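{- For integers $k\ge 3$, $\ell\in[2,k-1]$ and every $\varepsilon>0$, there exist $\eta>0$ and an integer $C>0$ such that the following holds for all sufficiently large $n$ divisible by $k-\ell$. Suppose $H$ is a $k$-graph on $n$ vertices with at least $\varepsilon n^k$ edges and $p=p(n)\ge n^{ -(k-\ell)-\eta}$. Then with high probability $H\cup G^{(k)}(n,p)$ contains a Hamilton $\ell$-cycle.
   Context: A $k$-graph is a hypergraph whose edges are $k$-element subsets of the vertex set. $G^{(k)}(n,p)$ is the binomial random $k$-graph on the vertex set of $H$, in which each $k$-subset is an edge independently with probability $p$; $H\cup G^{(k)}(n,p)$ has as edge set the union of the two edge sets. For $k>\ell\ge 1$, a $k$-uniform $\ell$-cycle is a $k$-graph whose vertices can be ordered cyclically $x_1,\dots,x_N$ such that each edge consists of $k$ consecutive vertices and any two consecutive edges intersect in exactly $\ell$ vertices; equivalently its edges are $\{x_{(k-\ell)i+1},\dots,x_{(k-\ell)i+k}\}$ for $i\in[N/(k-\ell)]$ (indices mod $N$). A Hamilton $\ell$-cycle in a $k$-graph is a spanning subgraph isomorphic to an $\ell$-cycle. "With high probability" means with probability tending to $1$ as $n\to\infty$.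
   Formalization: The density ε, the edge probability p and the error tolerance implicit in "with high probability" range over rational numbers instead of real numbers. -}

module Defs where

open import Data.Nat as ℕ using (ℕ; zero; suc; _∸_; _<_)
open import Data.Nat.DivMod using (_%_; m%n<n)
open import Data.Nat.Divisibility using (_∣_)
open import Data.Fin using (Fin; fromℕ<)
open import Data.Fin.Subset using (Subset; ∣_∣; ⁅_⁆; ⋃)
open import Data.Vec using ([]; _∷_)
open import Data.Bool using (Bool; true; false; if_then_else_)
open import Data.List as L using (List; []; _∷_; length; map; _++_; upTo; filterᵇ; foldr)
open import Data.List.Membership.Propositional using (_∈_)
open import Data.Rational using (ℚ; 0ℚ; 1ℚ; _*_; _-_; _+_)
open import Data.Integer using (+_)
open import Data.Product using (Σ; _×_)
open import Data.Sum using (_⊎_)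
open import Data.Empty using (⊥)
open import Function.Bundles using (_↔_; Inverse)
open import Relation.Binary.PropositionalEquality using (_≡_)

ℕ→ℚ : ℕ → ℚ
ℕ→ℚ n = Data.Rational._/_ (+ n) 1

_^ℚ_ : ℚ → ℕ → ℚ
x ^ℚ zero = 1ℚ
x ^ℚ suc m = x * (x ^ℚ m)

sumℚ : List ℚ → ℚ
sumℚ = foldr _+_ 0ℚ

allSubsets : (n : ℕ) → List (Subset n)
allSubsets zero = [] ∷ []
allSubsets (suc n) = map (true ∷_) (allSubsets n) ++ map (false ∷_) (allSubsets n)

kSets : (n k : ℕ) → List (Subset n)
kSets n k = filterᵇ (λ s → ∣ s ∣ ℕ.≡ᵇ k) (allSubsets n)

sublists : {A : Set} → List A → List (List A)
sublists [] = [] ∷ []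
sublists (x ∷ xs) = map (x ∷_) (sublists xs) ++ sublists xs

-- A k-graph on vertex set Fin n: a Boolean edge indicator on subsets;
-- only k-element subsets are regarded as (potential) edges.
KGraph : ℕ → Set
KGraph n = Subset n → Bool

numEdges : (n k : ℕ) → KGraph n → ℕ
numEdges n k H = length (filterᵇ H (kSets n k))

-- the i-th edge {x_{(k-ℓ)i+1}, …, x_{(k-ℓ)i+k}} (indices mod n) of the
-- cyclic vertex ordering σ (0-based here)
cycEdge : (k ℓ m : ℕ) → (Fin (suc m) ↔ Fin (suc m)) → ℕ → Subset (suc m)
cycEdge k ℓ m σ i =
  ⋃ (map (λ j → ⁅ Inverse.to σ (fromℕ< (m%n<n ((k ∸ ℓ) ℕ.* i ℕ.+ j) (suc m))) ⁆) (upTo k))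

HasHamCycle : (k ℓ n : ℕ) → (Subset n → Set) → Set
HasHamCycle k ℓ zero E = ⊥
HasHamCycle k ℓ (suc m) E =
  ((k ∸ ℓ) ∣ suc m) ×
  Σ (Fin (suc m) ↔ Fin (suc m)) (λ σ →
    (i : ℕ) → (k ∸ ℓ) ℕ.* i < suc m → E (cycEdge k ℓ m σ i))

UnionEdge : (n k : ℕ) → KGraph n → List (Subset n) → Subset n → Set
UnionEdge n k H L e = (∣ e ∣ ≡ k) × ((H e ≡ true) ⊎ (e ∈ L))

-- probability of an outcome L (edge list of G^(k)(n,p), a sublist of kSets n k)
weight : (n k : ℕ) → ℚ → List (Subset n) → ℚ
weight n k p L = (p ^ℚ length L) * ((1ℚ - p) ^ℚ (length (kSets n k) ∸ length L))

-- Pr[ H ∪ G^(k)(n,p) contains a Hamilton ℓ-cycle ] ≥ q :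
-- there is an event (set of outcomes, given by indicator f) all of whose
-- outcomes contain a Hamilton ℓ-cycle, whose probability is at least q.
HamProbAtLeast : (k ℓ n : ℕ) → KGraph n → ℚ → ℚ → Set
HamProbAtLeast k ℓ n H p q =
  Σ (List (Subset n) → Bool) (λ f →
    ((L : List (Subset n)) → L ∈ sublists (kSets n k) → f L ≡ true →
       HasHamCycle k ℓ n (UnionEdge n k H L)) ×
    (q Data.Rational.≤ sumℚ (map (λ L → if f L then weight n k p L else 0ℚ)
                                 (sublists (kSets n k)))))

-- A random Hamilton ℓ-cycle is built as follows. Put d = k − ℓ and choose one by one, each uniformly among
-- the available candidates, n / (dT) disjoint edges of H (T a large constant); they become the edges number
-- 0, T, 2T, … of the cycle, and the remaining vertices are placed by a uniformly random permutation. A set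
-- of v given vertices then lies in v given positions with probability at most (C / n)^v. For t edges to
-- appear among the other edges of the cycle, a forest spanning v of their vertices has to be placed, with n
-- choices per root and O(1) choices per further vertex. As runs of consecutive edges are interrupted every T
-- steps and ℓ ≥ 2, one can take v minus the number of roots at least dt + γ with t ≤ 4Tγ, so this has
-- probability at most (K n^(−d − 1/(4T)))^t: the edges that have to come from the random graph form a spread
-- family whose exponent beats that of p when η = 1 / (16T).
--
-- By the minimal fragment argument, exposing a random set W shrinks most members S of a spread family to
-- fragments S′ ∖ W, with S′ ⊆ S ∪ W in the family, that are smaller by a factor close to n^η. After 1/η rounds,
-- each of density ηp, nothing is left to cover. All probabilities are counted in ℕ, over a common denominator.

module Submission where

open import Defs
open import Data.Nat
open import Data.Nat.Properties
open import Data.Nat.DivMod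
open import Data.Nat.Divisibility using (_∣_; divides; _∣?_; ∣⇒≤; ∣m+n∣m⇒∣n; n∣m*n; m∣m*n)
open import Data.Nat.Tactic.RingSolver using (solve-∀)
import Data.Integer as ℤ
import Data.Integer.Properties as ℤ
open import Data.Rational using (ℚ; 0ℚ; 1ℚ; mkℚ; _-_) renaming (_≤_ to _≤ℚ_; _<_ to _<ℚ_; _*_ to _*ℚ_; _+_ to _+ℚ_)
import Data.Rational as ℚ
import Data.Rational.Properties as ℚ
open import Data.Rational.Solver using (module +-*-Solver)
open import Data.Rational.Unnormalised using (mkℚᵘ; *≡*; *≤*) renaming (_≃_ to _≃ᵘ_)
import Data.Rational.Unnormalised.Properties as ℚᵘ
open import Data.Bool using (Bool; true; false; if_then_else_)
import Data.Bool
import Data.Bool.Properties as Bool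
open import Data.Fin as Fin using (Fin; toℕ; fromℕ<)
import Data.Fin.Properties as Fin
open import Data.Fin.Subset using (Subset; _⊆_; _∪_; _─_; ⊥; ∣_∣; ⋃; ⁅_⁆) renaming (_∈_ to _∈ₛ_; _∉_ to _∉ₛ_)
open import Data.Fin.Subset.Properties
  using (_⊆?_; ⊆-refl; ⊆-trans; ⊆-antisym; drop-∷-⊆; out⊆; s⊆s; p⊆q⇒∣p∣≤∣q∣; ∣⊥∣≡0; p⊆p∪q; q⊆p∪q; x∈p∪q⁻; p─q⊆p; x∈⁅x⁆; x∈⁅y⁆⇒x≡y; ∉⊥; ∪-identityˡ)
open import Data.Vec using ([]; _∷_; here; there)
open import Data.Vec.Properties using (≡-dec)
open import Data.Maybe using (Maybe; just; nothing)
open import Data.List as List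
  using (List; []; _∷_; _++_; length; map; filter; filterᵇ; concatMap; catMaybes; allFin; upTo; take; drop; replicate)
import Data.List.Properties as List
open import Data.List.Extrema.Nat using (argmin; argmin-sel; f[argmin]≤f[xs])
open import Data.List.Membership.Propositional using (_∈_; _∉_; find; lose)
open import Data.List.Membership.Propositional.Properties
  using (∈-filter⁺; ∈-filter⁻; ∈-map⁻; ∈-map⁺; ∈-∃++; ∈-++⁺ˡ; ∈-++⁺ʳ; ∈-++⁻; ∈-concatMap⁻; ∈-concatMap⁺; ∈-allFin; ∈-upTo⁺; ∈-upTo⁻)
open import Data.List.Relation.Unary.All as All using (All; []; _∷_)
import Data.List.Relation.Unary.All.Properties as All
open import Data.List.Relation.Unary.Any as Any using (Any; here; there; index)
open import Data.List.Relation.Unary.AllPairs as AllPairs using (AllPairs; []; _∷_)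
import Data.List.Relation.Unary.AllPairs.Properties as AllPairs
open import Data.List.Relation.Unary.Unique.Propositional using (Unique)
import Data.List.Relation.Unary.Unique.Propositional.Properties as Unique
open import Data.List.Relation.Binary.Pointwise as Pointwise using (Pointwise; []; _∷_)
open import Data.List.Relation.Binary.Permutation.Propositional
  using (_↭_; ↭-refl; ↭-sym; ↭-trans; ↭-reflexive; ↭⇒↭ₛ; prep; swap)
open import Data.List.Relation.Binary.Permutation.Propositional.Properties using (∈-resp-↭; ↭-length; shift)
import Data.List.Relation.Binary.Permutation.Setoid.Properties as Permutation
open import Data.Product using (Σ; ∃; _×_; _,_; proj₁; proj₂; map₁; map₂)
open import Data.Sum using (_⊎_; inj₁; inj₂; [_,_]′)
import Data.Empty
open import Data.Empty using (⊥-elim)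
open import Function using (_∘_; id)
open import Function.Bundles using (_↔_; Inverse; mk↔ₛ′)
open import Relation.Nullary using (¬_; Dec; yes; no; does)
open import Relation.Nullary.Decidable using (¬?; _×-dec_; map′; decidable-stable)
open import Relation.Unary using (Decidable)
open import Relation.Binary.Definitions using (tri<; tri≈; tri>)
open import Relation.Binary.PropositionalEquality hiding ([_])

-- Sums over lists and over subsets

-- The obstacle is that the N = n / d edges of a whole Hamilton cycle span only n = dN vertices: a
-- uniformly random cycle is spread no better than about n^(-d) per edge, and nothing is gained over
-- the exponent -d. The edges taken from H cut the cycle into runs. A run of t edges covers dt + ℓ
-- vertices; its first vertex is the root, so ℓ - 1 vertices beyond dt remain as surplus, which is
-- positive because ℓ ≥ 2. Neighbouring runs may share vertices, so only about one unit of surplus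
-- per run is claimed. A run has boundedly many edges, so this is a fixed power of n per edge. Such
-- a polynomial gap between the spread and p is what keeps the probabilistic part short: every round
-- can shrink the fragments by a power of n, a constant number of rounds suffices, and no
-- logarithmic factors have to be balanced.

𝟙 : {P : Set} → Dec P → ℕ
𝟙 (yes _) = 1
𝟙 (no _) = 0

𝟙-mono : {P Q : Set} → (P → Q) → (p : Dec P) (q : Dec Q) → 𝟙 p ≤ 𝟙 q
𝟙-mono f (no _) q = z≤n
𝟙-mono f (yes p) (yes q) = ≤-refl
𝟙-mono f (yes p) (no ¬q) = ⊥-elim (¬q (f p))

𝟙≤1 : {P : Set} (p : Dec P) → 𝟙 p ≤ 1
𝟙≤1 (yes _) = ≤-refl
𝟙≤1 (no _) = z≤n

𝟙-¬? : {P : Set} (d : Dec P) → 𝟙 (¬? d) + 𝟙 d ≡ 1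
𝟙-¬? (yes _) = refl
𝟙-¬? (no _) = refl

∑ : {A : Set} → List A → (A → ℕ) → ℕ
∑ [] f = 0
∑ (x ∷ xs) f = f x + ∑ xs f

∑-mono : {A : Set} (xs : List A) {f g : A → ℕ} → (∀ x → x ∈ xs → f x ≤ g x) → ∑ xs f ≤ ∑ xs g
∑-mono [] h = z≤n
∑-mono (x ∷ xs) h = +-mono-≤ (h x (here refl)) (∑-mono xs (λ y → h y ∘ there))

∑-+ : {A : Set} (xs : List A) (f g : A → ℕ) → ∑ xs (λ x → f x + g x) ≡ ∑ xs f + ∑ xs g
∑-+ [] f g = refl
∑-+ (x ∷ xs) f g rewrite ∑-+ xs f g = lem (f x) (g x) (∑ xs f) (∑ xs g)
  where
  lem : ∀ a b c d → a + b + (c + d) ≡ a + c + (b + d)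
  lem = solve-∀

∑-*ʳ : {A : Set} (xs : List A) (f : A → ℕ) (c : ℕ) → ∑ xs (λ x → f x * c) ≡ ∑ xs f * c
∑-*ʳ [] f c = refl
∑-*ʳ (x ∷ xs) f c rewrite ∑-*ʳ xs f c = sym (*-distribʳ-+ c (f x) (∑ xs f))

∑-const : {A : Set} (xs : List A) (c : ℕ) → ∑ xs (λ _ → c) ≡ length xs * c
∑-const [] c = refl
∑-const (x ∷ xs) c = cong (c +_) (∑-const xs c)

∑-++ : {A : Set} (xs ys : List A) (f : A → ℕ) → ∑ (xs ++ ys) f ≡ ∑ xs f + ∑ ys f
∑-++ [] ys f = refl
∑-++ (x ∷ xs) ys f rewrite ∑-++ xs ys f = sym (+-assoc (f x) (∑ xs f) (∑ ys f))

∑-map : {A B : Set} (g : A → B) (xs : List A) (f : B → ℕ) → ∑ (map g xs) f ≡ ∑ xs (f ∘ g)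
∑-map g [] f = refl
∑-map g (x ∷ xs) f = cong (f (g x) +_) (∑-map g xs f)

length-filter-∑ : {A : Set} {P : A → Set} (P? : Decidable P) (xs : List A) →
  length (filter P? xs) ≡ ∑ xs (λ x → 𝟙 (P? x))
length-filter-∑ P? [] = refl
length-filter-∑ P? (x ∷ xs) with P? x
... | yes _ = cong suc (length-filter-∑ P? xs)
... | no _ = length-filter-∑ P? xs

*-^ : ∀ m n o → (m * n) ^ o ≡ m ^ o * n ^ o
*-^ m n zero = refl
*-^ m n (suc o) rewrite *-^ m n o = lem m n (m ^ o) (n ^ o)
  where
  lem : ∀ a b c d → a * b * (c * d) ≡ a * c * (b * d)
  lem = solve-∀

-- 𝔼 a c f is the sum of a^|W| c^(M∸|W|) f(W) over all W ⊆ [M]: up to the factor (a + c)^M it is the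
-- expectation of f at a random subset of density a / (a + c), and for a = c = 1 it is the plain sum.
𝔼 : ∀ {M} → ℕ → ℕ → (Subset M → ℕ) → ℕ
𝔼 {zero} a c f = f []
𝔼 {suc M} a c f = a * 𝔼 a c (λ W → f (true ∷ W)) + c * 𝔼 a c (λ W → f (false ∷ W))

𝔼-mono : ∀ {M} a c {f g : Subset M → ℕ} → (∀ W → f W ≤ g W) → 𝔼 a c f ≤ 𝔼 a c g
𝔼-mono {zero} a c h = h []
𝔼-mono {suc M} a c h =
  +-mono-≤ (*-monoʳ-≤ a (𝔼-mono a c (λ W → h (true ∷ W)))) (*-monoʳ-≤ c (𝔼-mono a c (λ W → h (false ∷ W))))

𝔼-cong : ∀ {M} a c {f g : Subset M → ℕ} → (∀ W → f W ≡ g W) → 𝔼 a c f ≡ 𝔼 a c g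
𝔼-cong {zero} a c h = h []
𝔼-cong {suc M} a c h =
  cong₂ _+_ (cong (a *_) (𝔼-cong a c (λ W → h (true ∷ W)))) (cong (c *_) (𝔼-cong a c (λ W → h (false ∷ W))))

𝔼-+ : ∀ {M} a c (f g : Subset M → ℕ) → 𝔼 a c (λ W → f W + g W) ≡ 𝔼 a c f + 𝔼 a c g
𝔼-+ {zero} a c f g = refl
𝔼-+ {suc M} a c f g
  rewrite 𝔼-+ a c (λ W → f (true ∷ W)) (λ W → g (true ∷ W))
        | 𝔼-+ a c (λ W → f (false ∷ W)) (λ W → g (false ∷ W)) = lem a c _ _ _ _
  where
  lem : ∀ a c x y z w → a * (x + y) + c * (z + w) ≡ a * x + c * z + (a * y + c * w)
  lem = solve-∀

𝔼-*ʳ : ∀ {M} a c (f : Subset M → ℕ) k → 𝔼 a c (λ W → f W * k) ≡ 𝔼 a c f * k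
𝔼-*ʳ {zero} a c f k = refl
𝔼-*ʳ {suc M} a c f k
  rewrite 𝔼-*ʳ a c (λ W → f (true ∷ W)) k | 𝔼-*ʳ a c (λ W → f (false ∷ W)) k = lem a c _ _ k
  where
  lem : ∀ a c x y k → a * (x * k) + c * (y * k) ≡ (a * x + c * y) * k
  lem = solve-∀

𝔼-const : ∀ M a c k → 𝔼 {M} a c (λ _ → k) ≡ (a + c) ^ M * k
𝔼-const zero a c k = sym (+-identityʳ k)
𝔼-const (suc M) a c k rewrite 𝔼-const M a c k = lem a c ((a + c) ^ M) k
  where
  lem : ∀ a c x k → a * (x * k) + c * (x * k) ≡ (a + c) * x * k
  lem = solve-∀

∑-𝔼-swap : ∀ {M} {A : Set} (xs : List A) a c (f : A → Subset M → ℕ) →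
  ∑ xs (λ x → 𝔼 a c (f x)) ≡ 𝔼 a c (λ W → ∑ xs (λ x → f x W))
∑-𝔼-swap {M} [] a c f = sym (trans (𝔼-const M a c 0) (*-zeroʳ ((a + c) ^ M)))
∑-𝔼-swap (x ∷ xs) a c f rewrite ∑-𝔼-swap xs a c f = sym (𝔼-+ a c (f x) _)

𝔼-swap : ∀ {M N} a c a′ c′ (f : Subset M → Subset N → ℕ) →
  𝔼 a c (λ W → 𝔼 a′ c′ (f W)) ≡ 𝔼 a′ c′ (λ T → 𝔼 a c (λ W → f W T))
𝔼-swap {zero} a c a′ c′ f = refl
𝔼-swap {suc M} a c a′ c′ f
  rewrite 𝔼-swap a c a′ c′ (λ W → f (true ∷ W)) | 𝔼-swap a c a′ c′ (λ W → f (false ∷ W)) =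
  trans (cong₂ _+_ (pull a (λ T → 𝔼 a c (λ W → f (true ∷ W) T))) (pull c (λ T → 𝔼 a c (λ W → f (false ∷ W) T)))) (sym (𝔼-+ {_} a′ c′ (λ T → a * 𝔼 a c (λ W → f (true ∷ W) T)) (λ T → c * 𝔼 a c (λ W → f (false ∷ W) T))))
  where
  pull : ∀ {N} k (g : Subset N → ℕ) → k * 𝔼 a′ c′ g ≡ 𝔼 a′ c′ (λ T → k * g T)
  pull k g = trans (*-comm k _) (trans (sym (𝔼-*ʳ a′ c′ g k)) (𝔼-cong a′ c′ (λ T → *-comm (g T) k)))

-- For a = c = 1 all weights are 1. This lets the one fragment that belongs to a pair (S, W) be
-- replaced by a sum over all candidates T, which can then be exchanged with the other sums.
𝔼₁-member : ∀ {M} (f : Subset M → ℕ) T → f T ≤ 𝔼 1 1 f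
𝔼₁-member f [] = ≤-refl
𝔼₁-member f (true ∷ T) =
  ≤-trans (𝔼₁-member (λ W → f (true ∷ W)) T) (≤-trans (m≤n*m _ 1) (m≤m+n _ _))
𝔼₁-member f (false ∷ T) =
  ≤-trans (𝔼₁-member (λ W → f (false ∷ W)) T) (≤-trans (m≤n*m _ 1) (m≤n+m (1 * 𝔼 1 1 (λ W → f (false ∷ W))) (1 * 𝔼 1 1 (λ W → f (true ∷ W)))))

Antitone : ∀ {M} → (Subset M → ℕ) → Set
Antitone f = ∀ {W W′} → W ⊆ W′ → f W′ ≤ f W

-- A set of density p₁ + p₂ is at least as likely to satisfy a monotone property as the union of
-- independent sets of densities p₁ and p₂.
𝔼-∪ : ∀ {M} a₁ a₂ c (f : Subset M → ℕ) → Antitone f →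
  𝔼 (a₁ + a₂) c f * (a₁ + a₂ + c) ^ M ≤ 𝔼 a₁ (a₂ + c) (λ W → 𝔼 a₂ (a₁ + c) (λ W′ → f (W ∪ W′)))
𝔼-∪ {zero} a₁ a₂ c f anti = ≤-reflexive (*-identityʳ _)
𝔼-∪ {suc M} a₁ a₂ c f anti = begin
    ((a₁ + a₂) * E₁ + c * E₀) * (b * b ^ M)
  ≡⟨ l₁ a₁ a₂ c E₁ E₀ b (b ^ M) ⟩
    b * ((a₁ + a₂) * (E₁ * b ^ M) + c * (E₀ * b ^ M))
  ≤⟨ *-monoʳ-≤ b (+-mono-≤ (*-monoʳ-≤ (a₁ + a₂) (𝔼-∪ {M} a₁ a₂ c _ (λ s → anti (s⊆s s))))
                           (*-monoʳ-≤ c (𝔼-∪ {M} a₁ a₂ c _ (λ s → anti (s⊆s s))))) ⟩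
    b * ((a₁ + a₂) * A + c * B)
  ≡⟨ l₂ a₁ a₂ c A B ⟩
    a₁ * a₂ * A + rest
  -- The union contains the current element with density p₁ + p₂ - p₁p₂ only. The excess weight a₁a₂
  -- moves from the outcome with the element to the one without it, where f is at least as large.
  ≤⟨ +-monoˡ-≤ rest (*-monoʳ-≤ (a₁ * a₂) A≤B) ⟩
    a₁ * a₂ * B + rest
  ≡⟨ l₃ a₁ a₂ c A B ⟩
    a₁ * (A * a₂ + A * (a₁ + c)) + (a₂ + c) * (A * a₂ + B * (a₁ + c))
  ≡⟨ sym (cong₂ (λ x y → a₁ * x + (a₂ + c) * y) (split (λ W W′ → f (true ∷ (W ∪ W′))) (λ W W′ → f (true ∷ (W ∪ W′)))) (split (λ W W′ → f (true ∷ (W ∪ W′))) (λ W W′ → f (false ∷ (W ∪ W′))))) ⟩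
    𝔼 a₁ (a₂ + c) (λ W → 𝔼 a₂ (a₁ + c) (λ W′ → f (W ∪ W′))) ∎
  where
  open ≤-Reasoning
  b = a₁ + a₂ + c
  E₁ = 𝔼 (a₁ + a₂) c (λ W → f (true ∷ W))
  E₀ = 𝔼 (a₁ + a₂) c (λ W → f (false ∷ W))
  A = 𝔼 a₁ (a₂ + c) (λ W → 𝔼 a₂ (a₁ + c) (λ W′ → f (true ∷ (W ∪ W′))))
  B = 𝔼 a₁ (a₂ + c) (λ W → 𝔼 a₂ (a₁ + c) (λ W′ → f (false ∷ (W ∪ W′))))
  A≤B : A ≤ B
  A≤B = 𝔼-mono {M} _ _ (λ W → 𝔼-mono {M} _ _ (λ W′ → anti (out⊆ ⊆-refl)))
  rest = (a₁ * a₁ + a₁ * a₂ + a₂ * a₂ + c * a₁ + c * a₂) * A + c * (a₁ + a₂ + c) * B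
  split : (g h : Subset M → Subset M → ℕ) →
    𝔼 a₁ (a₂ + c) (λ W → a₂ * 𝔼 a₂ (a₁ + c) (g W) + (a₁ + c) * 𝔼 a₂ (a₁ + c) (h W))
      ≡ 𝔼 a₁ (a₂ + c) (λ W → 𝔼 a₂ (a₁ + c) (g W)) * a₂ + 𝔼 a₁ (a₂ + c) (λ W → 𝔼 a₂ (a₁ + c) (h W)) * (a₁ + c)
  split g h = trans (𝔼-+ {M} a₁ (a₂ + c) (λ W → a₂ * G W) (λ W → (a₁ + c) * H W))
    (cong₂ _+_ (trans (𝔼-cong {M} a₁ (a₂ + c) (λ W → *-comm a₂ (G W))) (𝔼-*ʳ {M} a₁ (a₂ + c) G a₂))
               (trans (𝔼-cong {M} a₁ (a₂ + c) (λ W → *-comm (a₁ + c) (H W))) (𝔼-*ʳ {M} a₁ (a₂ + c) H (a₁ + c))))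
    where
    G = λ W → 𝔼 {M} a₂ (a₁ + c) (g W)
    H = λ W → 𝔼 {M} a₂ (a₁ + c) (h W)
  l₁ : ∀ a₁ a₂ c x y b p → ((a₁ + a₂) * x + c * y) * (b * p) ≡ b * ((a₁ + a₂) * (x * p) + c * (y * p))
  l₁ = solve-∀
  l₂ : ∀ a₁ a₂ c A B → (a₁ + a₂ + c) * ((a₁ + a₂) * A + c * B) ≡ a₁ * a₂ * A + ((a₁ * a₁ + a₁ * a₂ + a₂ * a₂ + c * a₁ + c * a₂) * A + c * (a₁ + a₂ + c) * B)
  l₂ = solve-∀
  l₃ : ∀ a₁ a₂ c A B → a₁ * a₂ * B + ((a₁ * a₁ + a₁ * a₂ + a₂ * a₂ + c * a₁ + c * a₂) * A + c * (a₁ + a₂ + c) * B) ≡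
    a₁ * (A * a₂ + A * (a₁ + c)) + (a₂ + c) * (A * a₂ + B * (a₁ + c))
  l₃ = solve-∀

-- Fragments

disjoint : ∀ {M} → Subset M → Subset M → ℕ
disjoint [] [] = 1
disjoint (true ∷ W) (true ∷ T) = 0
disjoint (true ∷ W) (false ∷ T) = disjoint W T
disjoint (false ∷ W) (t ∷ T) = disjoint W T

disjoint-─ : ∀ {M} (W S : Subset M) → disjoint W (S ─ W) ≡ 1
disjoint-─ [] [] = refl
disjoint-─ (true ∷ W) (s ∷ S) = disjoint-─ W S
disjoint-─ (false ∷ W) (s ∷ S) = disjoint-─ W S

-- A set W disjoint from T can be read off from W ∪ T, and its weight is (c / a)^|T| times that of W
-- ∪ T. The factor c is then enlarged to a + c, so that the exchange costs the inverse density for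
-- each element of T.
𝔼-shift : ∀ {M} a c (T : Subset M) (h : Subset M → ℕ) →
  𝔼 a c (λ W → disjoint W T * h (W ∪ T)) * a ^ ∣ T ∣ ≤ (a + c) ^ ∣ T ∣ * 𝔼 a c h
𝔼-shift a c [] h = ≤-reflexive (lem (h []))
  where
  lem : ∀ x → (x + 0) * 1 ≡ x + 0
  lem = solve-∀
𝔼-shift {suc M} a c (true ∷ T) h = begin
    (a * 𝔼 {M} a c (λ W → 0) + c * X) * (a * a ^ ∣ T ∣)
  ≡⟨ cong (λ z → (a * z + c * X) * (a * a ^ ∣ T ∣)) (trans (𝔼-const M a c 0) (*-zeroʳ ((a + c) ^ M))) ⟩
    (a * 0 + c * X) * (a * a ^ ∣ T ∣)
  ≡⟨ l₁ a c X (a ^ ∣ T ∣) ⟩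
    c * (a * (X * a ^ ∣ T ∣))
  ≤⟨ *-mono-≤ (m≤n+m c a) (*-monoʳ-≤ a (𝔼-shift a c T (λ W → h (true ∷ W)))) ⟩
    (a + c) * (a * ((a + c) ^ ∣ T ∣ * Y))
  ≡⟨ l₂ (a + c) a ((a + c) ^ ∣ T ∣) Y ⟩
    (a + c) * (a + c) ^ ∣ T ∣ * (a * Y)
  ≤⟨ *-monoʳ-≤ ((a + c) * (a + c) ^ ∣ T ∣) (m≤m+n (a * Y) _) ⟩
    (a + c) * (a + c) ^ ∣ T ∣ * 𝔼 a c h ∎
  where
  open ≤-Reasoning
  X = 𝔼 a c (λ W → disjoint W T * h (true ∷ (W ∪ T)))
  Y = 𝔼 a c (λ W → h (true ∷ W))
  l₁ : ∀ a c x y → (a * 0 + c * x) * (a * y) ≡ c * (a * (x * y))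
  l₁ = solve-∀
  l₂ : ∀ b a x y → b * (a * (x * y)) ≡ b * x * (a * y)
  l₂ = solve-∀
𝔼-shift {suc M} a c (false ∷ T) h = begin
    (a * X₁ + c * X₀) * a ^ ∣ T ∣
  ≡⟨ l₁ a c X₁ X₀ (a ^ ∣ T ∣) ⟩
    a * (X₁ * a ^ ∣ T ∣) + c * (X₀ * a ^ ∣ T ∣)
  ≤⟨ +-mono-≤ (*-monoʳ-≤ a (𝔼-shift a c T (λ W → h (true ∷ W)))) (*-monoʳ-≤ c (𝔼-shift a c T (λ W → h (false ∷ W)))) ⟩
    a * ((a + c) ^ ∣ T ∣ * 𝔼 {M} a c (λ W → h (true ∷ W))) + c * ((a + c) ^ ∣ T ∣ * 𝔼 {M} a c (λ W → h (false ∷ W)))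
  ≡⟨ l₂ a c ((a + c) ^ ∣ T ∣) _ _ ⟩
    (a + c) ^ ∣ T ∣ * 𝔼 a c h ∎
  where
  open ≤-Reasoning
  X₁ = 𝔼 a c (λ W → disjoint W T * h (true ∷ (W ∪ T)))
  X₀ = 𝔼 a c (λ W → disjoint W T * h (false ∷ (W ∪ T)))
  l₁ : ∀ a c x y z → (a * x + c * y) * z ≡ a * (x * z) + c * (y * z)
  l₁ = solve-∀
  l₂ : ∀ a c z x y → a * (z * x) + c * (z * y) ≡ z * (a * x + c * y)
  l₂ = solve-∀

-- The binomial theorem, with a factor w for each element of S outside T. Relative to w^|S| the
-- subsets then cost (1 + 1/w)^|S| instead of 2^|S|: a member w times as large as the fragment costs
-- only a constant per element of the fragment.
∑-subsets : ∀ {M} w (S : Subset M) → 𝔼 1 1 (λ T → 𝟙 (T ⊆? S) * w ^ ∣ S ─ T ∣) ≤ suc w ^ ∣ S ∣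
∑-subsets w [] = ≤-reflexive refl
∑-subsets {suc M} w (true ∷ S) = begin
    1 * 𝔼 {M} 1 1 (λ T → 𝟙 ((true ∷ T) ⊆? (true ∷ S)) * w ^ ∣ S ─ T ∣)
      + 1 * 𝔼 {M} 1 1 (λ T → 𝟙 ((false ∷ T) ⊆? (true ∷ S)) * (w * w ^ ∣ S ─ T ∣))
  ≤⟨ +-mono-≤ (*-monoʳ-≤ 1 (𝔼-mono {M} 1 1 (λ T → *-monoˡ-≤ (w ^ ∣ S ─ T ∣) (𝟙-mono drop-∷-⊆ ((true ∷ T) ⊆? (true ∷ S)) (T ⊆? S)))))
       (*-monoʳ-≤ 1 (𝔼-mono {M} 1 1 (λ T → ≤-trans (*-monoˡ-≤ (w * w ^ ∣ S ─ T ∣) (𝟙-mono drop-∷-⊆ ((false ∷ T) ⊆? (true ∷ S)) (T ⊆? S)))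
           (≤-reflexive (l₁ (𝟙 (T ⊆? S)) w (w ^ ∣ S ─ T ∣)))))) ⟩
    1 * X + 1 * 𝔼 {M} 1 1 (λ T → 𝟙 (T ⊆? S) * w ^ ∣ S ─ T ∣ * w)
  ≡⟨ cong (λ z → 1 * X + 1 * z) (𝔼-*ʳ {M} 1 1 (λ T → 𝟙 (T ⊆? S) * w ^ ∣ S ─ T ∣) w) ⟩
    1 * X + 1 * (X * w)
  ≡⟨ l₂ X w ⟩
    suc w * X
  ≤⟨ *-monoʳ-≤ (suc w) (∑-subsets w S) ⟩
    suc w * suc w ^ ∣ S ∣ ∎
  where
  open ≤-Reasoning
  X = 𝔼 {M} 1 1 (λ T → 𝟙 (T ⊆? S) * w ^ ∣ S ─ T ∣)
  l₁ : ∀ i w x → i * (w * x) ≡ i * x * w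
  l₁ = solve-∀
  l₂ : ∀ x w → 1 * x + 1 * (x * w) ≡ suc w * x
  l₂ = solve-∀
∑-subsets {suc M} w (false ∷ S) = begin
    1 * 𝔼 {M} 1 1 (λ T → 𝟙 ((true ∷ T) ⊆? (false ∷ S)) * w ^ ∣ S ─ T ∣) + 1 * Y
  ≤⟨ +-monoˡ-≤ (1 * Y) (*-monoʳ-≤ 1 (𝔼-mono {M} 1 1 (λ T → ≤-reflexive (cong (_* w ^ ∣ S ─ T ∣) (none T ((true ∷ T) ⊆? (false ∷ S))))))) ⟩
    1 * 𝔼 {M} 1 1 (λ T → 0) + 1 * Y
  ≡⟨ cong₂ _+_ (trans (*-identityˡ _) (trans (𝔼-const M 1 1 0) (*-zeroʳ (2 ^ M)))) (*-identityˡ Y) ⟩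
    Y
  ≤⟨ 𝔼-mono {M} 1 1 (λ T → *-monoˡ-≤ (w ^ ∣ S ─ T ∣) (𝟙-mono drop-∷-⊆ ((false ∷ T) ⊆? (false ∷ S)) (T ⊆? S))) ⟩
    𝔼 {M} 1 1 (λ T → 𝟙 (T ⊆? S) * w ^ ∣ S ─ T ∣)
  ≤⟨ ∑-subsets w S ⟩
    suc w ^ ∣ S ∣ ∎
  where
  open ≤-Reasoning
  Y = 𝔼 {M} 1 1 (λ T → 𝟙 ((false ∷ T) ⊆? (false ∷ S)) * w ^ ∣ S ─ T ∣)
  none : ∀ T → (d : Dec ((true ∷ T) ⊆ (false ∷ S))) → 𝟙 d ≡ 0
  none T (no _) = refl
  none T (yes p) with p here
  ... | ()

∈-─⁻ : ∀ {M} {p q : Subset M} {x} → x ∈ₛ (p ─ q) → x ∈ₛ p × x ∉ₛ q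
∈-─⁻ {p = _ ∷ p} {q = false ∷ q} here = here , λ ()
∈-─⁻ {p = _ ∷ p} {q = true ∷ q} (there m) with ∈-─⁻ {p = p} {q = q} m
... | a , b = there a , λ { (there c) → b c }
∈-─⁻ {p = _ ∷ p} {q = false ∷ q} (there m) with ∈-─⁻ {p = p} {q = q} m
... | a , b = there a , λ { (there c) → b c }

⊆-∪⇒─-⊆ : ∀ {M} {p q r : Subset M} → p ⊆ (q ∪ r) → (p ─ r) ⊆ q
⊆-∪⇒─-⊆ {q = q} {r} h m with ∈-─⁻ m
... | x∈p , x∉r = [ id , ⊥-elim ∘ x∉r ]′ (x∈p∪q⁻ q r (h x∈p))

⊆-─-∪ : ∀ {M} (p q : Subset M) → p ⊆ (q ∪ (p ─ q))
⊆-─-∪ (true ∷ p) (true ∷ q) here = here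
⊆-─-∪ (true ∷ p) (false ∷ q) here = here
⊆-─-∪ (_ ∷ p) (true ∷ q) (there m) = there (⊆-─-∪ p q m)
⊆-─-∪ (_ ∷ p) (false ∷ q) (there m) = there (⊆-─-∪ p q m)

⊆∧∣≥∣⇒⊇ : ∀ {M} (p q : Subset M) → p ⊆ q → ∣ q ∣ ≤ ∣ p ∣ → q ⊆ p
⊆∧∣≥∣⇒⊇ [] [] h l = id
⊆∧∣≥∣⇒⊇ (true ∷ p) (true ∷ q) h (s≤s l) = s⊆s (⊆∧∣≥∣⇒⊇ p q (drop-∷-⊆ h) l)
⊆∧∣≥∣⇒⊇ (true ∷ p) (false ∷ q) h l with h here
... | ()
⊆∧∣≥∣⇒⊇ (false ∷ p) (true ∷ q) h l = ⊥-elim (<⇒≱ l (p⊆q⇒∣p∣≤∣q∣ (drop-∷-⊆ h)))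
⊆∧∣≥∣⇒⊇ (false ∷ p) (false ∷ q) h l = s⊆s (⊆∧∣≥∣⇒⊇ p q (drop-∷-⊆ h) l)

∣─∣ : ∀ {M} (p q : Subset M) → q ⊆ p → ∣ q ∣ + ∣ p ─ q ∣ ≡ ∣ p ∣
∣─∣ [] [] h = refl
∣─∣ (true ∷ p) (true ∷ q) h = cong suc (∣─∣ p q (drop-∷-⊆ h))
∣─∣ (false ∷ p) (true ∷ q) h with h here
... | ()
∣─∣ (true ∷ p) (false ∷ q) h = trans (+-suc _ _) (cong suc (∣─∣ p q (drop-∷-⊆ h)))
∣─∣ (false ∷ p) (false ∷ q) h = ∣─∣ p q (drop-∷-⊆ h)

-- The member S′ ⊆ S ∪ W of the family with the fewest elements outside W, and what is left of it.
nearest : ∀ {M} → List (Subset M) → Subset M → Subset M → Subset M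
nearest fam S W = argmin (λ S′ → ∣ S′ ─ W ∣) S (filter (_⊆? (S ∪ W)) fam)

fragment : ∀ {M} → List (Subset M) → Subset M → Subset M → Subset M
fragment fam S W = nearest fam S W ─ W

-- What matters is that the choice depends on Z alone and not on the pair (S, W) behind it. The
-- value `⊥` is a dummy for a Z that contains no member.
cover : ∀ {M} → List (Subset M) → Subset M → Subset M
cover [] Z = ⊥
cover (S ∷ fam) Z with S ⊆? Z
... | yes _ = S
... | no _ = cover fam Z

cover-∈ : ∀ {M} (fam : List (Subset M)) {S Z} → S ∈ fam → S ⊆ Z → cover fam Z ∈ fam × cover fam Z ⊆ Z
cover-∈ (S ∷ fam) {_} {Z} S′∈ S′⊆ with S ⊆? Z
... | yes p = here refl , p
... | no ¬p with S′∈
... | here refl = ⊥-elim (¬p S′⊆)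
... | there m with cover-∈ fam m S′⊆
... | m′ , s = there m′ , s

cover-size : ∀ {M} {r} (fam : List (Subset M)) Z → (∀ S → S ∈ fam → ∣ S ∣ ≤ r) → ∣ cover fam Z ∣ ≤ r
cover-size {M} [] Z h = ≤-trans (≤-reflexive (∣⊥∣≡0 M)) z≤n
cover-size (S ∷ fam) Z h with S ⊆? Z
... | yes _ = h S (here refl)
... | no _ = cover-size fam Z (λ S′ → h S′ ∘ there)

nearest-∈ : ∀ {M} (fam : List (Subset M)) S W → S ∈ fam → nearest fam S W ∈ fam × nearest fam S W ⊆ (S ∪ W)
nearest-∈ fam S W S∈ with argmin-sel (λ S′ → ∣ S′ ─ W ∣) S (filter (_⊆? (S ∪ W)) fam)
... | inj₁ eq rewrite eq = S∈ , p⊆p∪q W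
... | inj₂ m = ∈-filter⁻ (_⊆? (S ∪ W)) m

nearest-min : ∀ {M} (fam : List (Subset M)) S W {S′} → S′ ∈ fam → S′ ⊆ (S ∪ W) →
  ∣ nearest fam S W ─ W ∣ ≤ ∣ S′ ─ W ∣
nearest-min fam S W m s =
  All.lookup (f[argmin]≤f[xs] {f = λ S′ → ∣ S′ ─ W ∣} S (filter (_⊆? (S ∪ W)) fam)) (∈-filter⁺ (_⊆? (S ∪ W)) m s)

fragment-⊆ : ∀ {M} (fam : List (Subset M)) S W → S ∈ fam → fragment fam S W ⊆ S
fragment-⊆ fam S W S∈ = ⊆-∪⇒─-⊆ (proj₂ (nearest-∈ fam S W S∈))

∪-⊆ : ∀ {M} {p q r : Subset M} → p ⊆ r → q ⊆ r → (p ∪ q) ⊆ r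
∪-⊆ {p = p} {q} f g m = [ f , g ]′ (x∈p∪q⁻ p q m)

-- By minimality the fragment T can be recovered, up to taking a subset, from W ∪ T alone.
fragment-⊆-cover : ∀ {M} (fam : List (Subset M)) S W → S ∈ fam →
  fragment fam S W ⊆ cover fam (W ∪ fragment fam S W)
fragment-⊆-cover fam S W S∈ =
  -- C ∖ W lies in T because C ⊆ W ∪ T, and it has at least as many elements because T is a smallest
  -- remainder. So T = C ∖ W.
  ⊆-trans (⊆∧∣≥∣⇒⊇ (C ─ W) T C─W⊆T (nearest-min fam S W C∈ C⊆S∪W)) (p─q⊆p C W)
  where
  T = fragment fam S W
  C = cover fam (W ∪ T)
  N∈ = proj₁ (nearest-∈ fam S W S∈)
  both = cover-∈ fam N∈ (⊆-─-∪ (nearest fam S W) W)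
  C∈ = proj₁ both
  C⊆S∪W : C ⊆ (S ∪ W)
  C⊆S∪W = ⊆-trans (proj₂ both) (∪-⊆ (q⊆p∪q S W) (⊆-trans (fragment-⊆ fam S W S∈) (p⊆p∪q W)))
  C─W⊆T : (C ─ W) ⊆ T
  C─W⊆T = ⊆-∪⇒─-⊆ (⊆-trans (proj₂ both) (∪-⊆ (q⊆p∪q T W) (p⊆p∪q W)))

-- At most Q (a / x)^|J| members contain J. Q is kept apart from the length of the family: fragments
-- are discarded from round to round, while the count stays measured against the original Q.
Spread : ∀ {M} → ℕ → ℕ → ℕ → List (Subset M) → Set
Spread x a Q fam = ∀ J → ∑ fam (λ S → 𝟙 (J ⊆? S)) * x ^ ∣ J ∣ ≤ Q * a ^ ∣ J ∣

-- Double counting: a pair (S, W) with fragment T is encoded by T, Z = W ∪ T and S. Given T, the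
-- spread bounds the number of S ⊇ T; given Z, the set T ranges over the subsets of `cover fam Z`.
-- In the parameter l * w * (a + c) the factor a + c pays for passing from W to Z, w for the
-- binomial weights and l for the moment.
fragment-moment : ∀ {M} a c w l r Q (fam : List (Subset M)) .{{_ : NonZero a}} →
  Spread (l * w * (a + c)) a Q fam → (∀ S → S ∈ fam → ∣ S ∣ ≤ r) →
  ∑ fam (λ S → 𝔼 a c (λ W → l ^ ∣ fragment fam S W ∣)) * w ^ r ≤ Q * ((a + c) ^ M * suc w ^ r)
fragment-moment {M} a@(suc _) c w l r Q fam spread size = begin
    ∑ fam (λ S → 𝔼 a c (λ W → l ^ ∣ fragment fam S W ∣)) * w ^ r
  ≡⟨ sym (trans (∑-𝔼-swap′) (∑-*ʳ fam _ (w ^ r))) ⟩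
    ∑ fam (λ S → 𝔼 a c (λ W → l ^ ∣ fragment fam S W ∣ * w ^ r))
  ≤⟨ ∑-mono fam (λ S S∈ → 𝔼-mono {M} a c (λ W → ≤-trans (pointwise S S∈ W) (𝔼₁-member (term S W) (fragment fam S W)))) ⟩
    ∑ fam (λ S → 𝔼 a c (λ W → 𝔼 1 1 (term S W)))
  ≡⟨ ∑-𝔼-swap fam a c (λ S W → 𝔼 1 1 (term S W)) ⟩
    𝔼 a c (λ W → ∑ fam (λ S → 𝔼 1 1 (term S W)))
  ≡⟨ 𝔼-cong {M} a c (λ W → ∑-𝔼-swap fam 1 1 (λ S → term S W)) ⟩
    𝔼 a c (λ W → 𝔼 1 1 (λ T → ∑ fam (λ S → term S W T)))
  ≡⟨ 𝔼-swap {M} {M} a c 1 1 (λ W T → ∑ fam (λ S → term S W T)) ⟩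
    𝔼 1 1 (λ T → 𝔼 a c (λ W → ∑ fam (λ S → term S W T)))
  ≤⟨ 𝔼-mono {M} 1 1 perT ⟩
    𝔼 1 1 (λ T → 𝔼 a c (h T) * Q)
  ≡⟨ 𝔼-*ʳ {M} 1 1 (λ T → 𝔼 a c (h T)) Q ⟩
    𝔼 1 1 (λ T → 𝔼 a c (h T)) * Q
  ≡⟨ cong (_* Q) (𝔼-swap {M} {M} 1 1 a c h) ⟩
    𝔼 a c (λ Z → 𝔼 1 1 (λ T → h T Z)) * Q
  ≤⟨ *-monoˡ-≤ Q (𝔼-mono {M} a c perZ) ⟩
    𝔼 {M} a c (λ Z → suc w ^ r) * Q
  ≡⟨ trans (cong (_* Q) (𝔼-const M a c (suc w ^ r))) (*-comm _ Q) ⟩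
    Q * ((a + c) ^ M * suc w ^ r) ∎
  where
  open ≤-Reasoning
  C = cover fam
  h : Subset M → Subset M → ℕ
  -- The last factor pads the weights, so that together with w^|T| every pair contributes exactly
  -- w^r whatever the size of `C Z`.
  h T Z = 𝟙 (T ⊆? C Z) * w ^ ∣ C Z ─ T ∣ * w ^ (r ∸ ∣ C Z ∣)
  term : Subset M → Subset M → Subset M → ℕ
  term S W T = 𝟙 (T ⊆? S) * (disjoint W T * h T (W ∪ T)) * (l * w) ^ ∣ T ∣
  ∑-𝔼-swap′ : ∑ fam (λ S → 𝔼 a c (λ W → l ^ ∣ fragment fam S W ∣ * w ^ r))
            ≡ ∑ fam (λ S → 𝔼 a c (λ W → l ^ ∣ fragment fam S W ∣) * w ^ r)
  ∑-𝔼-swap′ = go fam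
    where
    go : ∀ xs → ∑ xs (λ S → 𝔼 a c (λ W → l ^ ∣ fragment fam S W ∣ * w ^ r))
              ≡ ∑ xs (λ S → 𝔼 a c (λ W → l ^ ∣ fragment fam S W ∣) * w ^ r)
    go [] = refl
    go (S ∷ xs) = cong₂ _+_ (𝔼-*ʳ {M} a c (λ W → l ^ ∣ fragment fam S W ∣) (w ^ r)) (go xs)
  pointwise : ∀ S → S ∈ fam → ∀ W → l ^ ∣ fragment fam S W ∣ * w ^ r ≤ term S W (fragment fam S W)
  pointwise S S∈ W with fragment fam S W | fragment-⊆ fam S W S∈ | fragment-⊆-cover fam S W S∈ | disjoint-─ W (nearest fam S W)
  ... | T | T⊆S | T⊆C | dis with T ⊆? S | T ⊆? C (W ∪ T)
  ... | no ¬p | _ = ⊥-elim (¬p T⊆S)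
  ... | yes _ | no ¬p = ⊥-elim (¬p T⊆C)
  ... | yes _ | yes _ rewrite dis | *-^ l w ∣ T ∣ = ≤-reflexive (trans (cong (l ^ ∣ T ∣ *_) wr) (lem (l ^ ∣ T ∣) (w ^ ∣ T ∣) (w ^ ∣ D ─ T ∣) (w ^ (r ∸ ∣ D ∣))))
    where
    D = C (W ∪ T)
    wr : w ^ r ≡ w ^ ∣ T ∣ * (w ^ ∣ D ─ T ∣ * w ^ (r ∸ ∣ D ∣))
    wr = begin-equality
        w ^ r
      ≡⟨ cong (w ^_) (sym (m+[n∸m]≡n (cover-size fam (W ∪ T) size))) ⟩
        w ^ (∣ D ∣ + (r ∸ ∣ D ∣))
      ≡⟨ cong (λ z → w ^ (z + (r ∸ ∣ D ∣))) (sym (∣─∣ D T T⊆C)) ⟩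
        w ^ (∣ T ∣ + ∣ D ─ T ∣ + (r ∸ ∣ D ∣))
      ≡⟨ trans (^-distribˡ-+-* w (∣ T ∣ + ∣ D ─ T ∣) _) (cong (_* w ^ (r ∸ ∣ D ∣)) (^-distribˡ-+-* w ∣ T ∣ _)) ⟩
        w ^ ∣ T ∣ * w ^ ∣ D ─ T ∣ * w ^ (r ∸ ∣ D ∣)
      ≡⟨ *-assoc (w ^ ∣ T ∣) _ _ ⟩
        w ^ ∣ T ∣ * (w ^ ∣ D ─ T ∣ * w ^ (r ∸ ∣ D ∣)) ∎
    lem : ∀ a b x y → a * (b * (x * y)) ≡ 1 * (1 * (1 * x * y)) * (a * b)
    lem = solve-∀
  perT : ∀ T → 𝔼 a c (λ W → ∑ fam (λ S → term S W T)) ≤ 𝔼 a c (h T) * Q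
  perT T = *-cancelʳ-≤ _ _ (b ^ t * a ^ t) {{m*n≢0 (b ^ t) (a ^ t) {{m^n≢0 b t}} {{m^n≢0 a t}}}} (begin
      𝔼 a c (λ W → ∑ fam (λ S → term S W T)) * (b ^ t * a ^ t)
    ≡⟨ cong (_* (b ^ t * a ^ t)) (𝔼-cong {M} a c factor) ⟩
      𝔼 a c (λ W → disjoint W T * h T (W ∪ T) * (s * lw)) * (b ^ t * a ^ t)
    ≡⟨ cong (_* (b ^ t * a ^ t)) (𝔼-*ʳ {M} a c (λ W → disjoint W T * h T (W ∪ T)) (s * lw)) ⟩
      e * (s * lw) * (b ^ t * a ^ t)
    ≡⟨ l₁ e s lw (b ^ t) (a ^ t) ⟩
      s * (lw * b ^ t) * (e * a ^ t)
    ≡⟨ cong (λ z → s * z * (e * a ^ t)) (sym (*-^ (l * w) b t)) ⟩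
      s * (l * w * b) ^ t * (e * a ^ t)
    ≤⟨ *-mono-≤ (spread T) (𝔼-shift a c T (h T)) ⟩
      Q * a ^ t * (b ^ t * 𝔼 a c (h T))
    ≡⟨ l₂ Q (a ^ t) (b ^ t) _ ⟩
      𝔼 a c (h T) * Q * (b ^ t * a ^ t) ∎)
    where
    t = ∣ T ∣
    b = a + c
    s = ∑ fam (λ S → 𝟙 (T ⊆? S))
    lw = (l * w) ^ t
    e = 𝔼 a c (λ W → disjoint W T * h T (W ∪ T))
    l₁ : ∀ e s x b a → e * (s * x) * (b * a) ≡ s * (x * b) * (e * a)
    l₁ = solve-∀
    l₂ : ∀ q a b h → q * a * (b * h) ≡ h * q * (b * a)
    l₂ = solve-∀
    factor : ∀ W → ∑ fam (λ S → term S W T) ≡ disjoint W T * h T (W ∪ T) * (s * lw)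
    factor W = trans (∑-*ʳ fam _ lw) (trans (cong (_* lw) (∑-*ʳ fam _ _)) (l₃ s _ lw))
      where
      l₃ : ∀ s d x → s * d * x ≡ d * (s * x)
      l₃ = solve-∀
  perZ : ∀ Z → 𝔼 1 1 (λ T → h T Z) ≤ suc w ^ r
  perZ Z = begin
      𝔼 1 1 (λ T → h T Z)
    ≡⟨ 𝔼-*ʳ {M} 1 1 (λ T → 𝟙 (T ⊆? C Z) * w ^ ∣ C Z ─ T ∣) (w ^ (r ∸ ∣ C Z ∣)) ⟩
      𝔼 1 1 (λ T → 𝟙 (T ⊆? C Z) * w ^ ∣ C Z ─ T ∣) * w ^ (r ∸ ∣ C Z ∣)
    ≤⟨ *-mono-≤ (∑-subsets w (C Z)) (^-monoˡ-≤ (r ∸ ∣ C Z ∣) (n≤1+n w)) ⟩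
      suc w ^ ∣ C Z ∣ * suc w ^ (r ∸ ∣ C Z ∣)
    ≡⟨ sym (^-distribˡ-+-* (suc w) ∣ C Z ∣ _) ⟩
      suc w ^ (∣ C Z ∣ + (r ∸ ∣ C Z ∣))
    ≡⟨ cong (suc w ^_) (m+[n∸m]≡n (cover-size fam Z size)) ⟩
      suc w ^ r ∎

-- (w + 1)^w ≤ 4 w^w, from Bernoulli's inequality (1 − 1/(w + 1))^h ≥ 1 − h/(w + 1) ≥ 1/2 for 2h ≤ w + 1.
bernoulli : ∀ w h → suc w ^ h ≤ w ^ h + h * suc w ^ (h ∸ 1)
bernoulli w zero = ≤-refl
bernoulli w (suc zero) = ≤-reflexive (lem w)
  where
  lem : ∀ w → suc w * 1 ≡ w * 1 + 1 * 1
  lem = solve-∀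
bernoulli w (suc h@(suc h′)) = begin
    suc w * suc w ^ h
  ≡⟨⟩
    suc w ^ h + w * suc w ^ h
  ≤⟨ +-monoʳ-≤ (suc w ^ h) (*-monoʳ-≤ w (bernoulli w h)) ⟩
    suc w ^ h + w * (w ^ h + h * suc w ^ h′)
  ≡⟨ l₁ (suc w ^ h) w (w ^ h) h (suc w ^ h′) ⟩
    w * w ^ h + (suc w ^ h + h * (w * suc w ^ h′))
  ≤⟨ +-monoʳ-≤ (w * w ^ h) (+-monoʳ-≤ (suc w ^ h) (*-monoʳ-≤ h (*-monoˡ-≤ (suc w ^ h′) (n≤1+n w)))) ⟩
    w * w ^ h + (suc w ^ h + h * suc w ^ h) ∎
  where
  open ≤-Reasoning
  l₁ : ∀ x w y h z → x + w * (y + h * z) ≡ w * y + (x + h * (w * z))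
  l₁ = solve-∀

half-power : ∀ w h → 2 * h ≤ suc w → suc w ^ h ≤ 2 * w ^ h
half-power w zero h≤ = s≤s z≤n
half-power w h@(suc h′) h≤ = +-cancelʳ-≤ (suc w ^ h) _ _ (begin
    suc w ^ h + suc w ^ h
  ≡⟨ l₁ (suc w ^ h) ⟩
    2 * suc w ^ h
  ≤⟨ *-monoʳ-≤ 2 (bernoulli w h) ⟩
    2 * (w ^ h + h * suc w ^ h′)
  ≡⟨ l₂ (w ^ h) h (suc w ^ h′) ⟩
    2 * w ^ h + 2 * h * suc w ^ h′
  ≤⟨ +-monoʳ-≤ (2 * w ^ h) (*-monoˡ-≤ (suc w ^ h′) h≤) ⟩
    2 * w ^ h + suc w ^ h ∎)
  where
  open ≤-Reasoning
  l₁ : ∀ x → x + x ≡ 2 * x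
  l₁ = solve-∀
  l₂ : ∀ x h y → 2 * (x + h * y) ≡ 2 * x + 2 * h * y
  l₂ = solve-∀

[1+w]^h≤4w^h : ∀ w h → h ≤ w → suc w ^ h ≤ 4 * w ^ h
[1+w]^h≤4w^h w h h≤ = begin
    suc w ^ h
  ≡⟨ cong (suc w ^_) (sym (⌊n/2⌋+⌈n/2⌉≡n h)) ⟩
    suc w ^ (f + g)
  ≡⟨ ^-distribˡ-+-* (suc w) f g ⟩
    suc w ^ f * suc w ^ g
  ≤⟨ *-mono-≤ (half-power w f (≤-trans (*-monoʳ-≤ 2 (⌊n/2⌋≤⌈n/2⌉ h)) 2g≤)) (half-power w g 2g≤) ⟩
    2 * w ^ f * (2 * w ^ g)
  ≡⟨ trans (l₁ (w ^ f) (w ^ g)) (cong (4 *_) (sym (^-distribˡ-+-* w f g))) ⟩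
    4 * w ^ (f + g)
  ≡⟨ cong (λ z → 4 * w ^ z) (⌊n/2⌋+⌈n/2⌉≡n h) ⟩
    4 * w ^ h ∎
  where
  open ≤-Reasoning
  f = ⌊ h /2⌋
  g = ⌈ h /2⌉
  l₁ : ∀ x y → 2 * x * (2 * y) ≡ 4 * (x * y)
  l₁ = solve-∀
  2g≤ : 2 * g ≤ suc w
  2g≤ = begin
      g + (g + 0)
    ≡⟨ cong (g +_) (+-identityʳ g) ⟩
      g + g
    ≤⟨ +-monoʳ-≤ g (⌊n/2⌋≤⌈n/2⌉ (suc h)) ⟩
      g + ⌈ suc h /2⌉
    ≡⟨ ⌊n/2⌋+⌈n/2⌉≡n (suc h) ⟩
      suc h
    ≤⟨ s≤s h≤ ⟩
      suc w ∎

-- Serves to weaken the Markov bound (4 / l)^t to 4 / l, uniformly in t ≥ 1.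
^-exchange : ∀ {m n} t .{{_ : NonZero t}} → m ≤ n → m ^ t * n ≤ n ^ t * m
^-exchange {m} {n} (suc t) m≤n = begin
    m * m ^ t * n
  ≤⟨ *-monoˡ-≤ n (*-monoʳ-≤ m (^-monoˡ-≤ t m≤n)) ⟩
    m * n ^ t * n
  ≡⟨ lem m (n ^ t) n ⟩
    n * n ^ t * m ∎
  where
  open ≤-Reasoning
  lem : ∀ a b c → a * b * c ≡ c * b * a
  lem = solve-∀

-- Markov's inequality for l to the size of the fragment. For members of size at most wt the factor
-- (1 + 1/w)^(wt) in the moment is at most 4^t, so that large fragments make up at most (4 / l)^t of
-- Q.
fragment-large : ∀ {M} a c w l t Q (fam : List (Subset M)) .{{_ : NonZero a}} .{{_ : NonZero w}} .{{_ : NonZero t}} →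
  4 ≤ l → Spread (l * w * (a + c)) a Q fam → (∀ S → S ∈ fam → ∣ S ∣ ≤ w * t) →
  ∑ fam (λ S → 𝔼 a c (λ W → 𝟙 (t ≤? ∣ fragment fam S W ∣))) * l ≤ 4 * Q * (a + c) ^ M
fragment-large {M} a c w l@(suc _) t Q fam 4≤l spread size = *-cancelʳ-≤ _ _ (4 ^ t) {{m^n≢0 4 t}} (begin
    bad * l * 4 ^ t
  ≡⟨ l₁ bad l (4 ^ t) ⟩
    bad * (4 ^ t * l)
  ≤⟨ *-monoʳ-≤ bad (^-exchange t 4≤l) ⟩
    bad * (l ^ t * 4)
  ≡⟨ sym (*-assoc bad _ 4) ⟩
    bad * l ^ t * 4
  ≤⟨ *-monoˡ-≤ 4 markov ⟩
    X * 4
  ≤⟨ *-monoˡ-≤ 4 moment ⟩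
    Q * (b ^ M * 4 ^ t) * 4
  ≡⟨ l₂ Q (b ^ M) (4 ^ t) ⟩
    4 * Q * b ^ M * 4 ^ t ∎)
  where
  open ≤-Reasoning
  b = a + c
  bad = ∑ fam (λ S → 𝔼 a c (λ W → 𝟙 (t ≤? ∣ fragment fam S W ∣)))
  X = ∑ fam (λ S → 𝔼 a c (λ W → l ^ ∣ fragment fam S W ∣))
  l₁ : ∀ x l y → x * l * y ≡ x * (y * l)
  l₁ = solve-∀
  l₂ : ∀ q b x → q * (b * x) * 4 ≡ 4 * q * b * x
  l₂ = solve-∀
  indicator : ∀ s → 𝟙 (t ≤? s) * l ^ t ≤ l ^ s
  indicator s with t ≤? s
  ... | yes t≤s = ≤-trans (≤-reflexive (*-identityˡ _)) (^-monoʳ-≤ l t≤s)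
  ... | no _ = z≤n
  markov : bad * l ^ t ≤ X
  markov = ≤-trans (≤-reflexive (sym (∑-*ʳ fam _ (l ^ t))))
    (∑-mono fam (λ S _ → ≤-trans (≤-reflexive (sym (𝔼-*ʳ {M} a c (λ W → 𝟙 (t ≤? ∣ fragment fam S W ∣)) (l ^ t))))
                                 (𝔼-mono {M} a c (λ W → indicator ∣ fragment fam S W ∣))))
  moment : X ≤ Q * (b ^ M * 4 ^ t)
  moment = *-cancelʳ-≤ _ _ (w ^ (w * t)) {{m^n≢0 w (w * t)}} (begin
      X * w ^ (w * t)
    ≤⟨ fragment-moment a c w l (w * t) Q fam spread size ⟩
      Q * (b ^ M * suc w ^ (w * t))
    ≡⟨ cong (λ z → Q * (b ^ M * z)) (sym (^-*-assoc (suc w) w t)) ⟩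
      Q * (b ^ M * (suc w ^ w) ^ t)
    ≤⟨ *-monoʳ-≤ Q (*-monoʳ-≤ (b ^ M) (^-monoˡ-≤ t ([1+w]^h≤4w^h w w ≤-refl))) ⟩
      Q * (b ^ M * (4 * w ^ w) ^ t)
    ≡⟨ cong (λ z → Q * (b ^ M * z)) (trans (*-^ 4 (w ^ w) t) (cong (4 ^ t *_) (^-*-assoc w w t))) ⟩
      Q * (b ^ M * (4 ^ t * w ^ (w * t)))
    ≡⟨ l₃ Q (b ^ M) (4 ^ t) _ ⟩
      Q * (b ^ M * 4 ^ t) * w ^ (w * t) ∎)
    where
    l₃ : ∀ q b x y → q * (b * (x * y)) ≡ q * (b * x) * y
    l₃ = solve-∀

-- Iterating the fragments until a member is covered

avoids : ∀ {M} → List (Subset M) → Subset M → ℕ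
avoids [] W = 1
avoids (S ∷ fam) W with S ⊆? W
... | yes _ = 0
... | no _ = avoids fam W

avoids-cases : ∀ {M} (fam : List (Subset M)) W →
  (avoids fam W ≡ 0 × ∃ λ S → S ∈ fam × S ⊆ W) ⊎ (avoids fam W ≡ 1 × (∀ S → S ∈ fam → ¬ (S ⊆ W)))
avoids-cases [] W = inj₂ (refl , λ _ ())
avoids-cases (S ∷ fam) W with S ⊆? W
... | yes p = inj₁ (refl , S , here refl , p)
... | no ¬p with avoids-cases fam W
... | inj₁ (e , S′ , m , s) = inj₁ (e , S′ , there m , s)
... | inj₂ (e , h) = inj₂ (e , λ { S′ (here refl) → ¬p ; S′ (there m) → h S′ m })

avoids-mono : ∀ {M} (fam fam′ : List (Subset M)) W W′ →
  (∀ S′ → S′ ∈ fam′ → S′ ⊆ W′ → ∃ λ S → S ∈ fam × S ⊆ W) → avoids fam W ≤ avoids fam′ W′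
avoids-mono fam fam′ W W′ h with avoids-cases fam W | avoids-cases fam′ W′
... | inj₁ (e , _) | _ rewrite e = z≤n
... | inj₂ (e , k) | inj₂ (e′ , _) rewrite e | e′ = ≤-refl
... | inj₂ (e , k) | inj₁ (_ , S′ , m , s) with h S′ m s
... | S , m′ , s′ = ⊥-elim (k S m′ s′)

avoids≤1 : ∀ {M} (fam : List (Subset M)) W → avoids fam W ≤ 1
avoids≤1 fam W with avoids-cases fam W
... | inj₁ (e , _) rewrite e = z≤n
... | inj₂ (e , _) rewrite e = ≤-refl

avoids-antitone : ∀ {M} (fam : List (Subset M)) → Antitone (avoids fam)
avoids-antitone fam {W} {W′} W⊆W′ = avoids-mono fam fam W′ W (λ S m s → S , m , ⊆-trans s W⊆W′)

length-split : {A : Set} (f : A → ℕ) (t : ℕ) (xs : List A) →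
  length xs ≡ ∑ xs (λ x → 𝟙 (f x <? t)) + ∑ xs (λ x → 𝟙 (t ≤? f x))
length-split f t [] = refl
length-split f t (x ∷ xs) with f x <? t | t ≤? f x
... | yes p | yes q = ⊥-elim (<⇒≱ p q)
... | yes _ | no _ = cong suc (length-split f t xs)
... | no _ | yes _ = trans (cong suc (length-split f t xs)) (sym (+-suc _ _))
... | no p | no q = ⊥-elim (q (≮⇒≥ p))

∑-filter-map-≤ : {A B : Set} {P : B → Set} (P? : Decidable P) (g : A → B) (f : B → ℕ) (xs : List A) →
  ∑ (filter P? (map g xs)) f ≤ ∑ xs (f ∘ g)
∑-filter-map-≤ P? g f [] = z≤n
∑-filter-map-≤ P? g f (x ∷ xs) with P? (g x)
... | yes _ = +-monoʳ-≤ (f (g x)) (∑-filter-map-≤ P? g f xs)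
... | no _ = ≤-trans (∑-filter-map-≤ P? g f xs) (m≤n+m _ (f (g x)))

-- Each of the j rounds exposes a random set of density a / b and replaces every member of the family
-- by its fragment, which shrinks the members by a factor w except for a small proportion of them.
spread-avoids : ∀ {M} a b w l Q .{{_ : NonZero a}} .{{_ : NonZero w}} → 4 ≤ l → ∀ j c → j * a + c ≡ b →
  (fam : List (Subset M)) → Spread (l * w * b) a Q fam → (∀ S → S ∈ fam → ∣ S ∣ < w ^ j) →
  𝔼 (j * a) c (avoids fam) * (length fam * l) ≤ j * (4 * Q * b ^ M)
-- With no rounds left the sizes are below w^0 = 1, so the members are empty and lie in every set.
-- An empty family is harmless because its length is a factor on the left.
spread-avoids {M} a b w l Q 4≤l zero c eq [] spread size =
  ≤-reflexive (*-zeroʳ (𝔼 {M} 0 c (avoids [])))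
spread-avoids {M} a b w l Q 4≤l zero c eq fam@(S₀ ∷ _) spread size = ≤-trans (*-monoˡ-≤ (length fam * l) 𝔼≤0) z≤n
  where
  ∅⊆ : ∀ {M} (S : Subset M) → ∣ S ∣ ≡ 0 → ∀ {W} → S ⊆ W
  ∅⊆ (false ∷ S) e {w ∷ W} (there m) = there (∅⊆ S e m)
  ∅⊆ (true ∷ S) () here
  𝔼≤0 : 𝔼 {M} 0 c (avoids fam) ≤ 0
  𝔼≤0 = ≤-trans (𝔼-mono {M} 0 c (λ W → zero-at W)) (≤-reflexive (trans (𝔼-const M 0 c 0) (*-zeroʳ (c ^ M))))
    where
    zero-at : ∀ W → avoids fam W ≤ 0
    zero-at W with avoids-cases fam W
    ... | inj₁ (e , _) = ≤-reflexive e
    ... | inj₂ (_ , h) = ⊥-elim (h S₀ (here refl) (∅⊆ S₀ (n<1⇒n≡0 (size S₀ (here refl)))))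
spread-avoids {M} a b w l Q 4≤l (suc j) c refl fam spread size = *-cancelʳ-≤ _ _ B {{m^n≢0 b M {{b≢0}}}} (begin
    𝔼 (a + j * a) c (avoids fam) * (L * l) * B
  ≡⟨ l₁ (𝔼 (a + j * a) c (avoids fam)) (L * l) B ⟩
    𝔼 (a + j * a) c (avoids fam) * B * (L * l)
  ≤⟨ *-monoˡ-≤ (L * l) (𝔼-∪ a (j * a) c (avoids fam) (avoids-antitone fam)) ⟩
    𝔼 a (j * a + c) (λ W → F W) * (L * l)
  ≡⟨ sym (𝔼-*ʳ {M} a (j * a + c) F (L * l)) ⟩
    𝔼 a (j * a + c) (λ W → F W * (L * l))
  ≤⟨ 𝔼-mono {M} a (j * a + c) round ⟩
    𝔼 a (j * a + c) (λ W → bad W * (l * B) + j * (4 * Q * B))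
  ≡⟨ trans (𝔼-+ {M} a (j * a + c) (λ W → bad W * (l * B)) (λ _ → j * (4 * Q * B)))
       (cong₂ _+_ (𝔼-*ʳ {M} a (j * a + c) bad (l * B)) (𝔼-const M a (j * a + c) _)) ⟩
    𝔼 a (j * a + c) bad * (l * B) + (a + (j * a + c)) ^ M * (j * (4 * Q * B))
  ≡⟨ cong₂ _+_ (sym (*-assoc (𝔼 a (j * a + c) bad) l B)) (cong (λ z → z ^ M * (j * (4 * Q * B))) (sym (+-assoc a (j * a) c))) ⟩
    𝔼 a (j * a + c) bad * l * B + B * (j * (4 * Q * B))
  ≤⟨ +-monoˡ-≤ _ (*-monoˡ-≤ B large) ⟩
    4 * Q * B * B + B * (j * (4 * Q * B))
  ≡⟨ l₂ (4 * Q * B) j B ⟩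
    (4 * Q * B + j * (4 * Q * B)) * B ∎)
  where
  open ≤-Reasoning
  b≢0 : NonZero b
  b≢0 = >-nonZero (≤-trans (>-nonZero⁻¹ a) (≤-trans (m≤m+n a (j * a)) (m≤m+n _ c)))
  B = b ^ M
  L = length fam
  t = w ^ j
  instance
    t≢0 : NonZero t
    t≢0 = m^n≢0 w j
  F : Subset M → ℕ
  F W = 𝔼 (j * a) (a + c) (λ W′ → avoids fam (W ∪ W′))
  bad : Subset M → ℕ
  bad W = ∑ fam (λ S → 𝟙 (t ≤? ∣ fragment fam S W ∣))
  next : Subset M → List (Subset M)
  next W = filter (λ T → ∣ T ∣ <? t) (map (λ S → fragment fam S W) fam)
  l₁ : ∀ x y z → x * y * z ≡ x * z * y
  l₁ = solve-∀
  l₂ : ∀ x j z → x * z + z * (j * x) ≡ (x + j * x) * z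
  l₂ = solve-∀
  large : 𝔼 a (j * a + c) bad * l ≤ 4 * Q * B
  large = subst₂ _≤_ (cong (_* l) (∑-𝔼-swap fam a (j * a + c) (λ S W → 𝟙 (t ≤? ∣ fragment fam S W ∣))))
    (cong (λ z → 4 * Q * z ^ M) (sym (+-assoc a (j * a) c)))
    (fragment-large a (j * a + c) w l t Q fam 4≤l
      (subst (λ z → Spread (l * w * z) a Q fam) (+-assoc a (j * a) c) spread) (λ S m → <⇒≤ (size S m)))
  next-length : ∀ W → length (next W) ≡ ∑ fam (λ S → 𝟙 (∣ fragment fam S W ∣ <? t))
  next-length W = trans (length-filter-∑ (λ T → ∣ T ∣ <? t) (map (λ S → fragment fam S W) fam)) (∑-map (λ S → fragment fam S W) fam _)
  next-spread : ∀ W → Spread (l * w * b) a Q (next W)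
  next-spread W J = ≤-trans (*-monoˡ-≤ ((l * w * b) ^ ∣ J ∣) (≤-trans
      (∑-filter-map-≤ (λ T → ∣ T ∣ <? t) (λ S → fragment fam S W) (λ S → 𝟙 (J ⊆? S)) fam)
      (∑-mono fam (λ S m → 𝟙-mono {J ⊆ fragment fam S W} {J ⊆ S} (λ J⊆ → ⊆-trans J⊆ (fragment-⊆ fam S W m)) (J ⊆? fragment fam S W) (J ⊆? S)))))
    (spread J)
  next-size : ∀ W S → S ∈ next W → ∣ S ∣ < t
  next-size W S m = proj₂ (∈-filter⁻ (λ T → ∣ T ∣ <? t) {xs = map (λ S → fragment fam S W) fam} m)
  next-covers : ∀ W W′ S′ → S′ ∈ next W → S′ ⊆ W′ → ∃ λ S → S ∈ fam × S ⊆ (W ∪ W′)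
  next-covers W W′ S′ m s with ∈-map⁻ (λ S → fragment fam S W) (proj₁ (∈-filter⁻ (λ T → ∣ T ∣ <? t) {xs = map (λ S → fragment fam S W) fam} m))
  ... | S , S∈ , refl = nearest fam S W , proj₁ (nearest-∈ fam S W S∈) ,
    ⊆-trans (⊆-─-∪ (nearest fam S W) W) (∪-⊆ (p⊆p∪q W′) (⊆-trans s (q⊆p∪q W W′)))
  jab : j * a + (a + c) ≡ b
  jab = lem (j * a) a c
    where
    lem : ∀ x a c → x + (a + c) ≡ a + x + c
    lem = solve-∀
  -- For fixed W the members are split by the size of their fragments. Those with a large fragment
  -- are charged with the trivial bound B for `F W`; the others form `next W`, to which the
  -- induction applies with the same spread, since fragments are subsets. Covering one of their
  -- fragments by W′ covers a member of `fam` by W ∪ W′.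
  round : ∀ W → F W * (L * l) ≤ bad W * (l * B) + j * (4 * Q * B)
  round W = begin
      F W * (L * l)
    ≡⟨ cong (λ z → F W * (z * l)) (trans (length-split (λ S → ∣ fragment fam S W ∣) t fam) (trans (cong (_+ bad W) (sym (next-length W))) (+-comm _ (bad W)))) ⟩
      F W * ((bad W + length (next W)) * l)
    ≡⟨ l₃ (F W) (bad W) (length (next W)) l ⟩
      bad W * (l * F W) + F W * (length (next W) * l)
    ≤⟨ +-mono-≤ (*-monoʳ-≤ (bad W) (*-monoʳ-≤ l F≤B)) (*-monoˡ-≤ (length (next W) * l)
         (𝔼-mono {M} (j * a) (a + c) (λ W′ → avoids-mono fam (next W) (W ∪ W′) W′ (next-covers W W′)))) ⟩
      bad W * (l * B) + 𝔼 (j * a) (a + c) (avoids (next W)) * (length (next W) * l)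
    ≤⟨ +-monoʳ-≤ _ (spread-avoids a b w l Q 4≤l j (a + c) jab (next W) (next-spread W) (next-size W)) ⟩
      bad W * (l * B) + j * (4 * Q * B) ∎
    where
    l₃ : ∀ f x y l → f * ((x + y) * l) ≡ x * (l * f) + f * (y * l)
    l₃ = solve-∀
    F≤B : F W ≤ B
    F≤B = ≤-trans (𝔼-mono {M} (j * a) (a + c) (λ W′ → avoids≤1 fam (W ∪ W′)))
      (≤-reflexive (trans (𝔼-const M (j * a) (a + c) 1) (trans (*-identityʳ _) (cong (_^ M) jab))))

-- Orderings with prescribed entries

Unique-resp-↭ : {A : Set} {xs ys : List A} → xs ↭ ys → Unique xs → Unique ys
Unique-resp-↭ {A} p = Permutation.Unique-resp-↭ (setoid A) (↭⇒↭ₛ p)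

Unique-⊆-length : {A : Set} {xs ys : List A} → Unique xs → (∀ {x} → x ∈ xs → x ∈ ys) → length xs ≤ length ys
Unique-⊆-length {xs = []} u h = z≤n
Unique-⊆-length {xs = x ∷ xs} (x∉ ∷ u) h with ∈-∃++ (h (here refl))
... | as , bs , refl = begin
    suc (length xs)
  ≤⟨ s≤s (Unique-⊆-length u without) ⟩
    suc (length (as ++ bs))
  ≡⟨ ↭-length (↭-sym (shift x as bs)) ⟩
    length (as ++ x ∷ bs) ∎
  where
  open ≤-Reasoning
  without : ∀ {y} → y ∈ xs → y ∈ as ++ bs
  without {y} y∈ with ∈-resp-↭ (shift x as bs) (h (there y∈))
  ... | here refl = ⊥-elim (All.lookup x∉ y∈ refl)
  ... | there m = m

∑-concatMap : {A B : Set} (f : A → List B) (xs : List A) (g : B → ℕ) →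
  ∑ (concatMap f xs) g ≡ ∑ xs (λ x → ∑ (f x) g)
∑-concatMap f [] g = refl
∑-concatMap f (x ∷ xs) g = trans (∑-++ (f x) (concatMap f xs) g) (cong (∑ (f x) g +_) (∑-concatMap f xs g))

length-∑ : {A : Set} (xs : List A) → length xs ≡ ∑ xs (λ _ → 1)
length-∑ xs = sym (trans (∑-const xs 1) (*-identityʳ _))

∑-zero : {A : Set} (xs : List A) {f : A → ℕ} → (∀ x → x ∈ xs → f x ≡ 0) → ∑ xs f ≡ 0
∑-zero [] h = refl
∑-zero (x ∷ xs) h rewrite h x (here refl) = ∑-zero xs (λ y → h y ∘ there)

∑-cong : {A : Set} (xs : List A) {f g : A → ℕ} → (∀ x → x ∈ xs → f x ≡ g x) → ∑ xs f ≡ ∑ xs g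
∑-cong [] h = refl
∑-cong (x ∷ xs) h = cong₂ _+_ (h x (here refl)) (∑-cong xs (λ y → h y ∘ there))

𝟙-true : {P : Set} → P → (d : Dec P) → 𝟙 d ≡ 1
𝟙-true p (yes _) = refl
𝟙-true p (no ¬p) = ⊥-elim (¬p p)

𝟙-false : {P : Set} → ¬ P → (d : Dec P) → 𝟙 d ≡ 0
𝟙-false ¬p (yes p) = ⊥-elim (¬p p)
𝟙-false ¬p (no _) = refl

∑-𝟙-⊆ : {A : Set} {P : A → Set} (P? : Decidable P) (xs ys : List A) → Unique xs →
  (∀ {x} → x ∈ xs → P x → x ∈ ys) → ∑ xs (λ x → 𝟙 (P? x)) ≤ length ys
∑-𝟙-⊆ P? xs ys u h = ≤-trans (≤-reflexive (sym (length-filter-∑ P? xs)))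
  (Unique-⊆-length (Unique.filter⁺ P? u) (λ m → let (a , b) = ∈-filter⁻ P? {xs = xs} m in h a b))

data Match {A : Set} : List (Maybe A) → List A → Set where
  [] : Match [] []
  free : ∀ {ps y ys} → Match ps ys → Match (nothing ∷ ps) (y ∷ ys)
  fixed : ∀ {ps y ys} → Match ps ys → Match (just y ∷ ps) (y ∷ ys)

Match-++ : {A : Set} (ps : List (Maybe A)) {qs : List (Maybe A)} (ys : List A) {zs : List A} →
  length ps ≡ length ys → Match (ps ++ qs) (ys ++ zs) → Match ps ys × Match qs zs
Match-++ [] [] e m = [] , m
Match-++ (_ ∷ ps) (_ ∷ ys) e (free m) = map₁ free (Match-++ ps ys (suc-injective e) m)
Match-++ (_ ∷ ps) (_ ∷ ys) e (fixed m) = map₁ fixed (Match-++ ps ys (suc-injective e) m)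

Match-∈ : {A : Set} {ps : List (Maybe A)} {ys : List A} → Match ps ys → ∀ {u} → u ∈ catMaybes ps → u ∈ ys
Match-∈ (free m) i = there (Match-∈ m i)
Match-∈ (fixed m) (here refl) = here refl
Match-∈ (fixed m) (there i) = there (Match-∈ m i)

∣_∣⁺ : {A : Set} → List (Maybe A) → ℕ
∣ ps ∣⁺ = length (catMaybes ps)

module _ {n : ℕ} where
  match? : (ps : List (Maybe (Fin n))) (ys : List (Fin n)) → Dec (Match ps ys)
  match? [] [] = yes []
  match? [] (y ∷ ys) = no λ ()
  match? (p ∷ ps) [] = no λ ()
  match? (nothing ∷ ps) (y ∷ ys) = map′ free (λ { (free m) → m }) (match? ps ys)
  match? (just u ∷ ps) (y ∷ ys) with u Fin.≟ y
  ... | no u≢y = no λ { (fixed m) → u≢y refl }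
  ... | yes refl = map′ fixed (λ { (fixed m) → m }) (match? ps ys)

  matches : List (Maybe (Fin n)) → List (List (Fin n))
  matches [] = [] ∷ []
  matches (nothing ∷ ps) = concatMap (λ v → map (v ∷_) (matches ps)) (allFin n)
  matches (just u ∷ ps) = map (u ∷_) (matches ps)

  ∈-matches : ∀ {ps ys} → Match ps ys → ys ∈ matches ps
  ∈-matches [] = here refl
  ∈-matches {nothing ∷ ps} {y ∷ _} (free m) =
    ∈-concatMap⁺ (λ v → map (v ∷_) (matches ps)) (lose (∈-allFin y) (∈-map⁺ (y ∷_) (∈-matches m)))
  ∈-matches (fixed {y = y} m) = ∈-map⁺ (y ∷_) (∈-matches m)

  length-matches : ∀ ps → length (matches ps) * n ^ ∣ ps ∣⁺ ≡ n ^ length ps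
  length-matches [] = refl
  length-matches (nothing ∷ ps) = begin
      length (concatMap (λ v → map (v ∷_) (matches ps)) (allFin n)) * n ^ ∣ ps ∣⁺
    ≡⟨ cong (_* n ^ ∣ ps ∣⁺) (trans (length-∑ (concatMap (λ v → map (v ∷_) (matches ps)) (allFin n))) (trans (∑-concatMap (λ v → map (v ∷_) (matches ps)) (allFin n) (λ _ → 1))
         (∑-cong (allFin n) (λ v _ → trans (sym (length-∑ (map (v ∷_) (matches ps)))) (List.length-map (v ∷_) (matches ps)))))) ⟩
      ∑ (allFin n) (λ _ → length (matches ps)) * n ^ ∣ ps ∣⁺
    ≡⟨ cong (_* n ^ ∣ ps ∣⁺) (trans (∑-const (allFin n) _) (cong (_* length (matches ps)) (List.length-tabulate {n = n} id))) ⟩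
      n * length (matches ps) * n ^ ∣ ps ∣⁺
    ≡⟨ trans (*-assoc n _ _) (cong (n *_) (length-matches ps)) ⟩
      n * n ^ length ps ∎
    where open ≡-Reasoning
  length-matches (just u ∷ ps) = begin
      length (map (u ∷_) (matches ps)) * (n * n ^ ∣ ps ∣⁺)
    ≡⟨ cong (_* (n * n ^ ∣ ps ∣⁺)) (List.length-map (u ∷_) (matches ps)) ⟩
      length (matches ps) * (n * n ^ ∣ ps ∣⁺)
    ≡⟨ lem (length (matches ps)) n _ ⟩
      n * (length (matches ps) * n ^ ∣ ps ∣⁺)
    ≡⟨ cong (n *_) (length-matches ps) ⟩
      n * n ^ length ps ∎
    where
    open ≡-Reasoning
    lem : ∀ a b c → a * (b * c) ≡ b * (a * c)
    lem = solve-∀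

  ∑-match : ∀ ps (xs : List (List (Fin n))) → Unique xs →
    ∑ xs (λ ys → 𝟙 (match? ps ys)) * n ^ ∣ ps ∣⁺ ≤ n ^ length ps
  ∑-match ps xs u = ≤-trans (*-monoˡ-≤ (n ^ ∣ ps ∣⁺) (∑-𝟙-⊆ (match? ps) xs (matches ps) u (λ _ → ∈-matches)))
    (≤-reflexive (length-matches ps))

picks : {A : Set} → List A → List (A × List A)
picks [] = []
picks (y ∷ ys) = (y , ys) ∷ map (map₂ (y ∷_)) (picks ys)

map-proj₁-picks : {A : Set} (ys : List A) → map proj₁ (picks ys) ≡ ys
map-proj₁-picks [] = refl
map-proj₁-picks (y ∷ ys) = cong (y ∷_) (trans (sym (List.map-∘ (picks ys))) (map-proj₁-picks ys))

picks-↭ : {A : Set} (ys : List A) {y : A} {ys′ : List A} → (y , ys′) ∈ picks ys → y ∷ ys′ ↭ ys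
picks-↭ (y ∷ ys) (here refl) = ↭-refl
picks-↭ (y ∷ ys) (there m) with ∈-map⁻ (map₂ (y ∷_)) m
... | (z , zs) , m′ , refl = ↭-trans (swap z y ↭-refl) (prep y (picks-↭ ys m′))

perms : {A : Set} → ℕ → List A → List (List A)
perms zero ys = [] ∷ []
perms (suc R) ys = concatMap (λ yys → map (proj₁ yys ∷_) (perms R (proj₂ yys))) (picks ys)

∑-picks : {A : Set} (ys : List A) (f : A → ℕ) → ∑ (picks ys) (f ∘ proj₁) ≡ ∑ ys f
∑-picks ys f = trans (sym (∑-map proj₁ (picks ys) f)) (cong (λ z → ∑ z f) (map-proj₁-picks ys))

∑-perms : {A : Set} (R : ℕ) (ys : List A) (f : List A → ℕ) →
  ∑ (perms (suc R) ys) f ≡ ∑ (picks ys) (λ yys → ∑ (perms R (proj₂ yys)) (λ zs → f (proj₁ yys ∷ zs)))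
∑-perms R ys f = trans (∑-concatMap (λ yys → map (proj₁ yys ∷_) (perms R (proj₂ yys))) (picks ys) f)
  (∑-cong (picks ys) (λ yys _ → ∑-map (proj₁ yys ∷_) (perms R (proj₂ yys)) f))

picks-length : {A : Set} {R : ℕ} (ys : List A) {y : A} {ys′ : List A} → length ys ≡ suc R → (y , ys′) ∈ picks ys → length ys′ ≡ R
picks-length ys e m = suc-injective (trans (↭-length (picks-↭ ys m)) e)

perms-↭ : {A : Set} (R : ℕ) (ys : List A) → length ys ≡ R → ∀ {zs} → zs ∈ perms R ys → zs ↭ ys
perms-↭ zero [] e (here refl) = ↭-refl
perms-↭ (suc R) ys e m with find (∈-concatMap⁻ (λ yys → map (proj₁ yys ∷_) (perms R (proj₂ yys))) {xs = picks ys} m)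
... | (y , ys′) , m₁ , m₂ with ∈-map⁻ (y ∷_) m₂
... | zs , m₃ , refl = ↭-trans (prep y (perms-↭ R ys′ (picks-length ys e m₁) m₃)) (picks-↭ ys m₁)

length-perms : {A : Set} (R : ℕ) (ys : List A) → length ys ≡ R → length (perms R ys) ≡ R !
length-perms zero ys e = refl
length-perms (suc R) ys e = begin
    length (perms (suc R) ys)
  ≡⟨ trans (length-∑ (perms (suc R) ys)) (∑-perms R ys (λ _ → 1)) ⟩
    ∑ (picks ys) (λ yys → ∑ (perms R (proj₂ yys)) (λ _ → 1))
  ≡⟨ ∑-cong (picks ys) (λ yys m → trans (sym (length-∑ (perms R (proj₂ yys)))) (length-perms R (proj₂ yys) (picks-length ys e m))) ⟩
    ∑ (picks ys) (λ _ → R !)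
  ≡⟨ trans (∑-picks ys (λ _ → R !)) (trans (∑-const ys (R !)) (cong (_* R !) e)) ⟩
    suc R * R ! ∎
  where open ≡-Reasoning

module _ {n : ℕ} where
  open import Data.List.Membership.DecPropositional (Fin._≟_ {n}) using (_∈?_)

  perms-match-zero : ∀ R (ys : List (Fin n)) ps {u} → length ys ≡ R → u ∈ catMaybes ps → u ∉ ys →
    ∑ (perms R ys) (λ zs → 𝟙 (match? ps zs)) ≡ 0
  perms-match-zero R ys ps e u∈ u∉ = ∑-zero (perms R ys) (λ zs m →
    𝟙-false (λ mt → u∉ (∈-resp-↭ (perms-↭ R ys e m) (Match-∈ mt u∈))) (match? ps zs))

  outside-count : (ys js : List (Fin n)) → Unique ys → Unique js → (∀ {u} → u ∈ js → u ∈ ys) →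
    ∑ ys (λ y → 𝟙 (¬? (y ∈? js))) + length js ≤ length ys
  outside-count ys js uy uj h = begin
      ∑ ys (λ y → 𝟙 (¬? (y ∈? js))) + length js
    ≤⟨ +-monoʳ-≤ _ (Unique-⊆-length uj (λ m → ∈-filter⁺ (_∈? js) (h m) m)) ⟩
      ∑ ys (λ y → 𝟙 (¬? (y ∈? js))) + length (filter (_∈? js) ys)
    ≡⟨ cong (∑ ys (λ y → 𝟙 (¬? (y ∈? js))) +_) (length-filter-∑ (_∈? js) ys) ⟩
      ∑ ys (λ y → 𝟙 (¬? (y ∈? js))) + ∑ ys (λ y → 𝟙 (y ∈? js))
    ≡⟨ sym (∑-+ ys _ _) ⟩
      ∑ ys (λ y → 𝟙 (¬? (y ∈? js)) + 𝟙 (y ∈? js))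
    ≡⟨ ∑-cong ys (λ y _ → 𝟙-¬? (y ∈? js)) ⟩
      ∑ ys (λ _ → 1)
    ≡⟨ sym (length-∑ ys) ⟩
      length ys ∎
    where
    open ≤-Reasoning

  -- Induction on the slots. A prescribed first entry leaves one choice; a free one has to avoid the
  -- j vertices prescribed later, which leaves R + 1 - j choices and turns (R - j)! into (R + 1 -
  -- j)!.
  perms-match : ∀ R (ys : List (Fin n)) ps → length ys ≡ R → length ps ≡ R → Unique ys → Unique (catMaybes ps) →
    ∑ (perms R ys) (λ zs → 𝟙 (match? ps zs)) ≤ (R ∸ ∣ ps ∣⁺) !
  perms-match zero ys [] ey ep uy up = ≤-refl
  perms-match (suc R) ys (just u ∷ ps) ey ep uy (u∉ ∷ up) = begin
      ∑ (perms (suc R) ys) (λ zs → 𝟙 (match? (just u ∷ ps) zs))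
    ≡⟨ ∑-perms R ys _ ⟩
      ∑ (picks ys) (λ yys → ∑ (perms R (proj₂ yys)) (λ zs → 𝟙 (match? (just u ∷ ps) (proj₁ yys ∷ zs))))
    ≤⟨ ∑-mono (picks ys) each ⟩
      ∑ (picks ys) (λ yys → 𝟙 (u Fin.≟ proj₁ yys) * K)
    ≡⟨ trans (∑-picks ys (λ y → 𝟙 (u Fin.≟ y) * K)) (∑-*ʳ ys _ K) ⟩
      ∑ ys (λ y → 𝟙 (u Fin.≟ y)) * K
    ≤⟨ *-monoˡ-≤ K (∑-𝟙-⊆ (u Fin.≟_) ys (u ∷ []) uy (λ { _ refl → here refl })) ⟩
      1 * K
    ≡⟨ *-identityˡ K ⟩
      K ∎
    where
    open ≤-Reasoning
    K = (R ∸ ∣ ps ∣⁺) !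
    each : ∀ yys → yys ∈ picks ys → ∑ (perms R (proj₂ yys)) (λ zs → 𝟙 (match? (just u ∷ ps) (proj₁ yys ∷ zs))) ≤ 𝟙 (u Fin.≟ proj₁ yys) * K
    each (y , ys′) m with u Fin.≟ y
    ... | no u≢y = ≤-reflexive (∑-zero (perms R ys′) (λ zs _ → refl))
    ... | yes refl = begin
        ∑ (perms R ys′) (λ zs → 𝟙 (map′ fixed _ (match? ps zs)))
      ≤⟨ ∑-mono (perms R ys′) (λ zs _ → 𝟙-mono (λ { (fixed p) → p }) (map′ fixed _ (match? ps zs)) (match? ps zs)) ⟩
        ∑ (perms R ys′) (λ zs → 𝟙 (match? ps zs))
      ≤⟨ perms-match R ys′ ps (picks-length ys ey m) (suc-injective ep) (AllPairs.tail (Unique-resp-↭ (↭-sym (picks-↭ ys m)) uy)) up ⟩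
        K
      ≡⟨ sym (*-identityˡ K) ⟩
        1 * K ∎
  perms-match (suc R) ys (nothing ∷ ps) ey ep uy up with All.all? (_∈? ys) (catMaybes ps)
  -- A prescribed vertex that is no longer available makes the count zero. The bound R + 1 - j for a
  -- free slot relies on all of them being available.
  ... | no ¬all with find (All.¬All⇒Any¬ (_∈? ys) _ ¬all)
  ... | u , u∈ , u∉ = ≤-trans (≤-reflexive (perms-match-zero (suc R) ys (nothing ∷ ps) ey u∈ u∉)) z≤n
  perms-match (suc R) ys (nothing ∷ ps) ey ep uy up | yes all = begin
      ∑ (perms (suc R) ys) (λ zs → 𝟙 (match? (nothing ∷ ps) zs))
    ≡⟨ ∑-perms R ys _ ⟩
      ∑ (picks ys) (λ yys → ∑ (perms R (proj₂ yys)) (λ zs → 𝟙 (match? (nothing ∷ ps) (proj₁ yys ∷ zs))))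
    ≤⟨ ∑-mono (picks ys) each ⟩
      ∑ (picks ys) (λ yys → 𝟙 (¬? (proj₁ yys ∈? js)) * K)
    ≡⟨ trans (∑-picks ys (λ y → 𝟙 (¬? (y ∈? js)) * K)) (∑-*ʳ ys _ K) ⟩
      out * K
    ≤⟨ final out (≤-trans (outside-count ys js uy up (All.lookup all)) (≤-reflexive ey)) ⟩
      (suc R ∸ j) ! ∎
    where
    open ≤-Reasoning
    js = catMaybes ps
    j = length js
    K = (R ∸ j) !
    out = ∑ ys (λ y → 𝟙 (¬? (y ∈? js)))
    each : ∀ yys → yys ∈ picks ys → ∑ (perms R (proj₂ yys)) (λ zs → 𝟙 (match? (nothing ∷ ps) (proj₁ yys ∷ zs))) ≤ 𝟙 (¬? (proj₁ yys ∈? js)) * K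
    each (y , ys′) m with Unique-resp-↭ (↭-sym (picks-↭ ys m)) uy
    ... | y∉ ∷ uy′ with y ∈? js
    ... | yes y∈ = ≤-trans (∑-mono (perms R ys′) (λ zs _ → 𝟙-mono (λ { (free p) → p }) (match? (nothing ∷ ps) (y ∷ zs)) (match? ps zs)))
      (≤-reflexive (perms-match-zero R ys′ ps (picks-length ys ey m) y∈ (λ y∈′ → All.lookup y∉ y∈′ refl)))
    ... | no _ = ≤-trans (∑-mono (perms R ys′) (λ zs _ → 𝟙-mono (λ { (free p) → p }) (match? (nothing ∷ ps) (y ∷ zs)) (match? ps zs)))
      (≤-trans (perms-match R ys′ ps (picks-length ys ey m) (suc-injective ep) uy′ up) (≤-reflexive (sym (*-identityˡ K))))
    final : ∀ o → o + j ≤ suc R → o * K ≤ (suc R ∸ j) !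
    final zero _ = z≤n
    final (suc o) le = begin
        suc o * K
      ≤⟨ *-monoˡ-≤ K so≤ ⟩
        suc (R ∸ j) * K
      ≡⟨ cong _! (sym (+-∸-assoc 1 j≤R)) ⟩
        (suc R ∸ j) ! ∎
      where
      j≤R : j ≤ R
      j≤R = ≤-trans (m≤n+m j o) (s≤s⁻¹ le)
      so≤ : suc o ≤ suc (R ∸ j)
      so≤ = s≤s (m+n≤o⇒m≤o∸n o (s≤s⁻¹ le))

-- Each step lowers the base of the remaining power from R + 1 to R, at the cost of (1 + 1/R)^j ≤ 4
-- for j ≤ R. It compares R^j with the falling factorial R! / (R - j)!.
falling-bound : ∀ R j → j ≤ R → R ^ j * (R ∸ j) ! ≤ 4 ^ j * R !
falling-bound R zero _ = ≤-refl
falling-bound (suc R) (suc j) (s≤s j≤R) = begin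
    suc R * suc R ^ j * (R ∸ j) !
  ≤⟨ *-monoˡ-≤ ((R ∸ j) !) (*-monoʳ-≤ (suc R) ([1+w]^h≤4w^h R j j≤R)) ⟩
    suc R * (4 * R ^ j) * (R ∸ j) !
  ≡⟨ l₁ (suc R) (R ^ j) ((R ∸ j) !) ⟩
    4 * suc R * (R ^ j * (R ∸ j) !)
  ≤⟨ *-monoʳ-≤ (4 * suc R) (falling-bound R j j≤R) ⟩
    4 * suc R * (4 ^ j * R !)
  ≡⟨ l₂ (suc R) (4 ^ j) (R !) ⟩
    4 * 4 ^ j * (suc R * R !) ∎
  where
  open ≤-Reasoning
  l₁ : ∀ r x y → r * (4 * x) * y ≡ 4 * r * (x * y)
  l₁ = solve-∀
  l₂ : ∀ r x y → 4 * r * (x * y) ≡ 4 * x * (r * y)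
  l₂ = solve-∀

-- Blocks chosen one after the other, followed by a permutation

nth : {A : Set} → A → List A → ℕ → A
nth z [] s = z
nth z (x ∷ xs) zero = x
nth z (x ∷ xs) (suc s) = nth z xs s

nth-++ˡ : {A : Set} {z : A} (xs ys : List A) {s : ℕ} → s < length xs → nth z (xs ++ ys) s ≡ nth z xs s
nth-++ˡ (x ∷ xs) ys {zero} _ = refl
nth-++ˡ (x ∷ xs) ys {suc s} (s≤s l) = nth-++ˡ xs ys l

nth-++ʳ : {A : Set} {z : A} (xs ys : List A) (s : ℕ) → nth z (xs ++ ys) (length xs + s) ≡ nth z ys s
nth-++ʳ [] ys s = refl
nth-++ʳ (x ∷ xs) ys s = nth-++ʳ xs ys s

nth-∈ : {A : Set} {z : A} (xs : List A) {s : ℕ} → s < length xs → nth z xs s ∈ xs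
nth-∈ (x ∷ xs) {zero} _ = here refl
nth-∈ (x ∷ xs) {suc s} (s≤s l) = there (nth-∈ xs l)

nth-injective : {A : Set} {z : A} {xs : List A} → Unique xs → ∀ {s t} → s < length xs → t < length xs →
  nth z xs s ≡ nth z xs t → s ≡ t
nth-injective (x∉ ∷ u) {zero} {zero} _ _ e = refl
nth-injective (x∉ ∷ u) {zero} {suc t} _ (s≤s l) e = ⊥-elim (All.lookup x∉ (nth-∈ _ l) e)
nth-injective (x∉ ∷ u) {suc s} {zero} (s≤s l) _ e = ⊥-elim (All.lookup x∉ (nth-∈ _ l) (sym e))
nth-injective (x∉ ∷ u) {suc s} {suc t} (s≤s l) (s≤s l′) e = cong suc (nth-injective u l l′ e)

∈-take : {A : Set} (D : ℕ) (xs : List A) {x : A} → x ∈ take D xs → x ∈ xs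
∈-take D xs m = subst (_ ∈_) (List.take++drop≡id D xs) (∈-++⁺ˡ m)

Unique-++⁻ʳ : {A : Set} (xs : List A) {ys : List A} → Unique (xs ++ ys) → Unique ys
Unique-++⁻ʳ [] u = u
Unique-++⁻ʳ (x ∷ xs) (_ ∷ u) = Unique-++⁻ʳ xs u

Unique-++⁻ˡ : {A : Set} (xs : List A) {ys : List A} → Unique (xs ++ ys) → Unique xs
Unique-++⁻ˡ [] u = []
Unique-++⁻ˡ (x ∷ xs) (x∉ ∷ u) = All.++⁻ˡ xs x∉ ∷ Unique-++⁻ˡ xs u

module _ {n : ℕ} where
  open import Data.List.Membership.DecPropositional (Fin._≟_ {n}) using (_∈?_)

  remaining : List (Fin n) → List (Fin n)
  remaining used = filter (λ v → ¬? (v ∈? used)) (allFin n)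

  length-remaining : ∀ used → Unique used → length (remaining used) + length used ≡ n
  length-remaining used u = ≤-antisym
    (subst₂ _≤_ (cong (_+ length used) (sym out)) (List.length-tabulate {n = n} id)
      (outside-count (allFin n) used (Unique.allFin⁺ n) u (λ {v} _ → ∈-allFin v)))
    (≤-trans (≤-reflexive (trans (sym (List.length-tabulate {n = n} id)) (trans (length-∑ (allFin n))
        (trans (∑-cong (allFin n) (λ v _ → sym (𝟙-¬? (v ∈? used)))) (∑-+ (allFin n) _ _)))))
      (+-mono-≤ (≤-reflexive (sym out)) (∑-𝟙-⊆ (_∈? used) (allFin n) used (Unique.allFin⁺ n) (λ _ m → m))))
    where
    out : length (remaining used) ≡ ∑ (allFin n) (λ v → 𝟙 (¬? (v ∈? used)))
    out = length-filter-∑ (λ v → ¬? (v ∈? used)) (allFin n)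

  avoiding? : (used y : List (Fin n)) → Dec (All (_∉ used) y)
  avoiding? used = All.all? (λ v → ¬? (v ∈? used))

  options : ℕ → List (List (Fin n)) → List (Fin n) → List (List (Fin n))
  options D Hl used = take D (filter (avoiding? used) Hl)

  -- Orderings of the vertex set that begin with B consecutive blocks from Hl. Every block is chosen among
  -- exactly D candidates, so that the uniform measure on the list is that of the sequential choice.
  orderings : ℕ → List (List (Fin n)) → ℕ → ℕ → List (Fin n) → List (List (Fin n))
  orderings D Hl R zero used = perms R (remaining used)
  orderings D Hl R (suc B) used = concatMap (λ y → map (y ++_) (orderings D Hl R B (y ++ used))) (options D Hl used)

  module _ (k D C R : ℕ) (Hl : List (List (Fin n)))
    (Hl-length : ∀ {y} → y ∈ Hl → length y ≡ k) (Hl-distinct : ∀ {y} → y ∈ Hl → Unique y) (Hl-unique : Unique Hl)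
    (available : ∀ used → length used + R ≤ n → D ≤ length (filter (avoiding? used) Hl)) where

    Fits : ℕ → List (Fin n) → Set
    Fits B used = Unique used × length used + (B * k + R) ≡ n

    options-Hl : ∀ {used y} → y ∈ options D Hl used → y ∈ Hl × All (_∉ used) y
    options-Hl {used} m = ∈-filter⁻ (avoiding? used) (∈-take D (filter (avoiding? used) Hl) m)

    length-options : ∀ {B used} → Fits B used → length (options D Hl used) ≡ D
    length-options {B} {used} (u , e) = trans (List.length-take D _) (m≤n⇒m⊓n≡m (available used
      (≤-trans (+-monoʳ-≤ (length used) (m≤n+m R (B * k))) (≤-reflexive e))))

    Fits-step : ∀ {B used y} → Fits (suc B) used → y ∈ options D Hl used → Fits B (y ++ used)
    Fits-step {B} {used} {y} (u , e) m with options-Hl m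
    ... | y∈ , y∉ = Unique.++⁺ (Hl-distinct y∈) u (λ { (a , b) → All.lookup y∉ a b }) , trans
      (trans (cong (_+ (B * k + R)) (trans (List.length-++ y) (cong (_+ length used) (Hl-length y∈)))) (lem k (length used) (B * k) R)) e
      where
      lem : ∀ k u x r → k + u + (x + r) ≡ u + (k + x + r)
      lem = solve-∀

    Fits-remaining : ∀ {used} → Fits 0 used → length (remaining used) ≡ R
    Fits-remaining {used} (u , e) = +-cancelʳ-≡ (length used) _ _ (trans (length-remaining used u) (trans (sym e) (+-comm (length used) R)))

    ∑-orderings : ∀ B used (f : List (Fin n) → ℕ) → ∑ (orderings D Hl R (suc B) used) f ≡
      ∑ (options D Hl used) (λ y → ∑ (orderings D Hl R B (y ++ used)) (λ ξ → f (y ++ ξ)))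
    ∑-orderings B used f = trans (∑-concatMap (λ y → map (y ++_) (orderings D Hl R B (y ++ used))) (options D Hl used) f)
      (∑-cong (options D Hl used) (λ y _ → ∑-map (y ++_) (orderings D Hl R B (y ++ used)) f))

    length-orderings : ∀ B used → Fits B used → length (orderings D Hl R B used) ≡ D ^ B * R !
    length-orderings zero used fits = trans (length-perms R _ (Fits-remaining fits)) (sym (*-identityˡ (R !)))
    length-orderings (suc B) used fits = begin
        length (orderings D Hl R (suc B) used)
      ≡⟨ trans (length-∑ (orderings D Hl R (suc B) used)) (∑-orderings B used (λ _ → 1)) ⟩
        ∑ (options D Hl used) (λ y → ∑ (orderings D Hl R B (y ++ used)) (λ _ → 1))
      ≡⟨ ∑-cong (options D Hl used) (λ y m → trans (sym (length-∑ (orderings D Hl R B (y ++ used)))) (length-orderings B _ (Fits-step {B} fits m))) ⟩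
        ∑ (options D Hl used) (λ _ → D ^ B * R !)
      ≡⟨ trans (∑-const (options D Hl used) _) (cong (_* (D ^ B * R !)) (length-options {suc B} fits)) ⟩
        D * (D ^ B * R !)
      ≡⟨ sym (*-assoc D _ _) ⟩
        D * D ^ B * R ! ∎
      where open ≡-Reasoning

    ordering-properties : ∀ B used → Fits B used → ∀ {ξ} → ξ ∈ orderings D Hl R B used →
      Unique ξ × (∀ {v} → v ∈ ξ → v ∉ used) × length ξ ≡ B * k + R
        × (∀ {z b} → b < B → ∃ λ y → y ∈ Hl × (∀ {o} → o < k → nth z ξ (b * k + o) ≡ nth z y o))
    ordering-properties zero used fits@(u , e) m with perms-↭ R (remaining used) (Fits-remaining fits) m
    ... | p = Unique-resp-↭ (↭-sym p) (Unique.filter⁺ (λ v → ¬? (v ∈? used)) (Unique.allFin⁺ n)) ,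
      (λ v∈ → proj₂ (∈-filter⁻ (λ v → ¬? (v ∈? used)) {xs = allFin n} (∈-resp-↭ p v∈))) ,
      trans (↭-length p) (Fits-remaining fits) , λ ()
    ordering-properties (suc B) used fits m
      with find (∈-concatMap⁻ (λ y → map (y ++_) (orderings D Hl R B (y ++ used))) {xs = options D Hl used} m)
    ... | y , y∈ , m₁ with ∈-map⁻ (y ++_) m₁
    ... | ξ , ξ∈ , refl with ordering-properties B (y ++ used) (Fits-step {B} fits y∈) ξ∈ | options-Hl y∈
    ... | uξ , fresh , len , seg | y∈Hl , y∉ =
      Unique.++⁺ (Hl-distinct y∈Hl) uξ (λ { (a , b) → fresh b (∈-++⁺ˡ a) }) ,
      (λ v∈ → [ (λ a → All.lookup y∉ a) , (λ a → fresh a ∘ ∈-++⁺ʳ y) ]′ (∈-++⁻ y v∈)) ,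
      trans (List.length-++ y) (trans (cong₂ _+_ (Hl-length y∈Hl) len) (sym (+-assoc k (B * k) R))) ,
      segments
      where
      segments : ∀ {z b} → b < suc B → ∃ λ y′ → y′ ∈ Hl × (∀ {o} → o < k → nth z (y ++ ξ) (b * k + o) ≡ nth z y′ o)
      segments {z} {zero} _ = y , y∈Hl , λ o<k → nth-++ˡ y ξ (subst (_ <_) (sym (Hl-length y∈Hl)) o<k)
      segments {z} {suc b} (s≤s b<B) with seg {z} b<B
      ... | y′ , y′∈ , h = y′ , y′∈ , λ {o} o<k → trans
        (cong (nth z (y ++ ξ)) (trans (+-assoc k (b * k) o) (cong (_+ (b * k + o)) (sym (Hl-length y∈Hl)))))
        (trans (nth-++ʳ y ξ (b * k + o)) (h o<k))

    -- However many entries of the block are prescribed, the loss against a uniformly random k-tuple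
    -- is n^k / D ≤ C. It is absorbed by a single factor C, which is there as soon as one entry is
    -- prescribed; with none prescribed the count is D itself, whence the split at zero.
    options-match : ∀ {B used} ps → Fits B used → length ps ≡ k → 1 ≤ C → n ^ k ≤ C * D →
      ∑ (options D Hl used) (λ y → 𝟙 (match? ps y)) * n ^ ∣ ps ∣⁺ ≤ C ^ ∣ ps ∣⁺ * D
    options-match {B} {used} ps fits e 1≤C CD with ∣ ps ∣⁺ in eq
    ... | zero = begin
        ∑ (options D Hl used) (λ y → 𝟙 (match? ps y)) * 1
      ≤⟨ *-monoˡ-≤ 1 (∑-mono (options D Hl used) (λ y _ → 𝟙≤1 (match? ps y))) ⟩
        ∑ (options D Hl used) (λ y → 1) * 1
      ≡⟨ trans (*-identityʳ _) (trans (sym (length-∑ (options D Hl used))) (trans (length-options {B} fits) (sym (+-identityʳ D)))) ⟩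
        1 * D ∎
      where open ≤-Reasoning
    ... | suc j = begin
        ∑ (options D Hl used) (λ y → 𝟙 (match? ps y)) * n ^ suc j
      ≡⟨ cong (λ z → ∑ (options D Hl used) (λ y → 𝟙 (match? ps y)) * n ^ z) (sym eq) ⟩
        ∑ (options D Hl used) (λ y → 𝟙 (match? ps y)) * n ^ ∣ ps ∣⁺
      ≤⟨ ∑-match ps (options D Hl used) (Unique.take⁺ D (Unique.filter⁺ (avoiding? used) Hl-unique)) ⟩
        n ^ length ps
      ≡⟨ cong (n ^_) e ⟩
        n ^ k
      ≤⟨ CD ⟩
        C * D
      ≤⟨ *-monoˡ-≤ D (m≤m*n C (C ^ j) {{m^n≢0 C j {{>-nonZero 1≤C}}}}) ⟩
        C * C ^ j * D ∎
      where open ≤-Reasoning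

    -- The pattern is cut into the parts that belong to the blocks and the part of the permutation.
    -- In the latter each prescribed vertex costs 2 for replacing n by R and 4 in `falling-bound`;
    -- this is the 8.
    orderings-match : 8 ≤ C → n ^ k ≤ C * D → n ≤ 2 * R → ∀ B used ps → Fits B used → length ps ≡ B * k + R → Unique (catMaybes ps) →
      ∑ (orderings D Hl R B used) (λ ξ → 𝟙 (match? ps ξ)) * n ^ ∣ ps ∣⁺ ≤ C ^ ∣ ps ∣⁺ * (D ^ B * R !)
    orderings-match 8≤C CD n≤2R zero used ps fits@(u , _) e up = begin
        ∑ (perms R (remaining used)) (λ ξ → 𝟙 (match? ps ξ)) * n ^ j
      ≤⟨ *-mono-≤ (perms-match R (remaining used) ps (Fits-remaining fits) e (Unique.filter⁺ (λ v → ¬? (v ∈? used)) (Unique.allFin⁺ n)) up) (^-monoˡ-≤ j n≤2R) ⟩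
        (R ∸ j) ! * (2 * R) ^ j
      ≡⟨ trans (cong ((R ∸ j) ! *_) (*-^ 2 R j)) (l₁ ((R ∸ j) !) (2 ^ j) (R ^ j)) ⟩
        2 ^ j * (R ^ j * (R ∸ j) !)
      ≤⟨ *-monoʳ-≤ (2 ^ j) (falling-bound R j (≤-trans (List.length-catMaybes ps) (≤-reflexive e))) ⟩
        2 ^ j * (4 ^ j * R !)
      ≡⟨ trans (sym (*-assoc (2 ^ j) _ _)) (cong (_* R !) (sym (*-^ 2 4 j))) ⟩
        8 ^ j * R !
      ≤⟨ *-monoˡ-≤ (R !) (^-monoˡ-≤ j 8≤C) ⟩
        C ^ j * R !
      ≡⟨ cong (C ^ j *_) (sym (*-identityˡ (R !))) ⟩
        C ^ j * (1 * R !) ∎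
      where
      open ≤-Reasoning
      j = ∣ ps ∣⁺
      l₁ : ∀ a b c → a * (b * c) ≡ b * (c * a)
      l₁ = solve-∀
    orderings-match 8≤C CD n≤2R (suc B) used ps fits e up = begin
        ∑ (orderings D Hl R (suc B) used) (λ ξ → 𝟙 (match? ps ξ)) * n ^ ∣ ps ∣⁺
      ≡⟨ cong₂ _*_ (∑-orderings B used _) (trans (cong (n ^_) j≡) (^-distribˡ-+-* n j₁ j₂)) ⟩
        ∑ (options D Hl used) (λ y → ∑ (orderings D Hl R B (y ++ used)) (λ ξ → 𝟙 (match? ps (y ++ ξ)))) * (n ^ j₁ * n ^ j₂)
      ≡⟨ trans (l₁ (∑ (options D Hl used) inner) (n ^ j₁) (n ^ j₂)) (cong (_* n ^ j₁) (sym (∑-*ʳ (options D Hl used) inner (n ^ j₂)))) ⟩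
        ∑ (options D Hl used) (λ y → ∑ (orderings D Hl R B (y ++ used)) (λ ξ → 𝟙 (match? ps (y ++ ξ))) * n ^ j₂) * n ^ j₁
      ≤⟨ *-monoˡ-≤ (n ^ j₁) (∑-mono (options D Hl used) each) ⟩
        ∑ (options D Hl used) (λ y → 𝟙 (match? p₁ y) * X) * n ^ j₁
      ≡⟨ trans (cong (_* n ^ j₁) (∑-*ʳ (options D Hl used) (λ y → 𝟙 (match? p₁ y)) X)) (l₂ (∑ (options D Hl used) (λ y → 𝟙 (match? p₁ y))) X (n ^ j₁)) ⟩
        X * (∑ (options D Hl used) (λ y → 𝟙 (match? p₁ y)) * n ^ j₁)
      ≤⟨ *-monoʳ-≤ X (options-match {suc B} p₁ fits len₁ (≤-trans (s≤s z≤n) 8≤C) CD) ⟩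
        X * (C ^ j₁ * D)
      ≡⟨ l₃ (C ^ j₂) (D ^ B) (R !) (C ^ j₁) D ⟩
        C ^ j₁ * C ^ j₂ * (D * D ^ B * R !)
      ≡⟨ cong (_* (D * D ^ B * R !)) (sym (trans (cong (C ^_) j≡) (^-distribˡ-+-* C j₁ j₂))) ⟩
        C ^ ∣ ps ∣⁺ * (D * D ^ B * R !) ∎
      where
      open ≤-Reasoning
      p₁ = take k ps
      p₂ = drop k ps
      j₁ = ∣ p₁ ∣⁺
      j₂ = ∣ p₂ ∣⁺
      X = C ^ j₂ * (D ^ B * R !)
      inner = λ y → ∑ (orderings D Hl R B (y ++ used)) (λ ξ → 𝟙 (match? ps (y ++ ξ)))
      split : catMaybes ps ≡ catMaybes p₁ ++ catMaybes p₂
      split = trans (cong catMaybes (sym (List.take++drop≡id k ps))) (List.catMaybes-++ p₁ p₂)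
      j≡ : ∣ ps ∣⁺ ≡ j₁ + j₂
      j≡ = trans (cong length split) (List.length-++ (catMaybes p₁))
      len₁ : length p₁ ≡ k
      len₁ = trans (List.length-take k ps) (m≤n⇒m⊓n≡m (≤-trans (m≤m+n k (B * k + R)) (≤-reflexive (trans (sym (+-assoc k (B * k) R)) (sym e)))))
      len₂ : length p₂ ≡ B * k + R
      len₂ = trans (List.length-drop k ps) (trans (cong (_∸ k) (trans e (+-assoc k (B * k) R))) (m+n∸m≡n k _))
      l₁ : ∀ s a b → s * (a * b) ≡ s * b * a
      l₁ = solve-∀
      l₂ : ∀ s x a → s * x * a ≡ x * (s * a)
      l₂ = solve-∀
      l₃ : ∀ c d r e f → c * (d * r) * (e * f) ≡ e * c * (f * d * r)
      l₃ = solve-∀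
      each : ∀ y → y ∈ options D Hl used → ∑ (orderings D Hl R B (y ++ used)) (λ ξ → 𝟙 (match? ps (y ++ ξ))) * n ^ j₂ ≤ 𝟙 (match? p₁ y) * X
      each y m with match? p₁ y
      ... | no ¬m = ≤-trans (≤-reflexive (cong (_* n ^ j₂) (∑-zero (orderings D Hl R B (y ++ used)) (λ ξ _ →
          𝟙-false (λ mt → ¬m (proj₁ (Match-split y ξ m mt))) (match? ps (y ++ ξ)))))) z≤n
        where
        Match-split : ∀ y ξ → y ∈ options D Hl used → Match ps (y ++ ξ) → Match p₁ y × Match p₂ ξ
        Match-split y ξ m mt = Match-++ p₁ y (trans len₁ (sym (Hl-length (proj₁ (options-Hl m)))))
          (subst (λ q → Match q (y ++ ξ)) (sym (List.take++drop≡id k ps)) mt)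
      ... | yes _ = begin
          ∑ (orderings D Hl R B (y ++ used)) (λ ξ → 𝟙 (match? ps (y ++ ξ))) * n ^ j₂
        ≤⟨ *-monoˡ-≤ (n ^ j₂) (∑-mono (orderings D Hl R B (y ++ used)) (λ ξ _ → 𝟙-mono (λ mt → proj₂ (Match-++ p₁ y (trans len₁ (sym (Hl-length (proj₁ (options-Hl m)))))
          (subst (λ q → Match q (y ++ ξ)) (sym (List.take++drop≡id k ps)) mt))) (match? ps (y ++ ξ)) (match? p₂ ξ))) ⟩
          ∑ (orderings D Hl R B (y ++ used)) (λ ξ → 𝟙 (match? p₂ ξ)) * n ^ j₂
        ≤⟨ orderings-match 8≤C CD n≤2R B (y ++ used) p₂ (Fits-step {B} fits m) len₂ (Unique-++⁻ʳ (catMaybes p₁) (subst Unique split up)) ⟩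
          X
        ≡⟨ sym (*-identityˡ X) ⟩
          1 * X ∎

-- Positions and slots

Match-insert : {A : Set} {z : A} (ps : List (Maybe A)) (s : ℕ) (u : A) → s < length ps →
  (∃ λ u′ → u′ ∈ catMaybes ps × (∀ {ξ} → Match ps ξ → nth z ξ s ≡ u′)) ⊎
  (∃ λ ps′ → length ps′ ≡ length ps × catMaybes ps′ ↭ u ∷ catMaybes ps × (∀ {ξ} → Match ps ξ → nth z ξ s ≡ u → Match ps′ ξ))
Match-insert (nothing ∷ ps) zero u l = inj₂ (just u ∷ ps , refl , ↭-refl , λ { (free m) refl → fixed m })
Match-insert (just u′ ∷ ps) zero u l = inj₁ (u′ , here refl , λ { (fixed m) → refl })
Match-insert {z = z} (p ∷ ps) (suc s) u (s≤s l) with Match-insert {z = z} ps s u l | p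
... | inj₁ (u′ , u′∈ , h) | nothing = inj₁ (u′ , u′∈ , λ { (free m) → h m })
... | inj₁ (u′ , u′∈ , h) | just _ = inj₁ (u′ , there u′∈ , λ { (fixed m) → h m })
... | inj₂ (ps′ , e , p↭ , h) | nothing = inj₂ (nothing ∷ ps′ , cong suc e , p↭ , λ { (free m) eq → free (h m eq) })
... | inj₂ (ps′ , e , p↭ , h) | just w = inj₂ (just w ∷ ps′ , cong suc e , ↭-trans (prep w p↭) (swap w u ↭-refl) , λ { (fixed m) eq → fixed (h m eq) })

Match-replicate : {A : Set} (n : ℕ) (ξ : List A) → length ξ ≡ n → Match (replicate n nothing) ξ
Match-replicate zero [] e = []
Match-replicate (suc n) (x ∷ ξ) e = free (Match-replicate n ξ (suc-injective e))

catMaybes-replicate : {A : Set} (n : ℕ) → catMaybes (replicate {A = Maybe A} n nothing) ≡ []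
catMaybes-replicate zero = refl
catMaybes-replicate (suc n) = catMaybes-replicate n

module _ {A : Set} (z : A) (n : ℕ) (θ : ℕ → ℕ) where
  Pins : List A → List ℕ → List A → Set
  Pins ξ = Pointwise (λ x u → x < n × nth z ξ (θ x) ≡ u)

  -- Since the vertices are distinct, two of them assigned to one slot contradict each other, and
  -- then no ordering qualifies. Otherwise the pins form a pattern, for which orderings can be
  -- counted block by block.
  Pins-Match : (∀ {x} → x < n → θ x < n) → ∀ P us → Unique us → (∀ {ξ} → length ξ ≡ n → ¬ Pins ξ P us) ⊎
    (∃ λ ps → length ps ≡ n × catMaybes ps ↭ us × (∀ {ξ} → length ξ ≡ n → Pins ξ P us → Match ps ξ))
  Pins-Match θ< [] [] u = inj₂ (replicate n nothing , List.length-replicate n , ↭-reflexive (catMaybes-replicate n) ,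
    λ {ξ} e _ → Match-replicate n ξ e)
  Pins-Match θ< [] (_ ∷ _) u = inj₁ λ { _ () }
  Pins-Match θ< (_ ∷ _) [] u = inj₁ λ { _ () }
  Pins-Match θ< (x ∷ P) (v ∷ us) (v∉ ∷ u) with x <? n | Pins-Match θ< P us u
  ... | no x≮n | _ = inj₁ λ { _ ((x<n , _) ∷ _) → x≮n x<n }
  ... | yes _ | inj₁ none = inj₁ λ { {ξ} e (_ ∷ p) → none {ξ} e p }
  ... | yes x<n | inj₂ (ps , len , p↭ , h) with Match-insert {z = z} ps (θ x) v (subst (θ x <_) (sym len) (θ< x<n))
  ... | inj₁ (v′ , v′∈ , h′) = inj₁ λ { {ξ} e ((_ , eq) ∷ p) →
    All.lookup v∉ (∈-resp-↭ p↭ v′∈) (trans (sym eq) (h′ (h {ξ} e p))) }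
  ... | inj₂ (ps′ , len′ , p↭′ , h′) = inj₂ (ps′ , trans len′ len , ↭-trans p↭′ (prep v p↭) ,
    λ { {ξ} e ((_ , eq) ∷ p) → h′ (h {ξ} e p) eq })

-- Positions on the cycle versus slots of an ordering: position b (k + s) + o with b < B and o < k has
-- slot b k + o, and the other positions follow in order.
shuffle : ℕ → ℕ → ℕ → ℕ → ℕ
shuffle k s zero x = x
shuffle k s (suc B) x with x <? k | x <? k + s
... | yes _ | _ = x
... | no _ | yes _ = B * k + x
... | no _ | no _ with shuffle k s B (x ∸ (k + s)) <? B * k
... | yes _ = k + shuffle k s B (x ∸ (k + s))
... | no _ = k + s + shuffle k s B (x ∸ (k + s))

module _ (k s : ℕ) where
  private
    θ = shuffle k s

  -- A view of one step of the recursion. Slots of later blocks shift by k, because only the first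
  -- block comes before them; slots of later gaps shift by k + s, because the first gap comes before
  -- them as well.
  data Shuffled (B : ℕ) : ℕ → ℕ → Set where
    block : ∀ {x z} → x < k → z ≡ x → Shuffled B x z
    gap : ∀ {x z} → k ≤ x → x < k + s → z ≡ B * k + x → Shuffled B x z
    later-block : ∀ {x x′ z} → θ B x′ < B * k → x ≡ k + s + x′ → z ≡ k + θ B x′ → Shuffled B x z
    later-gap : ∀ {x x′ z} → B * k ≤ θ B x′ → x ≡ k + s + x′ → z ≡ k + s + θ B x′ → Shuffled B x z

  shuffled : ∀ B x → Shuffled B x (θ (suc B) x)
  shuffled B x with x <? k | x <? k + s
  ... | yes x<k | _ = block x<k refl
  ... | no x≮k | yes x<ks = gap (≮⇒≥ x≮k) x<ks refl
  ... | no x≮k | no x≮ks with θ B (x ∸ (k + s)) <? B * k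
  ... | yes l = later-block l (sym (m+[n∸m]≡n (≮⇒≥ x≮ks))) refl
  ... | no l = later-gap (≮⇒≥ l) (sym (m+[n∸m]≡n (≮⇒≥ x≮ks))) refl

  private
    <-clash : ∀ {a b c : ℕ} → a < b → b ≤ c → a ≢ c
    <-clash a<b b≤c refl = <⇒≱ a<b b≤c

  -- The four cases have disjoint ranges of slots: the first block below k, the later blocks in the
  -- next B * k slots, the first gap in the s slots after these, the later gaps beyond.
  shuffle-injective : ∀ B {x y} → θ B x ≡ θ B y → x ≡ y
  shuffle-injective zero e = e
  shuffle-injective (suc B) {x} {y} e = go (shuffled B x) (shuffled B y) e
    where
    gap≥ : ∀ {x} → k ≤ x → k + B * k ≤ B * k + x
    gap≥ {x} le = ≤-trans (≤-reflexive (+-comm k (B * k))) (+-monoʳ-≤ (B * k) le)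
    gap< : ∀ {x} → x < k + s → B * k + x < k + s + B * k
    gap< {x} l = subst (B * k + x <_) (+-comm (B * k) (k + s)) (+-monoʳ-< (B * k) l)
    go : ∀ {x y z z′} → Shuffled B x z → Shuffled B y z′ → z ≡ z′ → x ≡ y
    go (block _ refl) (block _ refl) e = e
    go (gap _ _ refl) (gap _ _ refl) e = +-cancelˡ-≡ (B * k) _ _ e
    go (later-block _ refl refl) (later-block _ refl refl) e = cong (k + s +_) (shuffle-injective B (+-cancelˡ-≡ k _ _ e))
    go (later-gap _ refl refl) (later-gap _ refl refl) e = cong (k + s +_) (shuffle-injective B (+-cancelˡ-≡ (k + s) _ _ e))
    go (block l refl) (gap le _ refl) e = ⊥-elim (<-clash l (≤-trans le (m≤n+m _ (B * k))) e)
    go (block l refl) (later-block _ _ refl) e = ⊥-elim (<-clash l (m≤m+n k _) e)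
    go (block l refl) (later-gap _ _ refl) e = ⊥-elim (<-clash l (≤-trans (m≤m+n k s) (m≤m+n (k + s) _)) e)
    go (gap le _ refl) (later-block l _ refl) e = ⊥-elim (<-clash (+-monoʳ-< k l) (gap≥ le) (sym e))
    go (gap _ l refl) (later-gap le _ refl) e = ⊥-elim (<-clash (gap< l) (+-monoʳ-≤ (k + s) le) e)
    go (later-block l _ refl) (later-gap le _ refl) e = ⊥-elim (<-clash (+-monoʳ-< k l) (+-mono-≤ (m≤m+n k s) le) e)
    go (gap le _ refl) (block l refl) e = ⊥-elim (<-clash l (≤-trans le (m≤n+m _ (B * k))) (sym e))
    go (later-block _ _ refl) (block l refl) e = ⊥-elim (<-clash l (m≤m+n k _) (sym e))
    go (later-gap _ _ refl) (block l refl) e = ⊥-elim (<-clash l (≤-trans (m≤m+n k s) (m≤m+n (k + s) _)) (sym e))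
    go (later-block l _ refl) (gap le _ refl) e = ⊥-elim (<-clash (+-monoʳ-< k l) (gap≥ le) e)
    go (later-gap le _ refl) (gap _ l refl) e = ⊥-elim (<-clash (gap< l) (+-monoʳ-≤ (k + s) le) (sym e))
    go (later-gap le _ refl) (later-block l _ refl) e = ⊥-elim (<-clash (+-monoʳ-< k l) (+-mono-≤ (m≤m+n k s) le) (sym e))

  shuffle-< : ∀ B {x n} → B * (k + s) ≤ n → x < n → θ B x < n
  shuffle-< zero _ x<n = x<n
  shuffle-< (suc B) {x} {n} le x<n with shuffled B x
  ... | block _ e rewrite e = x<n
  ... | gap _ l e rewrite e = ≤-trans (subst (B * k + x <_) (+-comm (B * k) (k + s)) (+-monoʳ-< (B * k) l))
    (≤-trans (+-monoʳ-≤ (k + s) (*-monoʳ-≤ B (m≤m+n k s))) le)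
  ... | later-block {x′ = x′} l ex e rewrite e = ≤-trans (+-monoʳ-< k l) (≤-trans (+-mono-≤ (m≤m+n k s) (*-monoʳ-≤ B (m≤m+n k s))) le)
  ... | later-gap {x′ = x′} l ex e rewrite e = subst (k + s + θ B x′ <_) (m+[n∸m]≡n ks≤n) (+-monoʳ-< (k + s)
    (shuffle-< B {x′} {n ∸ (k + s)} (m+n≤o⇒m≤o∸n (B * (k + s)) (≤-trans (≤-reflexive (+-comm _ (k + s))) le))
      (+-cancelˡ-< (k + s) _ _ (subst₂ _<_ ex (sym (m+[n∸m]≡n ks≤n)) x<n))))
    where
    ks≤n : k + s ≤ n
    ks≤n = ≤-trans (m≤m+n (k + s) _) le

  shuffle-block : ∀ B {b o} → b < B → o < k → θ B (b * (k + s) + o) ≡ b * k + o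
  shuffle-block (suc B) {zero} {o} _ o<k with shuffled B o
  ... | block _ e = e
  ... | gap le _ _ = ⊥-elim (<⇒≱ o<k le)
  ... | later-block _ refl _ = ⊥-elim (<⇒≱ o<k (≤-trans (m≤m+n k s) (m≤m+n (k + s) _)))
  ... | later-gap _ refl _ = ⊥-elim (<⇒≱ o<k (≤-trans (m≤m+n k s) (m≤m+n (k + s) _)))
  shuffle-block (suc B) {suc b} {o} (s≤s b<B) o<k with shuffled B (k + s + b * (k + s) + o) | shuffle-block B {b} {o} b<B o<k
  ... | block l _ | _ = ⊥-elim (<⇒≱ l (≤-trans (m≤m+n k s) (≤-trans (m≤m+n (k + s) _) (m≤m+n _ o))))
  ... | gap _ l _ | _ = ⊥-elim (<⇒≱ l (≤-trans (m≤m+n (k + s) _) (m≤m+n _ o)))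
  ... | later-block {x′ = x′} l ex e | ih = trans e (trans (cong (k +_) (trans (cong (θ B) x′≡) ih)) (sym (+-assoc k (b * k) o)))
    where
    x′≡ : x′ ≡ b * (k + s) + o
    x′≡ = +-cancelˡ-≡ (k + s) _ _ (trans (sym ex) (+-assoc (k + s) _ o))
  ... | later-gap {x′ = x′} le ex _ | ih = ⊥-elim (<⇒≱ lt (subst (B * k ≤_) (trans (cong (θ B) x′≡) ih) le))
    where
    x′≡ : x′ ≡ b * (k + s) + o
    x′≡ = +-cancelˡ-≡ (k + s) _ _ (trans (sym ex) (+-assoc (k + s) _ o))
    lt : b * k + o < B * k
    lt = ≤-trans (+-monoʳ-< (b * k) o<k) (≤-trans (≤-reflexive (+-comm (b * k) k)) (*-monoˡ-≤ k b<B))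

-- Spanning forests in sets of edges of a cycle

window : ℕ → ℕ → List ℕ
window x zero = []
window x (suc l) = (x + l) ∷ window x l

length-window : ∀ x l → length (window x l) ≡ l
length-window x zero = refl
length-window x (suc l) = cong suc (length-window x l)

window-bounds : ∀ {x l y} → y ∈ window x l → x ≤ y × y < x + l
window-bounds {x} {suc l} (here refl) = m≤m+n x l , +-monoʳ-< x (n<1+n l)
window-bounds {x} {suc l} (there m) with window-bounds m
... | a , b = a , ≤-trans b (+-monoʳ-≤ x (n≤1+n l))

window-start : ∀ x l → x ∈ window x (suc l)
window-start x zero = here (sym (+-identityʳ x))
window-start x (suc l) = there (window-start x l)

Unique-window-++ : ∀ x l {xs} → Unique xs → (∀ {y} → y ∈ xs → x + l ≤ y) → Unique (window x l ++ xs)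
Unique-window-++ x zero u h = u
Unique-window-++ x (suc l) {xs} u h =
  All.tabulate (λ m e → distinct (∈-++⁻ (window x l) m) e) ∷
  Unique-window-++ x l u (λ m → ≤-trans (+-monoʳ-≤ x (n≤1+n l)) (h m))
  where
  distinct : ∀ {y} → (y ∈ window x l) ⊎ (y ∈ xs) → x + l ≢ y
  distinct (inj₁ m) refl = <-irrefl refl (proj₂ (window-bounds {x} {l} m))
  distinct (inj₂ m) refl = <⇒≱ (+-monoʳ-< x (n<1+n l)) (h m)

lastFrom : ℕ → List ℕ → ℕ
lastFrom a [] = a
lastFrom a (b ∷ as) = lastFrom b as

lastFrom-∈ : ∀ a as → lastFrom a as ∈ a ∷ as
lastFrom-∈ a [] = here refl
lastFrom-∈ a (b ∷ as) = there (lastFrom-∈ b as)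

lastFrom-≥ : ∀ a as → AllPairs _<_ (a ∷ as) → a ≤ lastFrom a as
lastFrom-≥ a [] _ = ≤-refl
lastFrom-≥ a (b ∷ as) ((a<b ∷ _) ∷ s) = ≤-trans (<⇒≤ a<b) (lastFrom-≥ b as s)

module _ (d k : ℕ) (d≥1 : 1 ≤ d) (d+2≤k : d + 2 ≤ k) (A : List ℕ) where

  InEdge : ℕ → ℕ → Set
  InEdge a x = d * a ≤ x × x < d * a + k

  -- A spanning forest, children first, of a set of positions in which every child lies in a common edge
  -- with its parent; the second index counts the roots.
  data Forest : List ℕ → ℕ → Set where
    [] : Forest [] 0
    root : ∀ {x xs c a} → a ∈ A → InEdge a x → Forest xs c → Forest (x ∷ xs) (suc c)
    child : ∀ {x y xs c a} → y ∈ xs → a ∈ A → InEdge a x → InEdge a y → Forest xs c → Forest (x ∷ xs) c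

  add-children : ∀ {a y xs c} l → l ≤ k → a ∈ A → InEdge a y → y ∈ xs → Forest xs c → Forest (window (d * a) l ++ xs) c
  add-children zero _ _ _ _ f = f
  add-children {a} (suc l) l<k a∈ ey y∈ f =
    child (∈-++⁺ʳ (window (d * a) l) y∈) a∈ (m≤m+n (d * a) l , +-monoʳ-< (d * a) l<k) ey
      (add-children l (<⇒≤ l<k) a∈ ey y∈ f)

  add-tree : ∀ {a xs c} l → l < k → a ∈ A → Forest xs c → Forest (window (d * a) (suc l) ++ xs) (suc c)
  add-tree {a} zero 0<k a∈ f = root a∈ (m≤m+n (d * a) 0 , +-monoʳ-< (d * a) 0<k) f
  add-tree {a} (suc l) l<k a∈ f =
    child (∈-++⁺ˡ (window-start (d * a) l)) a∈ (m≤m+n (d * a) (suc l) , +-monoʳ-< (d * a) l<k)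
      (≤-refl , m<m+n (d * a) (<-trans (s≤s z≤n) l<k)) (add-tree l (<⇒≤ l<k) a∈ f)

  -- The number of positions exceeds the number of roots by d per edge, plus one per gap in the list of edges.
  record Spanning (P e a : ℕ) (as : List ℕ) : Set where
    field
      {positions} : List ℕ
      {roots} : ℕ
      gaps : ℕ
      forest : Forest positions roots
      size : length positions ≡ roots + d * suc (length as) + gaps + e
      size≤ : length positions ≤ suc (length as) * k
      lower : ∀ {x} → x ∈ positions → d * a ≤ x
      upper : ∀ {x} → x ∈ positions → x < d * lastFrom a as + (d + 1 + e)
      distinct : Unique positions
      start : d * a ∈ positions
      many-gaps : ∀ {z} → z ∉ A → a < z → suc (length as) + a ≤ P * gaps + z
      no-gap : gaps ≡ 0 → ∀ {z} → z ∉ A → a < z → lastFrom a as < z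

  -- Edges are added from the last to the first. An edge whose successor a + 1 is present
  -- contributes its first d positions, as children of the start of the successor. Otherwise there
  -- is room for one position more: d + 1 children if the edge still meets the next one in the list,
  -- and else a new tree on d + 2 positions, which needs d + 2 ≤ k, that is, ℓ ≥ 2. The last edge
  -- gives a tree on d + 1 + e positions.
  spanning : ∀ P e → e ≤ 1 → (∀ {a} → a ∈ A → ∃ λ z → z ∉ A × a < z × z ≤ a + P) →
    ∀ a as → AllPairs _<_ (a ∷ as) → (∀ {b} → b ∈ a ∷ as → b ∈ A) → Spanning P e a as
  spanning P e e≤1 next a [] _ ⊆A = record
    { gaps = 0
    ; forest = subst (λ l → Forest (window (d * a) l ++ []) 1) l≡ (add-tree (d + e) d+e<k (⊆A (here refl)) [])
    ; size = trans len (lem d e)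
    ; size≤ = ≤-trans (≤-reflexive len) (≤-trans l≤k (≤-reflexive (sym (+-identityʳ k))))
    ; lower = λ m → proj₁ (bounds m)
    ; upper = λ m → proj₂ (bounds m)
    ; distinct = Unique-window-++ (d * a) (d + 1 + e) [] λ ()
    ; start = ∈-++⁺ˡ (subst (λ l → d * a ∈ window (d * a) l) l≡ (window-start (d * a) (d + e)))
    ; many-gaps = λ {z} _ a<z → ≤-trans a<z (≤-reflexive (cong (_+ z) (sym (*-zeroʳ P))))
    ; no-gap = λ _ _ a<z → a<z
    }
    where
    l≡ : suc (d + e) ≡ d + 1 + e
    l≡ = cong (_+ e) (+-comm 1 d)
    l≤k : d + 1 + e ≤ k
    l≤k = ≤-trans (≤-reflexive (+-assoc d 1 e)) (≤-trans (+-monoʳ-≤ d (s≤s e≤1)) d+2≤k)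
    d+e<k : d + e < k
    d+e<k = ≤-trans (≤-reflexive l≡) l≤k
    len : length (window (d * a) (d + 1 + e) ++ []) ≡ d + 1 + e
    len = trans (cong length (List.++-identityʳ (window (d * a) (d + 1 + e)))) (length-window (d * a) (d + 1 + e))
    lem : ∀ d e → d + 1 + e ≡ 1 + d * 1 + 0 + e
    lem = solve-∀
    bounds : ∀ {x} → x ∈ window (d * a) (d + 1 + e) ++ [] → d * a ≤ x × x < d * a + (d + 1 + e)
    bounds m with ∈-++⁻ (window (d * a) (d + 1 + e)) m
    ... | inj₁ m′ = window-bounds m′
    ... | inj₂ ()
  spanning P e e≤1 next a (b ∷ as) ((a<b ∷ _) ∷ sorted) ⊆A
    with spanning P e e≤1 next b as sorted (⊆A ∘ there) | b ≟ suc a | d * b <? d * a + k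
  ... | S | yes refl | _ = record
    { gaps = gaps
    ; forest = add-children d (≤-trans (m≤m+n d 2) d+2≤k) (⊆A (here refl)) b∈edge start forest
    ; size = trans (trans (List.length-++ (window (d * a) d)) (cong₂ _+_ (length-window (d * a) d) size)) (lem d roots (length as) gaps e)
    ; size≤ = ≤-trans (≤-reflexive (trans (List.length-++ (window (d * a) d)) (cong (_+ length positions) (length-window (d * a) d))))
        (+-mono-≤ (≤-trans (m≤m+n d 2) d+2≤k) size≤)
    ; lower = λ m → [ proj₁ ∘ window-bounds , (λ m′ → ≤-trans (*-monoʳ-≤ d (n≤1+n a)) (lower m′)) ]′ (∈-++⁻ (window (d * a) d) m)
    ; upper = λ m → [ (λ m′ → ≤-trans (proj₂ (window-bounds m′)) (≤-trans (≤-reflexive next-start) (≤-trans (*-monoʳ-≤ d (lastFrom-≥ b as sorted)) (m≤m+n _ _))))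
                    , upper ]′ (∈-++⁻ (window (d * a) d) m)
    ; distinct = Unique-window-++ (d * a) d distinct (λ m → ≤-trans (≤-reflexive next-start) (lower m))
    ; start = ∈-++⁺ˡ (subst (λ l → d * a ∈ window (d * a) l) (m+[n∸m]≡n d≥1) (window-start (d * a) (d ∸ 1)))
    ; many-gaps = λ z∉ a<z → ≤-trans (≤-reflexive (cong suc (sym (+-suc (length as) a)))) (many-gaps z∉ (beyond z∉ a<z))
    ; no-gap = λ g z∉ a<z → no-gap g z∉ (beyond z∉ a<z)
    }
    where
    open Spanning S
    next-start : d * a + d ≡ d * suc a
    next-start = trans (+-comm (d * a) d) (sym (*-suc d a))
    b∈edge : InEdge a (d * suc a)
    b∈edge = *-monoʳ-≤ d (n≤1+n a) , ≤-trans (≤-reflexive (cong suc (sym next-start))) (≤-trans (≤-reflexive (sym (+-suc (d * a) d)))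
      (+-monoʳ-≤ (d * a) (≤-trans (≤-reflexive (+-comm 1 d)) (≤-trans (+-monoʳ-≤ d (s≤s z≤n)) d+2≤k))))
    lem : ∀ d c t g e → d + (c + d * suc t + g + e) ≡ c + d * suc (suc t) + g + e
    lem = solve-∀
    beyond : ∀ {z} → z ∉ A → a < z → suc a < z
    beyond {z} z∉ a<z = ≤∧≢⇒< a<z (λ { refl → z∉ (⊆A (there (here refl))) })
  ... | S | no b≢ | touching = build touching
    where
    open Spanning S
    2+a≤b : suc a < b
    2+a≤b = ≤∧≢⇒< a<b (b≢ ∘ sym)
    da+2d≤db : d * a + d + d ≤ d * b
    da+2d≤db = ≤-trans (≤-reflexive (lem d a)) (*-monoʳ-≤ d 2+a≤b)
      where
      lem : ∀ d a → d * a + d + d ≡ d * suc (suc a)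
      lem = solve-∀
    -- Here a is a run by itself, of length 1 ≤ z - a. The run that starts at b stops before some z′
    -- ≤ b + P, so its length is charged to the new gap.
    many : ∀ {z} → z ∉ A → a < z → suc (suc (length as)) + a ≤ P * suc gaps + z
    many {z} z∉ a<z with next (⊆A (there (here refl)))
    ... | z′ , z′∉ , b<z′ , z′≤ = begin
        suc (suc (length as)) + a
      ≡⟨ sym (+-suc (suc (length as)) a) ⟩
        suc (length as) + suc a
      ≤⟨ +-mono-≤ (+-cancelʳ-≤ b _ _ (begin
          suc (length as) + b
        ≤⟨ many-gaps z′∉ b<z′ ⟩
          P * gaps + z′
        ≤⟨ +-monoʳ-≤ (P * gaps) z′≤ ⟩
          P * gaps + (b + P)
        ≡⟨ lem P gaps b ⟩
          P * suc gaps + b ∎)) a<z ⟩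
        P * suc gaps + z ∎
      where
      open ≤-Reasoning
      lem : ∀ P g b → P * g + (b + P) ≡ P * suc g + b
      lem = solve-∀
    module _ (l c : ℕ) (l≥1 : 1 ≤ l) (l≤k : l ≤ k) (fits : d * a + l ≤ d * b) (f : Forest (window (d * a) l ++ positions) c)
      (net : l + roots ≡ c + suc d) where
      extend : Spanning P e a (b ∷ as)
      extend = record
        { gaps = suc gaps
        ; forest = f
        ; size = trans (trans (List.length-++ (window (d * a) l)) (cong₂ _+_ (length-window (d * a) l) size))
            (trans (l₁ l roots (d * suc (length as)) gaps e) (trans (cong (_+ (d * suc (length as) + gaps + e)) net) (l₂ c d (length as) gaps e)))
        ; size≤ = ≤-trans (≤-reflexive (trans (List.length-++ (window (d * a) l)) (cong (_+ length positions) (length-window (d * a) l)))) (+-mono-≤ l≤k size≤)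
        ; lower = λ m → [ proj₁ ∘ window-bounds , (λ m′ → ≤-trans (*-monoʳ-≤ d (<⇒≤ a<b)) (lower m′)) ]′ (∈-++⁻ (window (d * a) l) m)
        ; upper = λ m → [ (λ m′ → ≤-trans (proj₂ (window-bounds m′)) (≤-trans fits (≤-trans (*-monoʳ-≤ d (lastFrom-≥ b as sorted)) (m≤m+n _ _))))
                        , upper ]′ (∈-++⁻ (window (d * a) l) m)
        ; distinct = Unique-window-++ (d * a) l distinct (λ m → ≤-trans fits (lower m))
        ; start = ∈-++⁺ˡ (subst (λ l → d * a ∈ window (d * a) l) (m+[n∸m]≡n l≥1) (window-start (d * a) (l ∸ 1)))
        ; many-gaps = many
        ; no-gap = λ ()
        }
        where
        l₁ : ∀ l r x g e → l + (r + x + g + e) ≡ l + r + (x + g + e)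
        l₁ = solve-∀
        l₂ : ∀ c d t g e → c + suc d + (d * suc t + g + e) ≡ c + d * suc (suc t) + suc g + e
        l₂ = solve-∀
    build : Dec (d * b < d * a + k) → Spanning P e a (b ∷ as)
    build (yes db<) = extend (suc d) roots (s≤s z≤n) d+1≤k
      (≤-trans (≤-reflexive (trans (+-suc (d * a) d) (+-comm 1 (d * a + d)))) (≤-trans (+-monoʳ-≤ (d * a + d) d≥1) da+2d≤db))
      (add-children (suc d) d+1≤k (⊆A (here refl)) (*-monoʳ-≤ d (<⇒≤ a<b) , db<) start forest)
      (+-comm (suc d) roots)
      where
      d+1≤k : suc d ≤ k
      d+1≤k = ≤-trans (≤-trans (≤-reflexive (+-comm 1 d)) (+-monoʳ-≤ d (s≤s z≤n))) d+2≤k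
    build (no db≮) = extend (suc (suc d)) (suc roots) (s≤s z≤n) 2+d≤k
      (≤-trans (+-monoʳ-≤ (d * a) 2+d≤k) (≮⇒≥ db≮))
      (add-tree (suc d) 2+d≤k (⊆A (here refl)) forest)
      (trans (cong suc (+-comm (suc d) roots)) refl)
      where
      2+d≤k : suc (suc d) ≤ k
      2+d≤k = ≤-trans (≤-reflexive (+-comm 2 d)) d+2≤k

-- The window of the last edge is shortened by one position when it would run into that of the first edge;
-- this costs one unit of the surplus γ, which then is still at least half the number of gaps plus one.
cyclic-spanning : ∀ {d k N T A} → (d≥1 : 1 ≤ d) (d+2≤k : d + 2 ≤ k) → 2 ≤ T → 2 * T ≤ N → T ∉ A →
  (∀ {a} → a ∈ A → ∃ λ z → z ∉ A × a < z × z ≤ a + 2 * T) → (∀ {a} → a ∈ A → 1 ≤ a × a < N) →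
  ∀ a as → AllPairs _<_ (a ∷ as) → (∀ {b} → b ∈ a ∷ as → b ∈ A) →
  ∃ λ xs → ∃ λ c → ∃ λ γ → Forest d k d≥1 d+2≤k A xs c × length xs ≡ c + (d * suc (length as) + γ)
    × length xs ≤ suc (length as) * k × suc (length as) ≤ 4 * T * γ × Unique xs × (∀ {x} → x ∈ xs → d * a ≤ x × x < d * a + d * N)
cyclic-spanning {d} {k} {N} {T} {A} d≥1 d+2≤k 2≤T 2T≤N T∉A next bounded a as sorted ⊆A
  with d * lastFrom a as + (d + 1 + 1) ≤? d * a + d * N
... | yes fits = positions , roots , suc gaps , forest , trans size (lem roots (d * suc (length as)) gaps) , size≤ ,
    ≤-trans t≤ (*-monoˡ-≤ (suc gaps) (*-monoˡ-≤ T (s≤s (s≤s (z≤n {2}))))) , distinct , λ m → lower m , ≤-trans (upper m) fits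
  where
  open Spanning (spanning d k d≥1 d+2≤k A (2 * T) 1 ≤-refl next a as sorted ⊆A)
  lem : ∀ c x g → c + x + g + 1 ≡ c + (x + suc g)
  lem = solve-∀
  t≤ : suc (length as) ≤ 2 * T * suc gaps
  t≤ with next (⊆A (here refl))
  ... | z , z∉ , a<z , z≤ = +-cancelʳ-≤ a _ _ (≤-trans (many-gaps z∉ a<z) (≤-trans (+-monoʳ-≤ (2 * T * gaps) z≤) (≤-reflexive (lem′ T gaps a))))
    where
    lem′ : ∀ T g a → 2 * T * g + (a + 2 * T) ≡ 2 * T * suc g + a
    lem′ = solve-∀
... | no collide = positions , roots , gaps , forest , trans size′ (lem roots (d * suc (length as)) gaps) , size≤ ,
    t≤ , distinct , λ m → lower m , ≤-trans (upper m) top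
  where
  open Spanning (spanning d k d≥1 d+2≤k A (2 * T) 0 z≤n next a as sorted ⊆A) renaming (size to size₀)
  size′ : length positions ≡ roots + d * suc (length as) + gaps
  size′ = trans size₀ (+-identityʳ _)
  lem : ∀ c x g → c + x + g ≡ c + (x + g)
  lem = solve-∀
  last = lastFrom a as
  last<N : last < N
  last<N = proj₂ (bounded (⊆A (lastFrom-∈ a as)))
  1≤a : 1 ≤ a
  1≤a = proj₁ (bounded (⊆A (here refl)))
  d≤da : d ≤ d * a
  d≤da = ≤-trans (≤-reflexive (sym (*-identityʳ d))) (*-monoʳ-≤ d 1≤a)
  dlast : d * last + d ≤ d * N
  dlast = ≤-trans (≤-reflexive (trans (+-comm (d * last) d) (sym (*-suc d last)))) (*-monoʳ-≤ d last<N)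
  top : d * last + (d + 1 + 0) ≤ d * a + d * N
  top = ≤-trans (≤-reflexive (l (d * last) d)) (+-mono-≤ (≤-trans d≥1 d≤da) dlast)
    where
    l : ∀ x d → x + (d + 1 + 0) ≡ 1 + (x + d)
    l = solve-∀
  over : d * a + d * N < d * last + d + 2
  over = ≤-trans (≰⇒> collide) (≤-reflexive (l (d * last) d))
    where
    l : ∀ x d → x + (d + 1 + 1) ≡ x + d + 2
    l = solve-∀
  -- A collision gives d a + d N < d · last + d + 2 ≤ d N + 2, hence d a < 2: it can only happen if
  -- the first edge lies right after edge 0.
  a<T : a < T
  a<T = ≤-trans (≤-trans (s≤s a≤da) (+-cancelʳ-< (d * N) (d * a) 2 (≤-trans over (≤-trans (+-monoˡ-≤ 2 dlast) (≤-reflexive (+-comm (d * N) 2)))))) 2≤T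
    where
    a≤da : a ≤ d * a
    a≤da = m≤n*m a d {{>-nonZero d≥1}}
  gaps≥1 : 1 ≤ gaps
  gaps≥1 with gaps in eq
  ... | suc _ = s≤s z≤n
  -- Without gaps all edges form one run. It starts below T and edge T is absent, so it ends below
  -- T, which is too early to reach round the cycle when 2T ≤ N.
  ... | zero = ⊥-elim (<⇒≱ over (begin
      d * last + d + 2
    ≤⟨ +-monoˡ-≤ 2 (≤-trans (≤-reflexive (trans (+-comm (d * last) d) (sym (*-suc d last)))) (*-monoʳ-≤ d (no-gap eq T∉A a<T))) ⟩
      d * T + 2
    ≤⟨ +-monoʳ-≤ (d * T) (≤-trans 2≤T (m≤n*m T d {{>-nonZero d≥1}})) ⟩
      d * T + d * T
    ≡⟨ l d T ⟩
      d * (2 * T)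
    ≤⟨ *-monoʳ-≤ d 2T≤N ⟩
      d * N
    ≤⟨ m≤n+m (d * N) (d * a) ⟩
      d * a + d * N ∎))
    where
    open ≤-Reasoning
    l : ∀ d T → d * T + d * T ≡ d * (2 * T)
    l = solve-∀
  t≤ : suc (length as) ≤ 4 * T * gaps
  t≤ with next (⊆A (here refl))
  ... | z , z∉ , a<z , z≤ = +-cancelʳ-≤ a _ _ (begin
      suc (length as) + a
    ≤⟨ many-gaps z∉ a<z ⟩
      2 * T * gaps + z
    ≤⟨ +-monoʳ-≤ (2 * T * gaps) z≤ ⟩
      2 * T * gaps + (a + 2 * T)
    ≤⟨ +-monoʳ-≤ (2 * T * gaps) (+-monoʳ-≤ a (m≤m*n (2 * T) gaps {{>-nonZero gaps≥1}})) ⟩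
      2 * T * gaps + (a + 2 * T * gaps)
    ≡⟨ l T gaps a ⟩
      4 * T * gaps + a ∎)
    where
    open ≤-Reasoning
    l : ∀ T g a → 2 * T * g + (a + 2 * T * g) ≡ 4 * T * g + a
    l = solve-∀

-- Residues, unions of singletons and edges of cyclic orderings

mod-apart : ∀ n .{{_ : NonZero n}} {s x y} → s ≤ x → y < s + n → x < y → x % n ≢ y % n
mod-apart n {s} {x} {y} s≤x y< x<y e = <⇒≱ (+-cancelˡ-< x _ _ (subst (_< x + n) (sym (m+[n∸m]≡n (<⇒≤ x<y))) (≤-trans y< (+-monoˡ-≤ n s≤x))))
  (∣⇒≤ {{>-nonZero (m<n⇒0<n∸m x<y)}} (∣m+n∣m⇒∣n {n} {x / n * n} {y ∸ x} (divides (y / n) (+-cancelˡ-≡ (x % n) _ _ (begin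
      x % n + (x / n * n + (y ∸ x))
    ≡⟨ sym (+-assoc (x % n) _ _) ⟩
      x % n + x / n * n + (y ∸ x)
    ≡⟨ cong (_+ (y ∸ x)) (sym (m≡m%n+[m/n]*n x n)) ⟩
      x + (y ∸ x)
    ≡⟨ m+[n∸m]≡n (<⇒≤ x<y) ⟩
      y
    ≡⟨ trans (m≡m%n+[m/n]*n y n) (cong (_+ y / n * n) (sym e)) ⟩
      x % n + y / n * n ∎))) (n∣m*n (x / n))))
  where open ≡-Reasoning

mod-injective : ∀ n .{{_ : NonZero n}} {s x y} → s ≤ x → x < s + n → s ≤ y → y < s + n → x % n ≡ y % n → x ≡ y
mod-injective n {s} {x} {y} s≤x x< s≤y y< e with <-cmp x y
... | tri≈ _ eq _ = eq
... | tri< x<y _ _ = ⊥-elim (mod-apart n s≤x y< x<y e)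
... | tri> _ _ y<x = ⊥-elim (mod-apart n s≤y x< y<x (sym e))

∈-⋃⁺ : {A : Set} {n : ℕ} (g : A → Fin n) (xs : List A) {x : A} → x ∈ xs → g x ∈ₛ ⋃ (map (λ y → ⁅ g y ⁆) xs)
∈-⋃⁺ g (x ∷ xs) (here refl) = p⊆p∪q _ (x∈⁅x⁆ (g x))
∈-⋃⁺ g (y ∷ xs) (there m) = q⊆p∪q ⁅ g y ⁆ _ (∈-⋃⁺ g xs m)

∈-⋃⁻ : {A : Set} {n : ℕ} (g : A → Fin n) (xs : List A) {v : Fin n} → v ∈ₛ ⋃ (map (λ y → ⁅ g y ⁆) xs) → ∃ λ x → x ∈ xs × v ≡ g x
∈-⋃⁻ g [] m = ⊥-elim (∉⊥ m)
∈-⋃⁻ g (x ∷ xs) m with x∈p∪q⁻ ⁅ g x ⁆ _ m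
... | inj₁ m′ = x , here refl , x∈⁅y⁆⇒x≡y (g x) m′
... | inj₂ m′ with ∈-⋃⁻ g xs m′
... | y , y∈ , e = y , there y∈ , e

∣⁅x⁆∪p∣ : ∀ {n} (x : Fin n) (p : Subset n) → x ∉ₛ p → ∣ ⁅ x ⁆ ∪ p ∣ ≡ suc ∣ p ∣
∣⁅x⁆∪p∣ Fin.zero (true ∷ p) x∉ = ⊥-elim (x∉ here)
∣⁅x⁆∪p∣ Fin.zero (false ∷ p) x∉ = cong (suc ∘ ∣_∣) (∪-identityˡ p)
∣⁅x⁆∪p∣ (Fin.suc x) (true ∷ p) x∉ = cong suc (∣⁅x⁆∪p∣ x p (x∉ ∘ there))
∣⁅x⁆∪p∣ (Fin.suc x) (false ∷ p) x∉ = ∣⁅x⁆∪p∣ x p (x∉ ∘ there)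

∣⋃∣ : ∀ {n} {xs : List (Fin n)} → Unique xs → ∣ ⋃ (map ⁅_⁆ xs) ∣ ≡ length xs
∣⋃∣ {n} {[]} u = ∣⊥∣≡0 n
∣⋃∣ {xs = x ∷ xs} (x∉ ∷ u) = trans (∣⁅x⁆∪p∣ x _ (λ m → let (y , y∈ , e) = ∈-⋃⁻ id xs m in All.lookup x∉ y∈ e)) (cong suc (∣⋃∣ u))

∑-swap : {A B : Set} (xs : List A) (ys : List B) (f : A → B → ℕ) →
  ∑ xs (λ x → ∑ ys (f x)) ≡ ∑ ys (λ y → ∑ xs (λ x → f x y))
∑-swap [] ys f = sym (∑-zero ys (λ _ _ → refl))
∑-swap (x ∷ xs) ys f = trans (cong (∑ ys (f x) +_) (∑-swap xs ys f)) (sym (∑-+ ys (f x) _))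

∑-∈ : {A : Set} (xs : List A) (f : A → ℕ) {x : A} → x ∈ xs → f x ≤ ∑ xs f
∑-∈ (x ∷ xs) f (here refl) = m≤m+n (f x) _
∑-∈ (x ∷ xs) f (there m) = ≤-trans (∑-∈ xs f m) (m≤n+m _ (f x))

Unique-map : {A B : Set} (f : A → B) {xs : List A} → (∀ {x y} → x ∈ xs → y ∈ xs → f x ≡ f y → x ≡ y) → Unique xs → Unique (map f xs)
Unique-map f {[]} h u = []
Unique-map f {x ∷ xs} h (x∉ ∷ u) = All.tabulate (λ m e → lem (∈-map⁻ f m) e) ∷ Unique-map f (λ a b → h (there a) (there b)) u
  where
  lem : ∀ {z} → (∃ λ y → y ∈ xs × z ≡ f y) → f x ≢ z
  lem (y , y∈ , refl) e = All.lookup x∉ y∈ (h (here refl) (there y∈) e)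

Pointwise-nth : {A : Set} {R : ℕ → A → Set} {P : List ℕ} {xs : List A} → Pointwise R P xs → ∀ {y} (y∈ : y ∈ xs) → R (nth 0 P (toℕ (index y∈))) y
Pointwise-nth (r ∷ p) (here refl) = r
Pointwise-nth (_ ∷ p) (there m) = Pointwise-nth p m

InjectiveBelow : {A : Set} → ℕ → (ℕ → A) → Set
InjectiveBelow n ψ = ∀ {x y} → x < n → y < n → ψ x ≡ ψ y → x ≡ y

module _ (n : ℕ) .{{_ : NonZero n}} (d k : ℕ) where

  -- The set `cycEdge` of the definition of Hamilton cycles, for positions that are natural numbers;
  -- the passage to a bijection of `Fin n` is postponed to the end.
  edge : (ℕ → Fin n) → ℕ → Subset n
  edge ψ i = ⋃ (map (λ j → ⁅ ψ ((d * i + j) % n) ⁆) (upTo k))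

  ∈-edge⁺ : ∀ ψ {i j} → j < k → ψ ((d * i + j) % n) ∈ₛ edge ψ i
  ∈-edge⁺ ψ {i} j<k = ∈-⋃⁺ (λ j → ψ ((d * i + j) % n)) (upTo k) (∈-upTo⁺ j<k)

  ∈-edge⁻ : ∀ ψ {i v} → v ∈ₛ edge ψ i → ∃ λ j → j < k × v ≡ ψ ((d * i + j) % n)
  ∈-edge⁻ ψ {i} m with ∈-⋃⁻ (λ j → ψ ((d * i + j) % n)) (upTo k) m
  ... | j , j∈ , e = j , ∈-upTo⁻ j∈ , e

  near : ℕ → List ℕ
  near x = map (λ δ → (x + δ) % n) (upTo k) ++ map (λ δ → (x + (n ∸ δ)) % n) (upTo k)

  length-near : ∀ x → length (near x) ≡ 2 * k
  length-near x = trans (List.length-++ (map (λ δ → (x + δ) % n) (upTo k)))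
    (cong₂ _+_ (trans (List.length-map _ (upTo k)) (List.length-upTo k))
               (trans (trans (List.length-map _ (upTo k)) (List.length-upTo k)) (sym (+-identityʳ k))))

  ∈-near : k ≤ n → ∀ y {j₁ j₂} → j₁ < k → j₂ < k → (y + j₁) % n ∈ near ((y + j₂) % n)
  ∈-near k≤n y {j₁} {j₂} j₁<k j₂<k with ≤-total j₂ j₁
  ... | inj₁ j₂≤j₁ = ∈-++⁺ˡ (subst (_∈ map (λ δ → ((y + j₂) % n + δ) % n) (upTo k)) eq
      (∈-map⁺ (λ δ → ((y + j₂) % n + δ) % n) (∈-upTo⁺ (≤-trans (s≤s (m∸n≤m j₁ j₂)) j₁<k))))
    where
    eq : ((y + j₂) % n + (j₁ ∸ j₂)) % n ≡ (y + j₁) % n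
    eq = trans (%-shift (y + j₂) (j₁ ∸ j₂)) (cong (_% n) (trans (+-assoc y j₂ _) (cong (y +_) (m+[n∸m]≡n j₂≤j₁))))
      where
      %-shift : ∀ a b → (a % n + b) % n ≡ (a + b) % n
      %-shift a b = trans (%-distribˡ-+ (a % n) b n) (trans (cong (λ z → (z + b % n) % n) (m%n%n≡m%n a n)) (sym (%-distribˡ-+ a b n)))
  ... | inj₂ j₁≤j₂ = ∈-++⁺ʳ (map (λ δ → ((y + j₂) % n + δ) % n) (upTo k)) (subst (_∈ map (λ δ → ((y + j₂) % n + (n ∸ δ)) % n) (upTo k)) eq
      (∈-map⁺ (λ δ → ((y + j₂) % n + (n ∸ δ)) % n) (∈-upTo⁺ (≤-trans (s≤s (m∸n≤m j₂ j₁)) j₂<k))))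
    where
    δ = j₂ ∸ j₁
    δ≤n : δ ≤ n
    δ≤n = ≤-trans (m∸n≤m j₂ j₁) (≤-trans (<⇒≤ j₂<k) k≤n)
    eq : ((y + j₂) % n + (n ∸ δ)) % n ≡ (y + j₁) % n
    eq = trans (trans (%-distribˡ-+ ((y + j₂) % n) (n ∸ δ) n) (trans (cong (λ z → (z + (n ∸ δ) % n) % n) (m%n%n≡m%n (y + j₂) n)) (sym (%-distribˡ-+ (y + j₂) (n ∸ δ) n))))
      (trans (cong (_% n) (begin
          y + j₂ + (n ∸ δ)
        ≡⟨ cong (λ z → y + z + (n ∸ δ)) (sym (m+[n∸m]≡n j₁≤j₂)) ⟩
          y + (j₁ + δ) + (n ∸ δ)
        ≡⟨ lem y j₁ δ (n ∸ δ) ⟩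
          y + j₁ + (δ + (n ∸ δ))
        ≡⟨ cong (y + j₁ +_) (m+[n∸m]≡n δ≤n) ⟩
          y + j₁ + n ∎)) ([m+n]%n≡m%n (y + j₁) n))
      where
      open ≡-Reasoning
      lem : ∀ a b c e → a + (b + c) + e ≡ a + b + (c + e)
      lem = solve-∀

  module _ (k≤n : k ≤ n) (d≥1 : 1 ≤ d) (d+2≤k : d + 2 ≤ k) (A : List ℕ) where

    -- The possible positions, in another ordering with the same edges, of the vertices of a forest.
    leaves : ∀ {xs c} → Forest d k d≥1 d+2≤k A xs c → List (List ℕ)
    leaves [] = [] ∷ []
    leaves (root _ _ f) = concatMap (λ P → map (_∷ P) (upTo n)) (leaves f)
    leaves (child y∈ _ _ _ f) = concatMap (λ P → map (_∷ P) (near (nth 0 P (toℕ (index y∈))))) (leaves f)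

    length-leaves : ∀ {xs c} (f : Forest d k d≥1 d+2≤k A xs c) → length (leaves f) ≤ n ^ c * (2 * k) ^ length xs
    length-leaves [] = ≤-refl
    length-leaves {x ∷ xs} {suc c} (root _ _ f) = begin
        length (concatMap (λ P → map (_∷ P) (upTo n)) (leaves f))
      ≡⟨ trans (length-∑ (concatMap (λ P → map (_∷ P) (upTo n)) (leaves f))) (trans (∑-concatMap (λ P → map (_∷ P) (upTo n)) (leaves f) (λ _ → 1))
          (∑-cong (leaves f) (λ P _ → trans (sym (length-∑ (map (_∷ P) (upTo n)))) (trans (List.length-map _ (upTo n)) (List.length-upTo n))))) ⟩
        ∑ (leaves f) (λ _ → n)
      ≡⟨ ∑-const (leaves f) n ⟩
        length (leaves f) * n
      ≤⟨ *-monoˡ-≤ n (length-leaves f) ⟩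
        n ^ c * (2 * k) ^ length xs * n
      ≡⟨ lem (n ^ c) ((2 * k) ^ length xs) n ⟩
        n * n ^ c * (2 * k) ^ length xs
      ≤⟨ *-monoʳ-≤ (n * n ^ c) (m≤n*m ((2 * k) ^ length xs) (2 * k) {{2k≢0}}) ⟩
        n * n ^ c * ((2 * k) * (2 * k) ^ length xs) ∎
      where
      open ≤-Reasoning
      lem : ∀ a b c → a * b * c ≡ c * a * b
      lem = solve-∀
      2k≢0 : NonZero (2 * k)
      2k≢0 = >-nonZero (≤-trans (≤-trans d≥1 (≤-trans (m≤m+n d 2) d+2≤k)) (m≤m+n k (k + 0)))
    length-leaves {x ∷ xs} {c} (child y∈ _ _ _ f) = begin
        length (concatMap (λ P → map (_∷ P) (near (p P))) (leaves f))
      ≡⟨ trans (length-∑ (concatMap (λ P → map (_∷ P) (near (p P))) (leaves f))) (trans (∑-concatMap (λ P → map (_∷ P) (near (p P))) (leaves f) (λ _ → 1))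
          (∑-cong (leaves f) (λ P _ → trans (sym (length-∑ (map (_∷ P) (near (p P))))) (trans (List.length-map _ (near (p P))) (length-near (p P)))))) ⟩
        ∑ (leaves f) (λ _ → 2 * k)
      ≡⟨ ∑-const (leaves f) (2 * k) ⟩
        length (leaves f) * (2 * k)
      ≤⟨ *-monoˡ-≤ (2 * k) (length-leaves f) ⟩
        n ^ c * (2 * k) ^ length xs * (2 * k)
      ≡⟨ trans (*-assoc (n ^ c) _ _) (cong (n ^ c *_) (*-comm ((2 * k) ^ length xs) (2 * k))) ⟩
        n ^ c * ((2 * k) * (2 * k) ^ length xs) ∎
      where
      open ≤-Reasoning
      p : List ℕ → ℕ
      p P = nth 0 P (toℕ (index y∈))

    ∈-concatMap-map : {X : Set} {Z : ℕ → X → X} {h : X → List ℕ} {Ps : List X} {P : X} {q : ℕ} → P ∈ Ps → q ∈ h P →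
      Z q P ∈ concatMap (λ P → map (λ q → Z q P) (h P)) Ps
    ∈-concatMap-map {Z = Z} {h} {Ps} P∈ q∈ = ∈-concatMap⁺ (λ P → map (λ q → Z q P) (h P)) (lose P∈ (∈-map⁺ (λ q → Z q _) q∈))

    module _ (φ ψ : ℕ → Fin n) (ψ-injective : InjectiveBelow n ψ) (same : ∀ {a} → a ∈ A → ∃ λ i → edge φ a ≡ edge ψ i) where

      vertex-in-edge : ∀ {a x} → a ∈ A → InEdge d k d≥1 d+2≤k A a x → φ (x % n) ∈ₛ edge φ a
      vertex-in-edge {a} {x} a∈ (l , u) = subst (λ z → φ (z % n) ∈ₛ edge φ a) (m+[n∸m]≡n l)
        (∈-edge⁺ φ (+-cancelˡ-< (d * a) _ _ (subst (_< d * a + k) (sym (m+[n∸m]≡n l)) u)))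

      -- Every vertex of the forest lies in an edge of φ which is also an edge of ψ. A child and its
      -- parent share such an edge, so in ψ they are less than k apart; injectivity of ψ identifies
      -- the position recorded for the parent with its position in that edge.
      ∈-leaves : ∀ {xs c} (f : Forest d k d≥1 d+2≤k A xs c) →
        ∃ λ P → P ∈ leaves f × Pointwise (λ p x → p < n × ψ p ≡ φ (x % n)) P xs
      ∈-leaves [] = [] , here refl , []
      ∈-leaves (root a∈ e f) with ∈-leaves f | same a∈
      ... | P , P∈ , h | i , eq with ∈-edge⁻ ψ (subst (_ ∈ₛ_) eq (vertex-in-edge a∈ e))
      ... | j , _ , v≡ = (d * i + j) % n ∷ P , ∈-concatMap-map {Z = _∷_} {h = λ _ → upTo n} P∈ (∈-upTo⁺ (m%n<n (d * i + j) n)) , (m%n<n (d * i + j) n , sym v≡) ∷ h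
      ∈-leaves (child y∈ a∈ ex ey f) with ∈-leaves f | same a∈
      ... | P , P∈ , h | i , eq with ∈-edge⁻ ψ (subst (_ ∈ₛ_) eq (vertex-in-edge a∈ ex)) | ∈-edge⁻ ψ (subst (_ ∈ₛ_) eq (vertex-in-edge a∈ ey)) | Pointwise-nth h y∈
      ... | j₁ , j₁<k , v≡ | j₂ , j₂<k , w≡ | p<n , p≡ =
        (d * i + j₁) % n ∷ P ,
        ∈-concatMap-map {Z = _∷_} {h = λ P → near (nth 0 P (toℕ (index y∈)))} P∈
          (subst (λ z → (d * i + j₁) % n ∈ near z) (sym (ψ-injective p<n (m%n<n (d * i + j₂) n) (trans p≡ w≡))) (∈-near k≤n (d * i) j₁<k j₂<k)) ,
        (m%n<n (d * i + j₁) n , sym v≡) ∷ h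

-- Spread of the random Hamilton cycle

select : {A : Set} (xs : List A) → Subset (length xs) → List A
select [] W = []
select (x ∷ xs) (true ∷ W) = x ∷ select xs W
select (x ∷ xs) (false ∷ W) = select xs W

length-select : {A : Set} (xs : List A) (W : Subset (length xs)) → length (select xs W) ≡ ∣ W ∣
length-select [] [] = refl
length-select (x ∷ xs) (true ∷ W) = cong suc (length-select xs W)
length-select (x ∷ xs) (false ∷ W) = length-select xs W

select-∈ : {A : Set} (xs : List A) (W : Subset (length xs)) {x : A} → x ∈ select xs W → x ∈ xs
select-∈ (x ∷ xs) (true ∷ W) (here refl) = here refl
select-∈ (x ∷ xs) (true ∷ W) (there m) = there (select-∈ xs W m)
select-∈ (x ∷ xs) (false ∷ W) m = there (select-∈ xs W m)

Unique-select : {A : Set} (xs : List A) (W : Subset (length xs)) → Unique xs → Unique (select xs W)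
Unique-select [] W u = []
Unique-select (x ∷ xs) (true ∷ W) (x∉ ∷ u) = All.tabulate (λ m → All.lookup x∉ (select-∈ xs W m)) ∷ Unique-select xs W u
Unique-select (x ∷ xs) (false ∷ W) (_ ∷ u) = Unique-select xs W u

module _ {n : ℕ} where
  open import Data.List.Membership.DecPropositional (≡-dec {A = Bool} {n = n} Bool._≟_) using () renaming (_∈?_ to _∈ᴸ?_) public

  -- Sets of edges become subsets of the index set of a list of potential edges, the form on which
  -- `𝔼` and the fragments work; `select` goes back.
  mask : (xs es : List (Subset n)) → Subset (length xs)
  mask [] es = []
  mask (x ∷ xs) es = does (x ∈ᴸ? es) ∷ mask xs es

  select-mask : ∀ xs es (J : Subset (length xs)) → J ⊆ mask xs es → ∀ {e} → e ∈ select xs J → e ∈ es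
  select-mask (x ∷ xs) es (true ∷ J) h m with x ∈ᴸ? es | m
  ... | yes x∈ | here refl = x∈
  ... | yes x∈ | there m′ = select-mask xs es J (drop-∷-⊆ h) m′
  ... | no _ | _ with h here
  ... | ()
  select-mask (x ∷ xs) es (false ∷ J) h m = select-mask xs es J (drop-∷-⊆ h) m

  mask-select : ∀ xs es (W : Subset (length xs)) → mask xs es ⊆ W → ∀ {e} → e ∈ xs → e ∈ es → e ∈ select xs W
  mask-select (x ∷ xs) es (w ∷ W) h (there m) e∈ with w
  ... | true = there (mask-select xs es W (drop-∷-⊆ h) m e∈)
  ... | false = mask-select xs es W (drop-∷-⊆ h) m e∈
  mask-select (x ∷ xs) es (w ∷ W) h (here refl) e∈ with x ∈ᴸ? es | w
  ... | yes _ | true = here refl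
  ... | yes _ | false with h here
  ... | ()
  mask-select (x ∷ xs) es (w ∷ W) h (here refl) e∈ | no x∉ | _ = ⊥-elim (x∉ e∈)

  mask-size : ∀ xs es → Unique xs → ∣ mask xs es ∣ ≤ length es
  mask-size xs es u = ≤-trans (≤-reflexive (sym (length-select xs (mask xs es))))
    (Unique-⊆-length (Unique-select xs (mask xs es) u) (select-mask xs es (mask xs es) ⊆-refl))

indicator : Bool → ℕ
indicator true = 1
indicator false = 0

removed? : ∀ T B i → Dec (T ∣ i × i < T * B)
removed? T B i = (T ∣? i) ×-dec (i <? T * B)

-- H supplies the edges with the other numbers; these are the ones that the random graph has to
-- provide.
kept : ℕ → ℕ → ℕ → List ℕ
kept T B N = filter (λ i → ¬? (removed? T B i)) (upTo N)

length-kept : ∀ T B N → length (kept T B N) ≤ N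
length-kept T B N = ≤-trans (List.length-filter (λ i → ¬? (removed? T B i)) (upTo N)) (≤-reflexive (List.length-upTo N))

kept-sorted : ∀ T B N → AllPairs _<_ (kept T B N)
kept-sorted T B N = AllPairs.filter⁺ (λ i → ¬? (removed? T B i)) (AllPairs.applyUpTo⁺₁ id N (λ i<j _ → i<j))

∈-kept⁻ : ∀ T B N {i} → i ∈ kept T B N → i < N × ¬ (T ∣ i × i < T * B)
∈-kept⁻ T B N m = let (a , b) = ∈-filter⁻ (λ i → ¬? (removed? T B i)) {xs = upTo N} m in ∈-upTo⁻ a , b

-- The next multiple of T interrupts the run, except after the last block. There N takes its place,
-- which is at distance at most 2T because N < T (B + 1).
kept-next : ∀ T B N .{{_ : NonZero T}} → T * B ≤ N → N < T * suc B → ∀ {a} → a ∈ kept T B N →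
  ∃ λ z → z ∉ kept T B N × a < z × z ≤ a + 2 * T
kept-next T B N TB≤N N< {a} a∈ with T * suc (a / T) <? T * B
... | yes z< = T * suc (a / T) , (λ m → proj₂ (∈-kept⁻ T B N m) (m∣m*n (suc (a / T)) , z<)) , a<z , ≤-trans z≤ (+-monoʳ-≤ a (m≤m+n T (T + 0)))
  where
  a<z : a < T * suc (a / T)
  a<z = subst₂ _<_ (sym (m≡m%n+[m/n]*n a T)) (trans (cong (T +_) (*-comm (a / T) T)) (sym (*-suc T (a / T)))) (+-monoˡ-< (a / T * T) (m%n<n a T))
  z≤ : T * suc (a / T) ≤ a + T
  z≤ = ≤-trans (≤-reflexive (trans (*-suc T (a / T)) (trans (+-comm T _) (cong (_+ T) (*-comm T (a / T)))))) (+-monoˡ-≤ T (m/n*n≤m a T))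
... | no z≮ = N , (λ m → <-irrefl refl (proj₁ (∈-kept⁻ T B N m))) , proj₁ (∈-kept⁻ T B N a∈) , (begin
    N
  ≤⟨ <⇒≤ N< ⟩
    T * suc B
  ≡⟨ *-suc T B ⟩
    T + T * B
  ≤⟨ +-monoʳ-≤ T (≮⇒≥ z≮) ⟩
    T + T * suc (a / T)
  ≡⟨ lem T (a / T) ⟩
    a / T * T + 2 * T
  ≤⟨ +-monoˡ-≤ (2 * T) (m/n*n≤m a T) ⟩
    a + 2 * T ∎)
  where
  open ≤-Reasoning
  lem : ∀ T q → T + T * suc q ≡ q * T + 2 * T
  lem = solve-∀

-- Here N is the number of edges of the cycle, B the number of blocks, s the number of positions
-- between two blocks, R the number of permuted vertices, D the number of candidates for a block and
-- C the loss per prescribed vertex.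
module Family (n : ℕ) .{{n≢0 : NonZero n}} (d k s N T B R D C : ℕ) (z : Fin n) (Hl : List (List (Fin n)))
  (Hl-length : ∀ {y} → y ∈ Hl → length y ≡ k) (Hl-distinct : ∀ {y} → y ∈ Hl → Unique y) (Hl-unique : Unique Hl)
  (available : ∀ used → length used + R ≤ n → D ≤ length (filter (avoiding? used) Hl))
  (d≥1 : 1 ≤ d) (d+2≤k : d + 2 ≤ k) (k≤n : k ≤ n) (n≡ : n ≡ d * N) (BkR : B * k + R ≡ n) (dT : k + s ≡ d * T)
  (2≤T : 2 ≤ T) (2≤B : 2 ≤ B) (TB≤N : T * B ≤ N) (N< : N < T * suc B)
  (8≤C : 8 ≤ C) (CD : n ^ k ≤ C * D) (n≤2R : n ≤ 2 * R) where

  Ψ : List (List (Fin n))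
  Ψ = orderings D Hl R B []

  Q : ℕ
  Q = D ^ B * R !

  position : List (Fin n) → ℕ → Fin n
  position ξ x = nth z ξ (shuffle k s B x)

  fits : Fits k D C R Hl Hl-length Hl-distinct Hl-unique available B []
  fits = [] , BkR

  length-Ψ : length Ψ ≡ Q
  length-Ψ = length-orderings k D C R Hl Hl-length Hl-distinct Hl-unique available B [] fits

  Ψ-properties : ∀ {ξ} → ξ ∈ Ψ → Unique ξ × (∀ {v} → v ∈ ξ → v ∉ []) × length ξ ≡ B * k + R
        × (∀ {z b} → b < B → ∃ λ y → y ∈ Hl × (∀ {o} → o < k → nth z ξ (b * k + o) ≡ nth z y o))
  Ψ-properties = ordering-properties k D C R Hl Hl-length Hl-distinct Hl-unique available B [] fits

  Ψ-length : ∀ {ξ} → ξ ∈ Ψ → length ξ ≡ n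
  Ψ-length m = trans (proj₁ (proj₂ (proj₂ (Ψ-properties m)))) BkR

  BY≤n : B * (k + s) ≤ n
  BY≤n = ≤-trans (≤-reflexive (trans (cong (B *_) dT) (lem B d T))) (≤-trans (*-monoʳ-≤ d TB≤N) (≤-reflexive (sym n≡)))
    where
    lem : ∀ B d T → B * (d * T) ≡ d * (T * B)
    lem = solve-∀

  shuffle<n : ∀ {x} → x < n → shuffle k s B x < n
  shuffle<n = shuffle-< k s B BY≤n

  position-injective : ∀ {ξ} → ξ ∈ Ψ → InjectiveBelow n (position ξ)
  position-injective {ξ} m x<n y<n e = shuffle-injective k s B
    (nth-injective (proj₁ (Ψ-properties m)) (subst (_ <_) (sym (Ψ-length m)) (shuffle<n x<n)) (subst (_ <_) (sym (Ψ-length m)) (shuffle<n y<n)) e)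

  pins? : ∀ ξ P us → Dec (Pins z n (shuffle k s B) ξ P us)
  pins? ξ = Pointwise.decidable (λ x u → (x <? n) ×-dec (position ξ x Fin.≟ u))

  ∑-pins : ∀ P us → Unique us → ∑ Ψ (λ ξ → 𝟙 (pins? ξ P us)) * n ^ length us ≤ C ^ length us * Q
  ∑-pins P us u with Pins-Match z n (shuffle k s B) shuffle<n P us u
  ... | inj₁ none = ≤-trans (≤-reflexive (cong (_* n ^ length us) (∑-zero Ψ (λ ξ m → 𝟙-false (none {ξ} (Ψ-length m)) (pins? ξ P us))))) z≤n
  ... | inj₂ (ps , len , p↭ , h) = begin
      ∑ Ψ (λ ξ → 𝟙 (pins? ξ P us)) * n ^ length us
    ≤⟨ *-monoˡ-≤ (n ^ length us) (∑-mono Ψ (λ ξ m → 𝟙-mono (h {ξ} (Ψ-length m)) (pins? ξ P us) (match? ps ξ))) ⟩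
      ∑ Ψ (λ ξ → 𝟙 (match? ps ξ)) * n ^ length us
    ≡⟨ cong (λ l → ∑ Ψ (λ ξ → 𝟙 (match? ps ξ)) * n ^ l) (sym (↭-length p↭)) ⟩
      ∑ Ψ (λ ξ → 𝟙 (match? ps ξ)) * n ^ ∣ ps ∣⁺
    ≤⟨ orderings-match k D C R Hl Hl-length Hl-distinct Hl-unique available 8≤C CD n≤2R B [] ps fits (trans len (sym BkR)) (Unique-resp-↭ (↭-sym p↭) u) ⟩
      C ^ ∣ ps ∣⁺ * Q
    ≡⟨ cong (λ l → C ^ l * Q) (↭-length p↭) ⟩
      C ^ length us * Q ∎
    where open ≤-Reasoning

  module _ (A : List ℕ) (A⊆ : ∀ {a} → a ∈ A → a ∈ kept T B N) (φ : List (Fin n)) (φ∈ : φ ∈ Ψ)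
    {G : List (Fin n) → Set} (G? : ∀ ξ → Dec (G ξ))
    (G-same : ∀ {ξ} → G ξ → ∀ {a} → a ∈ A → ∃ λ i → edge n d k (position φ) a ≡ edge n d k (position ξ) i) where

    K : ℕ
    K = (2 * k * C) ^ k

    -- A union bound over the possible placements of a spanning forest: at most n^c (2k)^v of them,
    -- each of probability at most (C / n)^v, with v - c = dt + γ. The constants are collected in
    -- K^t, as v ≤ tk.
    ∑-edges : ∀ a as → a ∷ as ≡ A → AllPairs _<_ A → ∃ λ γ → length A ≤ 4 * T * γ ×
      ∑ Ψ (λ ξ → 𝟙 (G? ξ)) * n ^ (d * length A + γ) ≤ K ^ length A * Q
    ∑-edges a as refl sorted with cyclic-spanning {d} {k} {N} {T} {A} d≥1 d+2≤k 2≤T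
        (≤-trans (≤-reflexive (*-comm 2 T)) (≤-trans (*-monoʳ-≤ T 2≤B) TB≤N))
        (λ m → proj₂ (∈-kept⁻ T B N (A⊆ m)) (divides 1 (sym (+-identityʳ T)) , T<TB))
        (λ m → let (z , z∉ , l , u) = kept-next T B N {{T≢0}} TB≤N N< (A⊆ m) in z , z∉ ∘ A⊆ , l , u)
        -- Edge 0 comes from H, so the numbers in A start at 1. Together with the absence of edge T
        -- this controls what happens where the cycle closes.
        (λ m → n≢0⇒n>0 (λ { refl → proj₂ (∈-kept⁻ T B N (A⊆ m)) (divides 0 refl , ≤-trans (s≤s z≤n) T<TB) }) , proj₁ (∈-kept⁻ T B N (A⊆ m)))
        a as sorted id
      where
      T≢0 : NonZero T
      T≢0 = >-nonZero (≤-trans (s≤s z≤n) 2≤T)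
      T<TB : T < T * B
      T<TB = m<m*n T B {{T≢0}} 2≤B
    ... | xs , c , γ , f , size , size≤ , t≤ , distinct , range = γ , t≤ , *-cancelˡ-≤ (n ^ c) {{m^n≢0 n c}} (begin
        n ^ c * (X * n ^ (d * t + γ))
      ≡⟨ trans (lem (n ^ c) X _) (cong (X *_) (trans (sym (^-distribˡ-+-* n c _)) (cong (n ^_) (sym size)))) ⟩
        X * n ^ v
      ≤⟨ *-monoˡ-≤ (n ^ v) (∑-mono Ψ each) ⟩
        ∑ Ψ (λ ξ → ∑ Ls (λ P → 𝟙 (pins? ξ P us))) * n ^ v
      ≡⟨ trans (cong (_* n ^ v) (∑-swap Ψ Ls _)) (sym (∑-*ʳ Ls _ (n ^ v))) ⟩
        ∑ Ls (λ P → ∑ Ψ (λ ξ → 𝟙 (pins? ξ P us)) * n ^ v)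
      ≤⟨ ∑-mono Ls (λ P _ → subst (λ l → ∑ Ψ (λ ξ → 𝟙 (pins? ξ P us)) * n ^ l ≤ C ^ l * Q) (List.length-map u xs) (∑-pins P us us-unique)) ⟩
        ∑ Ls (λ P → C ^ v * Q)
      ≡⟨ ∑-const Ls _ ⟩
        length Ls * (C ^ v * Q)
      ≤⟨ *-monoˡ-≤ (C ^ v * Q) (length-leaves n d k k≤n d≥1 d+2≤k A f) ⟩
        n ^ c * (2 * k) ^ v * (C ^ v * Q)
      ≡⟨ trans (lem₂ (n ^ c) ((2 * k) ^ v) (C ^ v) Q) (cong (λ z → n ^ c * (z * Q)) (sym (*-^ (2 * k) C v))) ⟩
        n ^ c * ((2 * k * C) ^ v * Q)
      ≤⟨ *-monoʳ-≤ (n ^ c) (*-monoˡ-≤ Q (≤-trans (^-monoʳ-≤ (2 * k * C) {{2kC≢0}} size≤)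
           (≤-reflexive (trans (cong ((2 * k * C) ^_) (*-comm t k)) (sym (^-*-assoc (2 * k * C) k t)))))) ⟩
        n ^ c * (K ^ t * Q) ∎)
      where
      open ≤-Reasoning
      t = suc (length as)
      v = length xs
      X = ∑ Ψ (λ ξ → 𝟙 (G? ξ))
      u : ℕ → Fin n
      u x = position φ (x % n)
      us = map u xs
      Ls = leaves n d k k≤n d≥1 d+2≤k A f
      2kC≢0 : NonZero (2 * k * C)
      2kC≢0 = m*n≢0 (2 * k) C {{m*n≢0 2 k {{_}} {{>-nonZero (≤-trans (s≤s z≤n) (≤-trans (m≤n+m 2 d) d+2≤k))}}}} {{>-nonZero (≤-trans (s≤s z≤n) 8≤C)}}
      lem : ∀ a b c → a * (b * c) ≡ b * (a * c)
      lem = solve-∀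
      lem₂ : ∀ a b c d → a * b * (c * d) ≡ a * (b * c * d)
      lem₂ = solve-∀
      -- All positions of the forest lie within one turn starting at d a, so they remain distinct
      -- modulo n.
      us-unique : Unique us
      us-unique = Unique-map u (λ {x} {y} x∈ y∈ e → mod-injective n {d * a} (proj₁ (range x∈)) (up x∈) (proj₁ (range y∈)) (up y∈)
        (position-injective φ∈ (m%n<n x n) (m%n<n y n) e)) distinct
        where
        up : ∀ {x} → x ∈ xs → x < d * a + n
        up m = subst (λ z → _ < d * a + z) (sym n≡) (proj₂ (range m))
      each : ∀ ξ → ξ ∈ Ψ → 𝟙 (G? ξ) ≤ ∑ Ls (λ P → 𝟙 (pins? ξ P us))
      each ξ ξ∈ with G? ξ
      ... | no _ = z≤n
      ... | yes g with ∈-leaves n d k k≤n d≥1 d+2≤k A (position φ) (position ξ) (position-injective ξ∈) (G-same g) f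
      ... | P , P∈ , h = ≤-trans (≤-reflexive (sym (𝟙-true (pin h) (pins? ξ P us)))) (∑-∈ Ls (λ P → 𝟙 (pins? ξ P us)) P∈)
        where
        pin : ∀ {P xs} → Pointwise (λ p x → p < n × position ξ p ≡ u x) P xs → Pins z n (shuffle k s B) ξ P (map u xs)
        pin [] = []
        pin (r ∷ p) = r ∷ pin p

  module _ (es : List (Subset n)) (es-unique : Unique es) where

    kept-edges : List (Fin n) → List (Subset n)
    kept-edges ξ = map (edge n d k (position ξ)) (kept T B N)

    edge-mask : List (Fin n) → Subset (length es)
    edge-mask ξ = mask es (kept-edges ξ)

    edge-mask-size : ∀ ξ → ∣ edge-mask ξ ∣ ≤ N
    edge-mask-size ξ = ≤-trans (mask-size es (kept-edges ξ) es-unique)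
      (≤-trans (≤-reflexive (List.length-map _ (kept T B N))) (length-kept T B N))

    -- One member φ that contains J serves as reference, and t counts its kept edges that belong to
    -- J. Asking only for |J| ≤ t spares a proof that different numbers give different edges. If no
    -- member contains J, the sum vanishes.
    ∑-edge-mask : ∀ J → ∃ λ t → ∣ J ∣ ≤ t × ∃ λ γ → t ≤ 4 * T * γ ×
      ∑ Ψ (λ ξ → 𝟙 (J ⊆? edge-mask ξ)) * n ^ (d * t + γ) ≤ ((2 * k * C) ^ k) ^ t * Q
    ∑-edge-mask J with Any.any? (λ ξ → J ⊆? edge-mask ξ) Ψ
    ... | no none = ∣ J ∣ , ≤-refl , ∣ J ∣ , m≤n*m ∣ J ∣ (4 * T) {{>-nonZero (≤-trans (≤-trans (s≤s z≤n) 2≤T) (m≤m+n T _))}} ,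
      ≤-trans (≤-reflexive (cong (_* n ^ (d * ∣ J ∣ + ∣ J ∣)) (∑-zero Ψ (λ ξ m → 𝟙-false {J ⊆ edge-mask ξ} (λ p → none (lose {P = λ ξ → J ⊆ edge-mask ξ} m p)) (J ⊆? edge-mask ξ))))) z≤n
    ... | yes some with find some
    ... | φ , φ∈ , J⊆ = length A , J≤A , go A refl
      where
      A = filter (λ i → edge n d k (position φ) i ∈ᴸ? select es J) (kept T B N)
      J≤A : ∣ J ∣ ≤ length A
      J≤A = ≤-trans (≤-reflexive (sym (length-select es J))) (≤-trans
        (Unique-⊆-length {ys = map (edge n d k (position φ)) A} (Unique-select es J es-unique) inA) (≤-reflexive (List.length-map _ A)))
        where
        inA : ∀ {e} → e ∈ select es J → e ∈ map (edge n d k (position φ)) A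
        inA m with ∈-map⁻ (edge n d k (position φ)) (select-mask es (kept-edges φ) J J⊆ m)
        ... | i , i∈ , refl = ∈-map⁺ (edge n d k (position φ)) (∈-filter⁺ (λ i → edge n d k (position φ) i ∈ᴸ? select es J) i∈ m)
      A⊆ : ∀ {a} → a ∈ A → a ∈ kept T B N
      A⊆ m = proj₁ (∈-filter⁻ (λ i → edge n d k (position φ) i ∈ᴸ? select es J) m)
      same : ∀ {ξ} → J ⊆ edge-mask ξ → ∀ {a} → a ∈ A → ∃ λ i → edge n d k (position φ) a ≡ edge n d k (position ξ) i
      same {ξ} J⊆ξ {a} m with ∈-map⁻ (edge n d k (position ξ)) (select-mask es (kept-edges ξ) J J⊆ξ
        (proj₂ (∈-filter⁻ (λ i → edge n d k (position φ) i ∈ᴸ? select es J) {xs = kept T B N} m)))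
      ... | i , _ , eq = i , eq
      go : ∀ as → as ≡ A → ∃ λ γ → length A ≤ 4 * T * γ ×
        ∑ Ψ (λ ξ → 𝟙 (J ⊆? edge-mask ξ)) * n ^ (d * length A + γ) ≤ ((2 * k * C) ^ k) ^ length A * Q
      go [] eq = 0 , subst (λ l → length l ≤ 4 * T * 0) eq z≤n , subst (λ l → ∑ Ψ (λ ξ → 𝟙 (J ⊆? edge-mask ξ)) * n ^ (d * length l + 0) ≤ ((2 * k * C) ^ k) ^ length l * Q) eq (begin
          ∑ Ψ (λ ξ → 𝟙 (J ⊆? edge-mask ξ)) * n ^ (d * 0 + 0)
        ≤⟨ *-monoˡ-≤ (n ^ (d * 0 + 0)) (∑-mono Ψ (λ ξ _ → 𝟙≤1 (J ⊆? edge-mask ξ))) ⟩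
          ∑ Ψ (λ ξ → 1) * n ^ (d * 0 + 0)
        ≡⟨ cong₂ (λ a b → a * n ^ (b + 0)) (trans (sym (length-∑ Ψ)) length-Ψ) (*-zeroʳ d) ⟩
          Q * 1
        ≡⟨ *-comm Q 1 ⟩
          1 * Q ∎)
        where open ≤-Reasoning
      go (a ∷ as) eq = ∑-edges A A⊆ φ φ∈ {λ ξ → J ⊆ edge-mask ξ} (λ ξ → J ⊆? edge-mask ξ) (λ {ξ} → same {ξ}) a as eq
        (AllPairs.filter⁺ (λ i → edge n d k (position φ) i ∈ᴸ? select es J) (kept-sorted T B N))

    -- As t ≤ 4Tγ, the surplus n^γ is at least y^(16Tγ) ≥ y^(4t), so that every edge gains a factor
    -- y^4 over n^d. Passing from t to |J| only drops factors a / x ≤ 1.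
    family-spread : ∀ y a x .{{_ : NonZero y}} .{{_ : NonZero x}} → y ^ (16 * T) ≤ n →
      (2 * k * C) ^ k * x ≤ a * (n ^ d * y ^ 4) → a ≤ x → Spread x a Q (map edge-mask Ψ)
    family-spread y a x y≤n x≤ a≤x J with ∑-edge-mask J
    ... | t , J≤t , γ , t≤ , bound = *-cancelʳ-≤ _ _ (x ^ (t ∸ ∣ J ∣)) {{m^n≢0 x (t ∸ ∣ J ∣)}} (begin
        ∑ (map edge-mask Ψ) (λ S → 𝟙 (J ⊆? S)) * x ^ ∣ J ∣ * x ^ e
      ≡⟨ trans (cong (λ z → z * x ^ ∣ J ∣ * x ^ e) (∑-map edge-mask Ψ _)) (trans (*-assoc X _ _) (cong (X *_) (trans (sym (^-distribˡ-+-* x ∣ J ∣ e)) (cong (x ^_) (m+[n∸m]≡n J≤t))))) ⟩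
        X * x ^ t
      ≤⟨ all-edges ⟩
        Q * a ^ t
      ≡⟨ trans (cong (λ z → Q * a ^ z) (sym (m+[n∸m]≡n J≤t))) (trans (cong (Q *_) (^-distribˡ-+-* a ∣ J ∣ e)) (sym (*-assoc Q _ _))) ⟩
        Q * a ^ ∣ J ∣ * a ^ e
      ≤⟨ *-monoʳ-≤ (Q * a ^ ∣ J ∣) (^-monoˡ-≤ e a≤x) ⟩
        Q * a ^ ∣ J ∣ * x ^ e ∎)
      where
      open ≤-Reasoning
      e = t ∸ ∣ J ∣
      X = ∑ Ψ (λ ξ → 𝟙 (J ⊆? edge-mask ξ))
      G = (2 * k * C) ^ k
      Z = n ^ d * y ^ 4
      G≢0 : NonZero G
      G≢0 = m^n≢0 (2 * k * C) k {{m*n≢0 (2 * k) C {{m*n≢0 2 k {{_}} {{>-nonZero (≤-trans (s≤s z≤n) (≤-trans (m≤n+m 2 d) d+2≤k))}}}} {{>-nonZero (≤-trans (s≤s z≤n) 8≤C)}}}}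
      Z^t : Z ^ t ≤ n ^ (d * t + γ)
      Z^t = begin
          (n ^ d * y ^ 4) ^ t
        ≡⟨ trans (*-^ (n ^ d) (y ^ 4) t) (cong₂ _*_ (^-*-assoc n d t) (^-*-assoc y 4 t)) ⟩
          n ^ (d * t) * y ^ (4 * t)
        ≤⟨ *-monoʳ-≤ (n ^ (d * t)) (^-monoʳ-≤ y (≤-trans (*-monoʳ-≤ 4 t≤) (≤-reflexive (lem T γ)))) ⟩
          n ^ (d * t) * y ^ (16 * T * γ)
        ≡⟨ cong (n ^ (d * t) *_) (sym (^-*-assoc y (16 * T) γ)) ⟩
          n ^ (d * t) * (y ^ (16 * T)) ^ γ
        ≤⟨ *-monoʳ-≤ (n ^ (d * t)) (^-monoˡ-≤ γ y≤n) ⟩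
          n ^ (d * t) * n ^ γ
        ≡⟨ sym (^-distribˡ-+-* n (d * t) γ) ⟩
          n ^ (d * t + γ) ∎
        where
        lem : ∀ T γ → 4 * (4 * T * γ) ≡ 16 * T * γ
        lem = solve-∀
      all-edges : X * x ^ t ≤ Q * a ^ t
      all-edges = *-cancelʳ-≤ _ _ (G ^ t) {{m^n≢0 G t {{G≢0}}}} (begin
          X * x ^ t * G ^ t
        ≡⟨ trans (*-assoc X _ _) (cong (X *_) (trans (*-comm (x ^ t) (G ^ t)) (sym (*-^ G x t)))) ⟩
          X * (G * x) ^ t
        ≤⟨ *-monoʳ-≤ X (^-monoˡ-≤ t x≤) ⟩
          X * (a * Z) ^ t
        ≡⟨ trans (cong (X *_) (*-^ a Z t)) (l₁ X (a ^ t) (Z ^ t)) ⟩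
          a ^ t * (X * Z ^ t)
        ≤⟨ *-monoʳ-≤ (a ^ t) (*-monoʳ-≤ X Z^t) ⟩
          a ^ t * (X * n ^ (d * t + γ))
        ≤⟨ *-monoʳ-≤ (a ^ t) bound ⟩
          a ^ t * (G ^ t * Q)
        ≡⟨ l₂ (a ^ t) (G ^ t) Q ⟩
          Q * a ^ t * G ^ t ∎)
        where
        l₁ : ∀ x a z → x * (a * z) ≡ a * (x * z)
        l₁ = solve-∀
        l₂ : ∀ a k q → a * (k * q) ≡ q * a * k
        l₂ = solve-∀

  -- Edge bT starts at position d b T = b (k + s), where block b is placed, and its k positions stay
  -- below n, so that no reduction modulo n takes place.
  removed-edge : ∀ {ξ} → ξ ∈ Ψ → ∀ {i} → T ∣ i → i < T * B → ∃ λ y → y ∈ Hl × edge n d k (position ξ) i ≡ ⋃ (map ⁅_⁆ y)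
  removed-edge {ξ} ξ∈ (divides b refl) i<TB with proj₂ (proj₂ (proj₂ (Ψ-properties ξ∈))) {z} (*-cancelʳ-< T b B (subst (b * T <_) (*-comm T B) i<TB))
  ... | y , y∈ , h = y , y∈ , cong ⋃ (begin
      map (λ j → ⁅ position ξ ((d * (b * T) + j) % n) ⁆) (upTo k)
    ≡⟨ List.map-cong-local (All.tabulate {xs = upTo k} (λ {j} m → cong ⁅_⁆ (at j (∈-upTo⁻ m)))) ⟩
      map (λ j → ⁅ nth z y j ⁆) (upTo k)
    ≡⟨ List.map-∘ (upTo k) ⟩
      map ⁅_⁆ (map (nth z y) (upTo k))
    ≡⟨ cong (map ⁅_⁆) (trans (cong (λ l → map (nth z y) (upTo l)) (sym (Hl-length y∈))) (trans (List.map-upTo (nth z y) (length y)) (applyUpTo-nth y))) ⟩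
      map ⁅_⁆ y ∎)
    where
    open ≡-Reasoning
    applyUpTo-nth : ∀ y → List.applyUpTo (nth z y) (length y) ≡ y
    applyUpTo-nth [] = refl
    applyUpTo-nth (x ∷ y) = cong (x ∷_) (applyUpTo-nth y)
    b<B : b < B
    b<B = *-cancelʳ-< T b B (subst (b * T <_) (*-comm T B) i<TB)
    at : ∀ j → j < k → position ξ ((d * (b * T) + j) % n) ≡ nth z y j
    at j j<k = trans (cong (λ x → nth z ξ (shuffle k s B x)) (trans (m<n⇒m%n≡m lt) eq)) (trans (cong (nth z ξ) (shuffle-block k s B b<B j<k)) (h j<k))
      where
      eq : d * (b * T) + j ≡ b * (k + s) + j
      eq = cong (_+ j) (trans (lem d b T) (cong (b *_) (sym dT)))
        where
        lem : ∀ d b T → d * (b * T) ≡ b * (d * T)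
        lem = solve-∀
      lt : d * (b * T) + j < n
      lt = subst (_< n) (sym eq) (≤-trans (+-monoʳ-< (b * (k + s)) (≤-trans j<k (m≤m+n k s)))
        (≤-trans (≤-reflexive (+-comm (b * (k + s)) (k + s))) (≤-trans (*-monoˡ-≤ (k + s) b<B) BY≤n)))

  edge-size : ∀ {ξ} → ξ ∈ Ψ → ∀ i → ∣ edge n d k (position ξ) i ∣ ≡ k
  edge-size {ξ} ξ∈ i = trans (cong (∣_∣ ∘ ⋃) (List.map-∘ (upTo k))) (trans (∣⋃∣ (Unique-map (λ j → position ξ ((d * i + j) % n)) inj (Unique.upTo⁺ k)))
    (trans (List.length-map _ (upTo k)) (List.length-upTo k)))
    where
    inj : ∀ {x y} → x ∈ upTo k → y ∈ upTo k → position ξ ((d * i + x) % n) ≡ position ξ ((d * i + y) % n) → x ≡ y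
    inj {x} {y} x∈ y∈ e = +-cancelˡ-≡ (d * i) _ _ (mod-injective n {d * i} (m≤m+n _ x) (+-monoʳ-< (d * i) (≤-trans (∈-upTo⁻ x∈) k≤n))
      (m≤m+n _ y) (+-monoʳ-< (d * i) (≤-trans (∈-upTo⁻ y∈) k≤n)) (position-injective ξ∈ (m%n<n _ n) (m%n<n _ n) e))

  module Success (es : List (Subset n)) (es-unique : Unique es) (∈-es : ∀ e → ∣ e ∣ ≡ k → e ∈ es) where

    -- The event behind the probability bound. It asks for a cycle from `Ψ` rather than for any
    -- Hamilton cycle, so that it can fail only if the random set avoids the whole family.
    contains? : (L : List (Subset n)) → Dec (Any (λ ξ → All (_∈ L) (kept-edges es es-unique ξ)) Ψ)
    contains? L = Any.any? (λ ξ → All.all? (_∈ᴸ? L) (kept-edges es es-unique ξ)) Ψ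

    good : List (Subset n) → Bool
    good L = does (contains? L)

    family : List (Subset (length es))
    family = map (edge-mask es es-unique) Ψ

    good-edges : ∀ L → good L ≡ true → ∃ λ ξ → ξ ∈ Ψ × (∀ i → d * i < n →
      ∣ edge n d k (position ξ) i ∣ ≡ k × (edge n d k (position ξ) i ∈ L ⊎ ∃ λ y → y ∈ Hl × edge n d k (position ξ) i ≡ ⋃ (map ⁅_⁆ y)))
    good-edges L e with contains? L
    good-edges L () | no _
    good-edges L e | yes some with find some
    ... | ξ , ξ∈ , all = ξ , ξ∈ , λ i di<n → edge-size ξ∈ i , is-edge i di<n (removed? T B i)
      where
      is-edge : ∀ i → d * i < n → Dec (T ∣ i × i < T * B) → edge n d k (position ξ) i ∈ L ⊎ ∃ λ y → y ∈ Hl × edge n d k (position ξ) i ≡ ⋃ (map ⁅_⁆ y)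
      is-edge i di<n (yes (T∣i , i<)) = inj₂ (removed-edge ξ∈ T∣i i<)
      is-edge i di<n (no kept-i) = inj₁ (All.lookup all (∈-map⁺ (edge n d k (position ξ))
        (∈-filter⁺ (λ i → ¬? (removed? T B i)) (∈-upTo⁺ (*-cancelˡ-< d i N (subst (d * i <_) n≡ di<n))) kept-i)))

    good-or-avoids : ∀ W → 1 ≤ indicator (good (select es W)) + avoids family W
    good-or-avoids W with avoids-cases family W
    ... | inj₂ (e , _) = ≤-trans (≤-reflexive (sym e)) (m≤n+m (avoids family W) _)
    ... | inj₁ (_ , S , S∈ , S⊆W) with ∈-map⁻ (edge-mask es es-unique) S∈
    ... | ξ , ξ∈ , refl = ≤-trans (at-good (contains? (select es W))) (m≤m+n _ _)
      where
      in-es : ∀ {e} → e ∈ kept-edges es es-unique ξ → e ∈ es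
      in-es m with ∈-map⁻ (edge n d k (position ξ)) m
      ... | i , _ , refl = ∈-es _ (edge-size ξ∈ i)
      at-good : (D : Dec (Any (λ ξ → All (_∈ select es W) (kept-edges es es-unique ξ)) Ψ)) → 1 ≤ indicator (does D)
      at-good (yes _) = ≤-refl
      at-good (no none) = ⊥-elim (none (lose {P = λ ξ → All (_∈ select es W) (kept-edges es es-unique ξ)} ξ∈
        (All.tabulate (λ m → mask-select es (kept-edges es es-unique ξ) W S⊆W (in-es m) m))))

    family-size : ∀ {w} → n < w → ∀ S → S ∈ family → ∣ S ∣ < w
    family-size n<w S m with ∈-map⁻ (edge-mask es es-unique) m
    ... | ξ , _ , refl = ≤-trans (s≤s (≤-trans (edge-mask-size es es-unique ξ) (≤-trans (m≤n*m N d {{>-nonZero d≥1}}) (≤-reflexive (sym n≡))))) n<w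

    family-length : length family ≡ Q
    family-length = trans (List.length-map _ Ψ) length-Ψ

-- Edges of H as lists, and candidates that avoid used vertices

elements : ∀ {n} → Subset n → List (Fin n)
elements [] = []
elements (true ∷ s) = Fin.zero ∷ map Fin.suc (elements s)
elements (false ∷ s) = map Fin.suc (elements s)

length-elements : ∀ {n} (s : Subset n) → length (elements s) ≡ ∣ s ∣
length-elements [] = refl
length-elements (true ∷ s) = cong suc (trans (List.length-map Fin.suc (elements s)) (length-elements s))
length-elements (false ∷ s) = trans (List.length-map Fin.suc (elements s)) (length-elements s)

Unique-elements : ∀ {n} (s : Subset n) → Unique (elements s)
Unique-elements [] = []
Unique-elements (true ∷ s) = All.tabulate (λ m e → zero∉ (∈-map⁻ Fin.suc m) e) ∷ Unique.map⁺ Fin.suc-injective (Unique-elements s)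
  where
  zero∉ : ∀ {v} → (∃ λ x → x ∈ elements s × v ≡ Fin.suc x) → Fin.zero ≢ v
  zero∉ (x , _ , refl) ()
Unique-elements (false ∷ s) = Unique.map⁺ Fin.suc-injective (Unique-elements s)

∈-elements⁺ : ∀ {n} {s : Subset n} {x} → x ∈ₛ s → x ∈ elements s
∈-elements⁺ {s = true ∷ s} here = here refl
∈-elements⁺ {s = true ∷ s} (there m) = there (∈-map⁺ Fin.suc (∈-elements⁺ m))
∈-elements⁺ {s = false ∷ s} (there m) = ∈-map⁺ Fin.suc (∈-elements⁺ m)

∈-elements⁻ : ∀ {n} (s : Subset n) {x} → x ∈ elements s → x ∈ₛ s
∈-elements⁻ (true ∷ s) (here refl) = here
∈-elements⁻ (true ∷ s) (there m) with ∈-map⁻ Fin.suc m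
... | x , m′ , refl = there (∈-elements⁻ s m′)
∈-elements⁻ (false ∷ s) m with ∈-map⁻ Fin.suc m
... | x , m′ , refl = there (∈-elements⁻ s m′)

⋃-elements : ∀ {n} (s : Subset n) → ⋃ (map ⁅_⁆ (elements s)) ≡ s
⋃-elements s = ⊆-antisym
  (λ m → let (y , y∈ , e) = ∈-⋃⁻ id (elements s) m in subst (_∈ₛ s) (sym e) (∈-elements⁻ s y∈))
  (λ m → ∈-⋃⁺ id (elements s) (∈-elements⁺ m))

∈-allSubsets : ∀ {n} (s : Subset n) → s ∈ allSubsets n
∈-allSubsets [] = here refl
∈-allSubsets (true ∷ s) = ∈-++⁺ˡ (∈-map⁺ (true ∷_) (∈-allSubsets s))
∈-allSubsets {suc n} (false ∷ s) = ∈-++⁺ʳ (map (true ∷_) (allSubsets n)) (∈-map⁺ (false ∷_) (∈-allSubsets s))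

Unique-allSubsets : ∀ n → Unique (allSubsets n)
Unique-allSubsets zero = [] ∷ []
Unique-allSubsets (suc n) = Unique.++⁺ (Unique.map⁺ (λ { refl → refl }) (Unique-allSubsets n)) (Unique.map⁺ (λ { refl → refl }) (Unique-allSubsets n))
  (λ (a , b) → clash (∈-map⁻ (true ∷_) a) (∈-map⁻ (false ∷_) b))
  where
  clash : ∀ {v : Subset (suc n)} → (∃ λ s → s ∈ allSubsets n × v ≡ true ∷ s) → (∃ λ s → s ∈ allSubsets n × v ≡ false ∷ s) → Data.Empty.⊥
  clash (_ , _ , refl) (_ , _ , ())

∈-kSets⁺ : ∀ {n k} (s : Subset n) → ∣ s ∣ ≡ k → s ∈ kSets n k
∈-kSets⁺ s refl = ∈-filter⁺ _ (∈-allSubsets s) (≡⇒≡ᵇ ∣ s ∣ ∣ s ∣ refl)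

∈-kSets⁻ : ∀ {n k} {s : Subset n} → s ∈ kSets n k → ∣ s ∣ ≡ k
∈-kSets⁻ {n} {k} {s} m = ≡ᵇ⇒≡ ∣ s ∣ k (proj₂ (∈-filter⁻ _ {xs = allSubsets n} m))

Unique-kSets : ∀ n k → Unique (kSets n k)
Unique-kSets n k = Unique.filter⁺ _ (Unique-allSubsets n)

edge-lists : ∀ n k → KGraph n → List (List (Fin n))
edge-lists n k H = map elements (filterᵇ H (kSets n k))

length-edge-lists : ∀ n k H → length (edge-lists n k H) ≡ numEdges n k H
length-edge-lists n k H = List.length-map elements (filterᵇ H (kSets n k))

edge-lists-∈ : ∀ {n k} H {y} → y ∈ edge-lists n k H → length y ≡ k × Unique y × H (⋃ (map ⁅_⁆ y)) ≡ true
edge-lists-∈ {n} {k} H m with ∈-map⁻ elements m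
... | s , s∈ , refl with ∈-filter⁻ _ {xs = kSets n k} s∈
... | s∈k , Hs = trans (length-elements s) (∈-kSets⁻ {n} {k} s∈k) , Unique-elements s , trans (cong H (⋃-elements s)) (T⇒true Hs)
  where
  T⇒true : ∀ {b} → Data.Bool.T b → b ≡ true
  T⇒true {true} _ = refl

Unique-edge-lists : ∀ n k H → Unique (edge-lists n k H)
Unique-edge-lists n k H = Unique.map⁺ (λ {s} {t} e → trans (sym (⋃-elements s)) (trans (cong (λ y → ⋃ (map ⁅_⁆ y)) e) (⋃-elements t)))
  (Unique.filter⁺ _ (Unique-kSets n k))

containing : {A : Set} → ℕ → A → List (List (Maybe A))
containing zero u = []
containing (suc k) u = (just u ∷ replicate k nothing) ∷ map (nothing ∷_) (containing k u)

length-containing : {A : Set} (k : ℕ) (u : A) → length (containing k u) ≡ k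
length-containing zero u = refl
length-containing (suc k) u = cong suc (trans (List.length-map _ (containing k u)) (length-containing k u))

containing-∈ : {A : Set} (k : ℕ) (u : A) {p : List (Maybe A)} → p ∈ containing k u → length p ≡ k × ∣ p ∣⁺ ≡ 1
containing-∈ (suc k) u (here refl) = cong suc (List.length-replicate k) , cong (suc ∘ length) (catMaybes-replicate k)
containing-∈ (suc k) u (there m) with ∈-map⁻ (nothing ∷_) m
... | p , p∈ , refl with containing-∈ k u p∈
... | a , b = cong suc a , b

containing-match : {A : Set} (k : ℕ) {u : A} {y : List A} → length y ≡ k → u ∈ y → ∃ λ p → p ∈ containing k u × Match p y
containing-match (suc k) {u} {v ∷ y} e (here refl) = _ , here refl , fixed (Match-replicate k y (suc-injective e))
containing-match (suc k) {u} {v ∷ y} e (there m) with containing-match k (suc-injective e) m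
... | p , p∈ , mt = nothing ∷ p , there (∈-map⁺ (nothing ∷_) p∈) , free mt

module _ {n : ℕ} .{{_ : NonZero n}} (k : ℕ) (Hl : List (List (Fin n))) (Hl-length : ∀ {y} → y ∈ Hl → length y ≡ suc k) (Hl-unique : Unique Hl) where

  -- A union bound over a used vertex and the slot in which it occurs: k + 1 slots, and n^k ways to
  -- fill the others.
  ∑-hitting : ∀ used → ∑ Hl (λ y → 𝟙 (¬? (avoiding? used y))) ≤ length used * (suc k * n ^ k)
  ∑-hitting used = begin
      ∑ Hl (λ y → 𝟙 (¬? (avoiding? used y)))
    ≤⟨ ∑-mono Hl hit ⟩
      ∑ Hl (λ y → ∑ used (λ u → ∑ (containing (suc k) u) (λ p → 𝟙 (match? p y))))
    ≡⟨ trans (∑-swap Hl used _) (∑-cong used (λ u _ → ∑-swap Hl (containing (suc k) u) _)) ⟩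
      ∑ used (λ u → ∑ (containing (suc k) u) (λ p → ∑ Hl (λ y → 𝟙 (match? p y))))
    ≤⟨ ∑-mono used (λ u _ → ∑-mono (containing (suc k) u) (one u)) ⟩
      ∑ used (λ u → ∑ (containing (suc k) u) (λ p → n ^ k))
    ≡⟨ ∑-cong used (λ u _ → trans (∑-const (containing (suc k) u) _) (cong (_* n ^ k) (length-containing (suc k) u))) ⟩
      ∑ used (λ u → suc k * n ^ k)
    ≡⟨ ∑-const used _ ⟩
      length used * (suc k * n ^ k) ∎
    where
    open ≤-Reasoning
    one : ∀ u p → p ∈ containing (suc k) u → ∑ Hl (λ y → 𝟙 (match? p y)) ≤ n ^ k
    one u p m with containing-∈ (suc k) u m
    ... | len , just₁ = *-cancelˡ-≤ n (≤-trans (≤-reflexive (trans (*-comm n _) (cong (∑ Hl (λ y → 𝟙 (match? p y)) *_) (trans (sym (*-identityʳ n)) (cong (n ^_) (sym just₁))))))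
      (≤-trans (∑-match p Hl Hl-unique) (≤-reflexive (cong (n ^_) len))))
    hit : ∀ y → y ∈ Hl → 𝟙 (¬? (avoiding? used y)) ≤ ∑ used (λ u → ∑ (containing (suc k) u) (λ p → 𝟙 (match? p y)))
    hit y y∈ with avoiding? used y
    ... | yes _ = z≤n
    ... | no ¬all with find (All.¬All⇒Any¬ (λ v → ¬? (v ∈? used)) y ¬all)
      where open import Data.List.Membership.DecPropositional (Fin._≟_ {n}) using (_∈?_)
    ... | u , u∈y , ¬¬u with containing-match (suc k) (Hl-length y∈) u∈y
    ... | p , p∈ , mt = ≤-trans (≤-trans (≤-reflexive (sym (𝟙-true mt (match? p y)))) (∑-∈ (containing (suc k) u) (λ p → 𝟙 (match? p y)) p∈))
      (∑-∈ used (λ u → ∑ (containing (suc k) u) (λ p → 𝟙 (match? p y))) (decidable-stable (u ∈? used) ¬¬u))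
      where open import Data.List.Membership.DecPropositional (Fin._≟_ {n}) using (_∈?_)

  avoiding-many : ∀ used {h} → length used ≤ h → length Hl ∸ h * (suc k * n ^ k) ≤ length (filter (avoiding? used) Hl)
  avoiding-many used {h} le = m≤n+o⇒m∸n≤o (length Hl) (h * (suc k * n ^ k)) (begin
      length Hl
    ≡⟨ trans (length-∑ Hl) (trans (∑-cong Hl (λ y _ → sym (𝟙-¬? (avoiding? used y)))) (∑-+ Hl _ _)) ⟩
      ∑ Hl (λ y → 𝟙 (¬? (avoiding? used y))) + ∑ Hl (λ y → 𝟙 (avoiding? used y))
    ≤⟨ +-mono-≤ (≤-trans (∑-hitting used) (*-monoˡ-≤ (suc k * n ^ k) le)) (≤-reflexive (sym (length-filter-∑ (avoiding? used) Hl))) ⟩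
      h * (suc k * n ^ k) + length (filter (avoiding? used) Hl) ∎)
    where
    open ≤-Reasoning

avoiding-enough : ∀ {n} .{{_ : NonZero n}} k (Hl : List (List (Fin n))) → 1 ≤ k → (∀ {y} → y ∈ Hl → length y ≡ k) → Unique Hl →
  ∀ used {h} → length used ≤ h → length Hl ∸ h * (k * n ^ (k ∸ 1)) ≤ length (filter (avoiding? used) Hl)
avoiding-enough (suc k) Hl _ len u used le = avoiding-many k Hl len u used le

-- Pigeonhole: if a value were missed, punching it out would give an injection into a smaller finite
-- set.
injective⇒↔ : ∀ {n} (f : Fin n → Fin n) → (∀ {x y} → f x ≡ f y → x ≡ y) → Σ (Fin n ↔ Fin n) λ σ → ∀ x → Inverse.to σ x ≡ f x
injective⇒↔ {n} f inj = mk↔ₛ′ f (proj₁ ∘ surjective) (proj₂ ∘ surjective) (λ x → inj (proj₂ (surjective (f x)))) , λ _ → refl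
  where
  missing : ∀ {n} (f : Fin n → Fin n) → (∀ {x y} → f x ≡ f y → x ≡ y) → ∀ y → ¬ (∃ λ x → f x ≡ y) → Data.Empty.⊥
  missing {suc n} f inj y none = 1+n≰n (Fin.injective⇒≤ {f = λ x → Fin.punchOut {i = y} {j = f x} (λ e → none (x , sym e))}
    (λ {x} {x′} e → inj (Fin.punchOut-injective {i = y} (λ e → none (x , sym e)) (λ e → none (x′ , sym e)) e)))
  surjective : ∀ y → ∃ λ x → f x ≡ y
  surjective y with Fin.any? (λ x → f x Fin.≟ y)
  ... | yes p = p
  ... | no none = ⊥-elim (missing f inj y none)

Hamiltonian : ∀ n .{{_ : NonZero n}} k ℓ (E : Subset n → Set) (ψ : ℕ → Fin n) → InjectiveBelow n ψ → (k ∸ ℓ) ∣ n →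
  (∀ i → (k ∸ ℓ) * i < n → E (edge n (k ∸ ℓ) k ψ i)) → HasHamCycle k ℓ n E
Hamiltonian (suc m) k ℓ E ψ inj d∣n edges = d∣n , proj₁ bij , λ i i< → subst E (sym (cyc i)) (edges i i<)
  where
  bij = injective⇒↔ (λ x → ψ (toℕ x)) (λ {x} {y} e → Fin.toℕ-injective (inj (Fin.toℕ<n x) (Fin.toℕ<n y) e))
  cyc : ∀ i → cycEdge k ℓ m (proj₁ bij) i ≡ edge (suc m) (k ∸ ℓ) k ψ i
  cyc i = cong ⋃ (List.map-cong (λ j → cong ⁅_⁆ (trans (proj₂ bij _) (cong ψ (Fin.toℕ-fromℕ< (m%n<n ((k ∸ ℓ) * i + j) (suc m)))))) (upTo k))

-- Choice of the parameters and the bound for one n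

module Finite (n : ℕ) .{{n≢0 : NonZero n}} (k ℓ E y num den : ℕ) (H : KGraph n)
  (2≤ℓ : 2 ≤ ℓ) (ℓ<k : ℓ < k) (E≥1 : 1 ≤ E) (d∣n : (k ∸ ℓ) ∣ n) where

  d T C G rounds b : ℕ
  d = k ∸ ℓ
  -- H has at least n^k / E edges. With this T the blocks occupy at most n / (2Ek) vertices, which
  -- meet at most n^k / (2E) edges, so at least n^k / (2E) candidates are always left.
  T = 2 * E * (k * k)
  -- At least 2E, for the choice of the blocks, and at least 8, for the permutation of the other
  -- vertices.
  C = 16 * E
  G = (2 * k * C) ^ k
  rounds = 16 * T
  b = rounds * den

  -- By `y≤n` and `n<y`, y is the integer part of n^(1 / rounds). The edge probability is p = num /
  -- den, and `p-large` says that p ≥ 1 / (n^d (y + 1)).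
  module Main (dense : n ^ k ≤ E * numEdges n k H) (4≤y : 4 ≤ y) (y-large : 4 * (G * rounds) ≤ y)
    (y≤n : y ^ rounds ≤ n) (n<y : n < suc y ^ rounds) (num≤den : num ≤ den) (num≥1 : 1 ≤ num)
    (p-large : den ≤ num * n ^ d * suc y) (k≤n : k ≤ n) (2dT≤n : d * (2 * T) ≤ n) where

    d≥1 : 1 ≤ d
    d≥1 = m<n⇒0<n∸m ℓ<k

    1≤k : 1 ≤ k
    1≤k = ≤-trans (s≤s z≤n) ℓ<k

    d+2≤k : d + 2 ≤ k
    d+2≤k = ≤-trans (+-monoʳ-≤ d 2≤ℓ) (≤-reflexive (m∸n+n≡m (<⇒≤ ℓ<k)))

    N : ℕ
    N = Data.Nat.Divisibility.quotient d∣n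

    n≡ : n ≡ d * N
    n≡ = trans (Data.Nat.Divisibility._∣_.equality d∣n) (*-comm N d)

    k≤T : k ≤ T
    k≤T = ≤-trans (m≤m*n k k {{>-nonZero 1≤k}}) (m≤n*m (k * k) (2 * E) {{>-nonZero (≤-trans E≥1 (m≤m+n E _))}})

    instance
      T≢0 : NonZero T
      T≢0 = >-nonZero (≤-trans 1≤k k≤T)

    B : ℕ
    B = N / T

    TB≤N : T * B ≤ N
    TB≤N = ≤-trans (≤-reflexive (*-comm T B)) (m/n*n≤m N T)

    N< : N < T * suc B
    N< = subst₂ _<_ (sym (m≡m%n+[m/n]*n N T)) (trans (cong (T +_) (*-comm B T)) (sym (*-suc T B))) (+-monoˡ-< (B * T) (m%n<n N T))

    2≤B : 2 ≤ B
    2≤B = ≤-trans (≤-reflexive (sym (m*n/n≡m 2 T))) (/-monoˡ-≤ T (*-cancelˡ-≤ d {{>-nonZero d≥1}} (≤-trans 2dT≤n (≤-reflexive n≡))))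

    TB≤n : T * B ≤ n
    TB≤n = ≤-trans TB≤N (≤-trans (m≤n*m N d {{>-nonZero d≥1}}) (≤-reflexive (sym n≡)))

    s R h : ℕ
    s = d * T ∸ k
    R = n ∸ B * k
    h = B * k

    dT : k + s ≡ d * T
    dT = m+[n∸m]≡n (≤-trans k≤T (m≤n*m T d {{>-nonZero d≥1}}))

    2Bk≤n : 2 * (B * k) ≤ n
    2Bk≤n = ≤-trans (≤-trans (≤-reflexive (l₁ B k)) (≤-trans (*-monoʳ-≤ (2 * k * B) {1} {E * k} (*-mono-≤ E≥1 1≤k)) (≤-reflexive (l₂ B k E)))) TB≤n
      where
      l₁ : ∀ B k → 2 * (B * k) ≡ 2 * k * B * 1
      l₁ = solve-∀
      l₂ : ∀ B k E → 2 * k * B * (E * k) ≡ 2 * E * (k * k) * B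
      l₂ = solve-∀

    BkR : B * k + R ≡ n
    BkR = m+[n∸m]≡n (≤-trans (m≤m+n (B * k) _) 2Bk≤n)

    n≤2R : n ≤ 2 * R
    n≤2R = +-cancelˡ-≤ (2 * (B * k)) n (2 * R) (begin
        2 * (B * k) + n
      ≤⟨ +-monoˡ-≤ n 2Bk≤n ⟩
        n + n
      ≡⟨ cong (λ z → z + z) (sym BkR) ⟩
        B * k + R + (B * k + R)
      ≡⟨ l (B * k) R ⟩
        2 * (B * k) + 2 * R ∎)
      where
      open ≤-Reasoning
      l : ∀ x r → x + r + (x + r) ≡ 2 * x + 2 * r
      l = solve-∀

    vertex : Fin n
    vertex = fromℕ< (>-nonZero⁻¹ n)

    Hl : List (List (Fin n))
    Hl = edge-lists n k H

    Hl-length : ∀ {y} → y ∈ Hl → length y ≡ k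
    Hl-length m = proj₁ (edge-lists-∈ H m)

    Hl-distinct : ∀ {y} → y ∈ Hl → Unique y
    Hl-distinct m = proj₁ (proj₂ (edge-lists-∈ H m))

    D : ℕ
    D = length Hl ∸ h * (k * n ^ (k ∸ 1))

    available : ∀ used → length used + R ≤ n → D ≤ length (filter (avoiding? used) Hl)
    available used le = avoiding-enough k Hl 1≤k Hl-length (Unique-edge-lists n k H) used
      (+-cancelʳ-≤ R _ _ (≤-trans le (≤-reflexive (sym BkR))))

    CD : n ^ k ≤ C * D
    CD = ≤-trans (+-cancelˡ-≤ (n ^ k) _ _ (begin
        n ^ k + n ^ k
      ≤⟨ +-mono-≤ dense dense ⟩
        E * numEdges n k H + E * numEdges n k H
      ≡⟨ cong (λ z → E * z + E * z) (sym (length-edge-lists n k H)) ⟩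
        E * length Hl + E * length Hl
      ≤⟨ +-mono-≤ (*-monoʳ-≤ E le) (*-monoʳ-≤ E le) ⟩
        E * (h * (k * n ^ (k ∸ 1)) + D) + E * (h * (k * n ^ (k ∸ 1)) + D)
      ≡⟨ l₁ E B k (n ^ (k ∸ 1)) D ⟩
        2 * E * (k * k) * B * n ^ (k ∸ 1) + 2 * E * D
      ≤⟨ +-monoˡ-≤ (2 * E * D) (*-monoˡ-≤ (n ^ (k ∸ 1)) TB≤n) ⟩
        n * n ^ (k ∸ 1) + 2 * E * D
      ≡⟨ cong (λ z → n ^ z + 2 * E * D) (m+[n∸m]≡n 1≤k) ⟩
        n ^ k + 2 * E * D ∎)) (*-monoˡ-≤ D (*-monoˡ-≤ E (s≤s (s≤s (z≤n {14})))))
      where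
      open ≤-Reasoning
      le : length Hl ≤ h * (k * n ^ (k ∸ 1)) + D
      le = m≤n+m∸n (length Hl) (h * (k * n ^ (k ∸ 1)))
      l₁ : ∀ E B k x D → E * (B * k * (k * x) + D) + E * (B * k * (k * x) + D) ≡ 2 * E * (k * k) * B * x + 2 * E * D
      l₁ = solve-∀

    8≤C : 8 ≤ C
    8≤C = ≤-trans (*-monoʳ-≤ 8 E≥1) (*-monoˡ-≤ E {8} {16} (s≤s (s≤s (s≤s (s≤s (s≤s (s≤s (s≤s (s≤s z≤n)))))))))

    2≤T : 2 ≤ T
    2≤T = ≤-trans (≤-trans 2≤ℓ (<⇒≤ ℓ<k)) k≤T

    open Family n d k s N T B R D C vertex Hl Hl-length Hl-distinct (Unique-edge-lists n k H) available
      d≥1 d+2≤k k≤n n≡ BkR dT 2≤T 2≤B TB≤N N< 8≤C CD n≤2R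

    open Success (kSets n k) (Unique-kSets n k) ∈-kSets⁺ public

    good-Hamiltonian : ∀ L → good L ≡ true → HasHamCycle k ℓ n (UnionEdge n k H L)
    good-Hamiltonian L e =
      let (ξ , ξ∈ , edges) = good-edges L e in
      Hamiltonian n k ℓ (UnionEdge n k H L) (position ξ) (position-injective ξ∈) d∣n (λ i i< → union (edges i i<))
      where
      union : ∀ {e} → ∣ e ∣ ≡ k × (e ∈ L ⊎ ∃ λ y → y ∈ Hl × e ≡ ⋃ (map ⁅_⁆ y)) → UnionEdge n k H L e
      union (size , inj₁ e∈) = size , inj₂ e∈
      union (size , inj₂ (y , y∈ , refl)) = size , inj₁ (proj₂ (proj₂ (edge-lists-∈ {n} {k} H y∈)))

    y≢0 : NonZero y
    y≢0 = >-nonZero (≤-trans (s≤s z≤n) 4≤y)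

    rounds≥1 : 1 ≤ rounds
    rounds≥1 = ≤-trans (≤-trans (s≤s z≤n) 2≤T) (m≤n*m T 16)

    den≥1 : 1 ≤ den
    den≥1 = ≤-trans num≥1 num≤den

    -- Of the surplus y^4 per edge one factor pays for p lying below n^(-d), one for the shrinking
    -- factor w = y + 1 of the rounds, one for their failure ratio l = y, and one for the constants.
    -- This is why η is a quarter of 1/(4T).
    family-is-spread : Spread (y * suc y * b) num Q family
    family-is-spread = family-spread (kSets n k) (Unique-kSets n k) y num (y * suc y * b) {{y≢0}} {{x≢0}} y≤n G≤ num≤
      where
      open ≤-Reasoning
      b≢0 : NonZero b
      b≢0 = >-nonZero (*-mono-≤ rounds≥1 den≥1)
      x≢0 : NonZero (y * suc y * b)
      x≢0 = m*n≢0 (y * suc y) b {{m*n≢0 y (suc y) {{y≢0}}}} {{b≢0}}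
      num≤ : num ≤ y * suc y * b
      num≤ = ≤-trans num≤den (≤-trans (m≤n*m den rounds {{>-nonZero rounds≥1}}) (m≤n*m b (y * suc y) {{m*n≢0 y (suc y) {{y≢0}}}}))
      1+y≤2y : suc y ≤ 2 * y
      1+y≤2y = ≤-trans (+-monoˡ-≤ y (≤-trans (s≤s z≤n) 4≤y)) (≤-reflexive (cong (y +_) (sym (+-identityʳ y))))
      G≤ : G * (y * suc y * (rounds * den)) ≤ num * (n ^ d * y ^ 4)
      G≤ = begin
          G * (y * suc y * (rounds * den))
        ≤⟨ *-monoʳ-≤ G (*-monoʳ-≤ (y * suc y) (*-monoʳ-≤ rounds p-large)) ⟩
          G * (y * suc y * (rounds * (num * n ^ d * suc y)))
        ≡⟨ l₁ G y (suc y) rounds (num * n ^ d) ⟩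
          num * n ^ d * (G * rounds * y * (suc y * suc y))
        ≤⟨ *-monoʳ-≤ (num * n ^ d) (*-monoʳ-≤ (G * rounds * y) (*-mono-≤ 1+y≤2y 1+y≤2y)) ⟩
          num * n ^ d * (G * rounds * y * (2 * y * (2 * y)))
        ≡⟨ l₂ (num * n ^ d) (G * rounds) y ⟩
          num * n ^ d * (4 * (G * rounds) * (y * y * y))
        ≤⟨ *-monoʳ-≤ (num * n ^ d) (*-monoˡ-≤ (y * y * y) y-large) ⟩
          num * n ^ d * (y * (y * y * y))
        ≡⟨ l₃ num (n ^ d) y ⟩
          num * (n ^ d * y ^ 4) ∎
        where
        l₁ : ∀ g y w r x → g * (y * w * (r * (x * w))) ≡ x * (g * r * y * (w * w))
        l₁ = solve-∀
        l₂ : ∀ x g y → x * (g * y * (2 * y * (2 * y))) ≡ x * (4 * g * (y * y * y))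
        l₂ = solve-∀
        l₃ : ∀ a x y → a * x * (y * (y * y * y)) ≡ a * (x * (y * (y * (y * (y * 1)))))
        l₃ = solve-∀

    -- Expanding p to (rounds * num) / (rounds * den) gives each round the density num / b = p /
    -- rounds over the same denominator, and together they have density p.
    a c : ℕ
    a = rounds * num
    c = rounds * (den ∸ num)

    a+c≡b : a + c ≡ b
    a+c≡b = trans (sym (*-distribˡ-+ rounds num (den ∸ num))) (cong (rounds *_) (m+[n∸m]≡n num≤den))

    Q≢0 : NonZero Q
    Q≢0 = m*n≢0 (D ^ B) (R !) {{m^n≢0 D B {{D≢0}}}} {{R !≢0}}
      where
      D≢0 : NonZero D
      D≢0 = ≢-nonZero (λ D≡0 → <⇒≱ (m^n>0 n k) (≤-trans CD (≤-reflexive (trans (cong (C *_) D≡0) (*-zeroʳ C)))))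

    -- The failure probability is at most 4 · rounds / y, which tends to 0 with n. The rounds
    -- suffice since members have at most n elements and n < (y + 1)^rounds.
    few-avoid : 𝔼 a c (avoids family) * y ≤ 4 * rounds * b ^ length (kSets n k)
    few-avoid = *-cancelˡ-≤ Q {{Q≢0}} (begin
        Q * (𝔼 a c (avoids family) * y)
      ≡⟨ l₁ Q (𝔼 a c (avoids family)) y ⟩
        𝔼 a c (avoids family) * (Q * y)
      ≡⟨ cong (λ z → 𝔼 a c (avoids family) * (z * y)) (sym family-length) ⟩
        𝔼 a c (avoids family) * (length family * y)
      ≤⟨ spread-avoids num b (suc y) y Q {{>-nonZero num≥1}} 4≤y rounds c a+c≡b family family-is-spread (family-size n<y) ⟩
        rounds * (4 * Q * b ^ length (kSets n k))
      ≡⟨ l₂ rounds Q (b ^ length (kSets n k)) ⟩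
        Q * (4 * rounds * b ^ length (kSets n k)) ∎)
      where
      open ≤-Reasoning
      l₁ : ∀ q e y → q * (e * y) ≡ e * (q * y)
      l₁ = solve-∀
      l₂ : ∀ r q x → r * (4 * q * x) ≡ q * (4 * r * x)
      l₂ = solve-∀

    mostly-good : b ^ length (kSets n k) * y ≤ 𝔼 a c (λ W → indicator (good (select (kSets n k) W))) * y + 4 * rounds * b ^ length (kSets n k)
    mostly-good = begin
        b ^ length (kSets n k) * y
      ≡⟨ cong (_* y) (trans (cong (_^ length (kSets n k)) (sym a+c≡b)) (sym (trans (𝔼-const (length (kSets n k)) a c 1) (*-identityʳ _)))) ⟩
        𝔼 {length (kSets n k)} a c (λ _ → 1) * y
      ≤⟨ *-monoˡ-≤ y (𝔼-mono {length (kSets n k)} a c good-or-avoids) ⟩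
        𝔼 {length (kSets n k)} a c (λ W → indicator (good (select (kSets n k) W)) + avoids family W) * y
      ≡⟨ trans (cong (_* y) (𝔼-+ {length (kSets n k)} a c _ _)) (*-distribʳ-+ y (𝔼 {length (kSets n k)} a c (λ W → indicator (good (select (kSets n k) W)))) _) ⟩
        𝔼 a c (λ W → indicator (good (select (kSets n k) W))) * y + 𝔼 a c (avoids family) * y
      ≤⟨ +-monoʳ-≤ _ few-avoid ⟩
        𝔼 a c (λ W → indicator (good (select (kSets n k) W))) * y + 4 * rounds * b ^ length (kSets n k) ∎
      where open ≤-Reasoning

-- Rational probabilities

integer-root : ∀ r n → 1 ≤ r → ∃ λ y → y ^ r ≤ n × n < suc y ^ r
integer-root (suc r) zero _ = 0 , z≤n , m^n>0 1 (suc r)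
integer-root r (suc n) 1≤r with integer-root r n 1≤r
... | y , y≤ , n< with suc n <? suc y ^ r
... | yes sn< = y , m≤n⇒m≤1+n y≤ , sn<
... | no sn≮ = suc y , ≮⇒≥ sn≮ , ≤-<-trans n< (^-monoˡ-< r {{>-nonZero 1≤r}} (n<1+n (suc y)))

toℚᵘ-ℕ→ℚ : ∀ n → ℚ.toℚᵘ (ℕ→ℚ n) ≃ᵘ mkℚᵘ (ℤ.+ n) 0
toℚᵘ-ℕ→ℚ n = ℚ.toℚᵘ-fromℚᵘ (mkℚᵘ (ℤ.+ n) 0)

ℕ→ℚ-+ : ∀ m n → ℕ→ℚ (m + n) ≡ ℕ→ℚ m +ℚ ℕ→ℚ n
ℕ→ℚ-+ m n = ℚ.toℚᵘ-injective (ℚᵘ.≃-trans (toℚᵘ-ℕ→ℚ (m + n)) (ℚᵘ.≃-trans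
  (*≡* (cong (λ z → z ℤ.* ℤ.+ 1) (sym (cong₂ ℤ._+_ (ℤ.*-identityʳ (ℤ.+ m)) (ℤ.*-identityʳ (ℤ.+ n))))))
  (ℚᵘ.≃-sym (ℚᵘ.≃-trans (ℚ.toℚᵘ-homo-+ (ℕ→ℚ m) (ℕ→ℚ n)) (ℚᵘ.+-cong (toℚᵘ-ℕ→ℚ m) (toℚᵘ-ℕ→ℚ n))))))

ℕ→ℚ-* : ∀ m n → ℕ→ℚ (m * n) ≡ ℕ→ℚ m *ℚ ℕ→ℚ n
ℕ→ℚ-* m n = ℚ.toℚᵘ-injective (ℚᵘ.≃-trans (toℚᵘ-ℕ→ℚ (m * n)) (ℚᵘ.≃-trans
  (*≡* (cong (λ z → z ℤ.* ℤ.+ 1) (ℤ.pos-* m n)))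
  (ℚᵘ.≃-sym (ℚᵘ.≃-trans (ℚ.toℚᵘ-homo-* (ℕ→ℚ m) (ℕ→ℚ n)) (ℚᵘ.*-cong (toℚᵘ-ℕ→ℚ m) (toℚᵘ-ℕ→ℚ n))))))

ℕ→ℚ-^ : ∀ m n → ℕ→ℚ (m ^ n) ≡ ℕ→ℚ m ^ℚ n
ℕ→ℚ-^ m zero = refl
ℕ→ℚ-^ m (suc n) = trans (ℕ→ℚ-* m (m ^ n)) (cong (ℕ→ℚ m *ℚ_) (ℕ→ℚ-^ m n))

ℕ→ℚ-mono-≤ : ∀ {m n} → m ≤ n → ℕ→ℚ m ≤ℚ ℕ→ℚ n
ℕ→ℚ-mono-≤ {m} {n} m≤n = ℚ.toℚᵘ-cancel-≤ (ℚᵘ.≤-respˡ-≃ (ℚᵘ.≃-sym (toℚᵘ-ℕ→ℚ m)) (ℚᵘ.≤-respʳ-≃ (ℚᵘ.≃-sym (toℚᵘ-ℕ→ℚ n))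
  (*≤* (ℤ.*-monoʳ-≤-nonNeg (ℤ.+ 1) (ℤ.+≤+ m≤n)))))

ℕ→ℚ-cancel-≤ : ∀ {m n} → ℕ→ℚ m ≤ℚ ℕ→ℚ n → m ≤ n
ℕ→ℚ-cancel-≤ {m} {n} le with ℚᵘ.≤-respˡ-≃ (toℚᵘ-ℕ→ℚ m) (ℚᵘ.≤-respʳ-≃ (toℚᵘ-ℕ→ℚ n) (ℚ.toℚᵘ-mono-≤ le))
... | *≤* le′ = ℤ.drop‿+≤+ (subst₂ ℤ._≤_ (ℤ.*-identityʳ (ℤ.+ m)) (ℤ.*-identityʳ (ℤ.+ n)) le′)

fraction : ∀ p → 0ℚ ≤ℚ p → ∃ λ num → ∃ λ den → 1 ≤ den × p *ℚ ℕ→ℚ den ≡ ℕ→ℚ num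
fraction (mkℚ ℤ.-[1+ _ ] _ _) (ℚ.*≤* ())
fraction p@(mkℚ (ℤ.+ num) den-1 _) _ = num , suc den-1 , s≤s z≤n , ℚ.toℚᵘ-injective (ℚᵘ.≃-trans
  (ℚᵘ.≃-trans (ℚ.toℚᵘ-homo-* p (ℕ→ℚ (suc den-1))) (ℚᵘ.*-cong {mkℚᵘ (ℤ.+ num) den-1} ℚᵘ.≃-refl (toℚᵘ-ℕ→ℚ (suc den-1))))
  (ℚᵘ.≃-trans (*≡* (trans (ℤ.*-identityʳ _) (cong (ℤ.+ num ℤ.*_) (sym (ℤ.*-identityʳ (ℤ.+ suc den-1))))))
    (ℚᵘ.≃-sym (toℚᵘ-ℕ→ℚ num))))

ℕ→ℚ-nonNeg : ∀ n → ℚ.NonNegative (ℕ→ℚ n)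
ℕ→ℚ-nonNeg n = ℚ.nonNegative (ℕ→ℚ-mono-≤ {0} {n} z≤n)

ℕ→ℚ-pos : ∀ {n} → 1 ≤ n → ℚ.Positive (ℕ→ℚ n)
ℕ→ℚ-pos {n} 1≤n = ℚ.positive (ℚ.<-≤-trans {0ℚ} {1ℚ} (ℚ.positive⁻¹ 1ℚ) (ℕ→ℚ-mono-≤ 1≤n))

fraction-≤ : ∀ p num den u v → 1 ≤ den → p *ℚ ℕ→ℚ den ≡ ℕ→ℚ num → p *ℚ ℕ→ℚ u ≤ℚ ℕ→ℚ v → num * u ≤ den * v
fraction-≤ p num den u v 1≤den e le = ℕ→ℚ-cancel-≤ (subst₂ _≤ℚ_
  (trans (lem p (ℕ→ℚ u) (ℕ→ℚ den)) (trans (cong (_*ℚ ℕ→ℚ u) e) (sym (ℕ→ℚ-* num u))))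
  (trans (ℚ.*-comm (ℕ→ℚ v) (ℕ→ℚ den)) (sym (ℕ→ℚ-* den v)))
  (ℚ.*-monoʳ-≤-nonNeg (ℕ→ℚ den) {{ℕ→ℚ-nonNeg den}} le))
  where
  open +-*-Solver
  lem : ∀ p u d → p *ℚ u *ℚ d ≡ p *ℚ d *ℚ u
  lem = solve 3 (λ p u d → p :* u :* d := p :* d :* u) refl

*-^ℚ : ∀ p q m → (p *ℚ q) ^ℚ m ≡ p ^ℚ m *ℚ q ^ℚ m
*-^ℚ p q zero = refl
*-^ℚ p q (suc m) = trans (cong (p *ℚ q *ℚ_) (*-^ℚ p q m)) (lem p q (p ^ℚ m) (q ^ℚ m))
  where
  open +-*-Solver
  lem : ∀ a b c d → a *ℚ b *ℚ (c *ℚ d) ≡ a *ℚ c *ℚ (b *ℚ d)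
  lem = solve 4 (λ a b c d → a :* b :* (c :* d) := a :* c :* (b :* d)) refl

sumℚ-++ : ∀ xs ys → sumℚ (xs ++ ys) ≡ sumℚ xs +ℚ sumℚ ys
sumℚ-++ [] ys = sym (ℚ.+-identityˡ _)
sumℚ-++ (x ∷ xs) ys = trans (cong (x +ℚ_) (sumℚ-++ xs ys)) (sym (ℚ.+-assoc x _ _))

sumℚ-map-* : {A : Set} (c : ℚ) (g h : A → ℚ) (xs : List A) → (∀ {x} → x ∈ xs → g x ≡ c *ℚ h x) →
  sumℚ (map g xs) ≡ c *ℚ sumℚ (map h xs)
sumℚ-map-* c g h [] _ = sym (ℚ.*-zeroʳ c)
sumℚ-map-* c g h (x ∷ xs) e = trans (cong₂ _+ℚ_ (e (here refl)) (sumℚ-map-* c g h xs (e ∘ there))) (sym (ℚ.*-distribˡ-+ c _ _))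

sublists-length : {A : Set} (xs : List A) {L : List A} → L ∈ sublists xs → length L ≤ length xs
sublists-length [] (here refl) = z≤n
sublists-length (x ∷ xs) m with ∈-++⁻ (map (x ∷_) (sublists xs)) m
... | inj₂ m′ = m≤n⇒m≤1+n (sublists-length xs m′)
... | inj₁ m′ with ∈-map⁻ (x ∷_) m′
... | L , L∈ , refl = s≤s (sublists-length xs L∈)

outcome : ℚ → ℚ → {A : Set} → ℕ → (List A → Bool) → List A → ℚ
outcome p q M f L = if f L then p ^ℚ length L *ℚ q ^ℚ (M ∸ length L) else 0ℚ

-- Conditioning on the first potential edge is the recursion of `𝔼`, once one factor of the common
-- denominator b is multiplied in.
probability-𝔼 : {A : Set} (p q : ℚ) (a b c : ℕ) → p *ℚ ℕ→ℚ b ≡ ℕ→ℚ a → q *ℚ ℕ→ℚ b ≡ ℕ→ℚ c →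
  (xs : List A) (f : List A → Bool) →
  sumℚ (map (outcome p q (length xs) f) (sublists xs)) *ℚ ℕ→ℚ (b ^ length xs) ≡ ℕ→ℚ (𝔼 a c (λ W → indicator (f (select xs W))))
probability-𝔼 p q a b c pa qc [] f with f []
... | true = refl
... | false = refl
probability-𝔼 p q a b c pa qc (x ∷ xs) f = begin
    sumℚ (map (outcome p q (suc M) f) (map (x ∷_) (sublists xs) ++ sublists xs)) *ℚ ℕ→ℚ (b * b ^ M)
  ≡⟨ cong₂ _*ℚ_ (trans (cong sumℚ (List.map-++ (outcome p q (suc M) f) (map (x ∷_) (sublists xs)) (sublists xs)))
       (trans (sumℚ-++ (map (outcome p q (suc M) f) (map (x ∷_) (sublists xs))) _)
         (cong₂ _+ℚ_ (trans (cong sumℚ (sym (List.map-∘ (sublists xs))))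
           (sumℚ-map-* p (outcome p q (suc M) f ∘ (x ∷_)) (outcome p q M (f ∘ (x ∷_))) (sublists xs) (λ {L} _ → present L)))
           (sumℚ-map-* q (outcome p q (suc M) f) (outcome p q M f) (sublists xs) (λ {L} m → absent L (sublists-length xs m))))))
       (ℕ→ℚ-* b (b ^ M)) ⟩
    (p *ℚ A₁ +ℚ q *ℚ A₀) *ℚ (ℕ→ℚ b *ℚ ℕ→ℚ (b ^ M))
  ≡⟨ lem p q A₁ A₀ (ℕ→ℚ b) (ℕ→ℚ (b ^ M)) ⟩
    p *ℚ ℕ→ℚ b *ℚ (A₁ *ℚ ℕ→ℚ (b ^ M)) +ℚ q *ℚ ℕ→ℚ b *ℚ (A₀ *ℚ ℕ→ℚ (b ^ M))
  ≡⟨ cong₂ _+ℚ_ (cong₂ _*ℚ_ pa (probability-𝔼 p q a b c pa qc xs (f ∘ (x ∷_)))) (cong₂ _*ℚ_ qc (probability-𝔼 p q a b c pa qc xs f)) ⟩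
    ℕ→ℚ a *ℚ ℕ→ℚ E₁ +ℚ ℕ→ℚ c *ℚ ℕ→ℚ E₀
  ≡⟨ sym (trans (ℕ→ℚ-+ (a * E₁) (c * E₀)) (cong₂ _+ℚ_ (ℕ→ℚ-* a E₁) (ℕ→ℚ-* c E₀))) ⟩
    ℕ→ℚ (a * E₁ + c * E₀) ∎
  where
  open ≡-Reasoning
  open +-*-Solver
  M = length xs
  A₁ = sumℚ (map (outcome p q M (f ∘ (x ∷_))) (sublists xs))
  A₀ = sumℚ (map (outcome p q M f) (sublists xs))
  E₁ = 𝔼 a c (λ W → indicator (f (x ∷ select xs W)))
  E₀ = 𝔼 a c (λ W → indicator (f (select xs W)))
  lem : ∀ p q x y b z → (p *ℚ x +ℚ q *ℚ y) *ℚ (b *ℚ z) ≡ p *ℚ b *ℚ (x *ℚ z) +ℚ q *ℚ b *ℚ (y *ℚ z)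
  lem = solve 6 (λ p q x y b z → (p :* x :+ q :* y) :* (b :* z) := p :* b :* (x :* z) :+ q :* b :* (y :* z)) refl
  present : ∀ L → outcome p q (suc M) f (x ∷ L) ≡ p *ℚ outcome p q M (f ∘ (x ∷_)) L
  present L with f (x ∷ L)
  ... | true = ℚ.*-assoc p _ _
  ... | false = sym (ℚ.*-zeroʳ p)
  -- The subtraction is truncated; the bound on the length ensures that the absent edge does
  -- contribute its factor q.
  absent : ∀ L → length L ≤ M → outcome p q (suc M) f L ≡ q *ℚ outcome p q M f L
  absent L le with f L
  ... | true = trans (cong (λ z → p ^ℚ length L *ℚ q ^ℚ z) (+-∸-assoc 1 le)) (swap₃ (p ^ℚ length L) q (q ^ℚ (M ∸ length L)))
    where
    swap₃ : ∀ a b c → a *ℚ (b *ℚ c) ≡ b *ℚ (a *ℚ c)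
    swap₃ = solve 3 (λ a b c → a :* (b :* c) := b :* (a :* c)) refl
  ... | false = sym (ℚ.*-zeroʳ q)

fraction-pos : ∀ p num den → 1 ≤ den → p *ℚ ℕ→ℚ den ≡ ℕ→ℚ num → 0ℚ <ℚ p → 1 ≤ num
fraction-pos p zero den 1≤den e 0<p = ⊥-elim (ℚ.<-irrefl refl (subst₂ _<ℚ_ (ℚ.*-zeroˡ (ℕ→ℚ den)) e
  (ℚ.*-monoˡ-<-pos (ℕ→ℚ den) {{ℕ→ℚ-pos 1≤den}} 0<p)))
fraction-pos p (suc num) _ _ _ _ = s≤s z≤n

fraction-^ : ∀ p num den r → p *ℚ ℕ→ℚ den ≡ ℕ→ℚ num → p ^ℚ r *ℚ ℕ→ℚ (den ^ r) ≡ ℕ→ℚ (num ^ r)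
fraction-^ p num den r e = begin
    p ^ℚ r *ℚ ℕ→ℚ (den ^ r)
  ≡⟨ cong (p ^ℚ r *ℚ_) (ℕ→ℚ-^ den r) ⟩
    p ^ℚ r *ℚ ℕ→ℚ den ^ℚ r
  ≡⟨ sym (*-^ℚ p (ℕ→ℚ den) r) ⟩
    (p *ℚ ℕ→ℚ den) ^ℚ r
  ≡⟨ trans (cong (_^ℚ r) e) (sym (ℕ→ℚ-^ num r)) ⟩
    ℕ→ℚ (num ^ r) ∎
  where open ≡-Reasoning

fraction-≥1 : ∀ p num den X → p *ℚ ℕ→ℚ den ≡ ℕ→ℚ num → 1ℚ ≤ℚ p *ℚ ℕ→ℚ X → den ≤ num * X
fraction-≥1 p num den X e le = ℕ→ℚ-cancel-≤ (subst₂ _≤ℚ_ (ℚ.*-identityˡ (ℕ→ℚ den))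
  (trans (lem p (ℕ→ℚ X) (ℕ→ℚ den)) (trans (cong (_*ℚ ℕ→ℚ X) e) (sym (ℕ→ℚ-* num X))))
  (ℚ.*-monoʳ-≤-nonNeg (ℕ→ℚ den) {{ℕ→ℚ-nonNeg den}} le))
  where
  open +-*-Solver
  lem : ∀ p x d → p *ℚ x *ℚ d ≡ p *ℚ d *ℚ x
  lem = solve 3 (λ p x d → p :* x :* d := p :* d :* x) refl

fraction-≤1 : ∀ p num den → p *ℚ ℕ→ℚ den ≡ ℕ→ℚ num → p ≤ℚ 1ℚ → num ≤ den
fraction-≤1 p num den e le = ℕ→ℚ-cancel-≤ (subst₂ _≤ℚ_ e (ℚ.*-identityˡ (ℕ→ℚ den))
  (ℚ.*-monoʳ-≤-nonNeg (ℕ→ℚ den) {{ℕ→ℚ-nonNeg den}} le))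

fraction-complement : ∀ p num den → p *ℚ ℕ→ℚ den ≡ ℕ→ℚ num → num ≤ den → (1ℚ - p) *ℚ ℕ→ℚ den ≡ ℕ→ℚ (den ∸ num)
fraction-complement p num den e le = begin
    (1ℚ - p) *ℚ ℕ→ℚ den
  ≡⟨ l₁ p (ℕ→ℚ den) ⟩
    ℕ→ℚ den - p *ℚ ℕ→ℚ den
  ≡⟨ cong₂ _-_ (trans (cong ℕ→ℚ (sym (m+[n∸m]≡n le))) (ℕ→ℚ-+ num (den ∸ num))) e ⟩
    ℕ→ℚ num +ℚ ℕ→ℚ (den ∸ num) - ℕ→ℚ num
  ≡⟨ l₂ (ℕ→ℚ num) (ℕ→ℚ (den ∸ num)) ⟩
    ℕ→ℚ (den ∸ num) ∎
  where
  open ≡-Reasoning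
  open +-*-Solver
  l₁ : ∀ p d → (1ℚ - p) *ℚ d ≡ d - p *ℚ d
  l₁ = solve 2 (λ p d → (con 1ℚ :- p) :* d := d :- p :* d) refl
  l₂ : ∀ a b → a +ℚ b - a ≡ b
  l₂ = solve 2 (λ a b → a :+ b :- a := b) refl

fraction-scale : ∀ p num den r → p *ℚ ℕ→ℚ den ≡ ℕ→ℚ num → p *ℚ ℕ→ℚ (r * den) ≡ ℕ→ℚ (r * num)
fraction-scale p num den r e = trans (cong (p *ℚ_) (ℕ→ℚ-* r den)) (trans (lem p (ℕ→ℚ r) (ℕ→ℚ den))
  (trans (cong (ℕ→ℚ r *ℚ_) e) (sym (ℕ→ℚ-* r num))))
  where
  open +-*-Solver
  lem : ∀ p r d → p *ℚ (r *ℚ d) ≡ r *ℚ (p *ℚ d)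
  lem = solve 3 (λ p r d → p :* (r :* d) := r :* (p :* d)) refl

-- With Z = b^M, X/Z is the probability of the event.
1-δ≤ : ∀ P δ δnum δden Z X y c → 1 ≤ Z → 1 ≤ y → 1 ≤ δden → 1 ≤ δnum → P *ℚ ℕ→ℚ Z ≡ ℕ→ℚ X → δ *ℚ ℕ→ℚ δden ≡ ℕ→ℚ δnum →
  Z * y ≤ X * y + c * Z → c * δden ≤ y → 1ℚ - δ ≤ℚ P
1-δ≤ P δ δnum δden Z X y c 1≤Z 1≤y 1≤δden 1≤δnum eP eδ le c≤y =
  subst (1ℚ - δ ≤ℚ_) (l₃ P δ) (ℚ.+-monoˡ-≤ (ℚ.- δ) (ℚ.*-cancelʳ-≤-pos {1ℚ} {P +ℚ δ} (ℕ→ℚ (Z * δden)) {{ℕ→ℚ-pos (*-mono-≤ 1≤Z 1≤δden)}}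
    (subst₂ _≤ℚ_ (sym (ℚ.*-identityˡ (ℕ→ℚ (Z * δden)))) right (ℕ→ℚ-mono-≤ main))))
  where
  open +-*-Solver
  l₁ : ∀ z y d → z * d * y ≡ z * y * d
  l₁ = solve-∀
  l₂ : ∀ x y c z d → (x * y + c * z) * d ≡ x * d * y + z * (c * d)
  l₂ = solve-∀
  l₄ : ∀ x z n y → x * y + z * y ≡ (x + z * 1) * y
  l₄ = solve-∀
  l₃ : ∀ P δ → P +ℚ δ +ℚ (ℚ.- δ) ≡ P
  l₃ = solve 2 (λ P δ → P :+ δ :+ (:- δ) := P) refl
  main : Z * δden ≤ X * δden + Z * δnum
  main = *-cancelʳ-≤ _ _ y {{>-nonZero 1≤y}} (begin
      Z * δden * y
    ≡⟨ l₁ Z y δden ⟩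
      Z * y * δden
    ≤⟨ *-monoˡ-≤ δden le ⟩
      (X * y + c * Z) * δden
    ≡⟨ l₂ X y c Z δden ⟩
      X * δden * y + Z * (c * δden)
    ≤⟨ +-monoʳ-≤ (X * δden * y) (*-monoʳ-≤ Z c≤y) ⟩
      X * δden * y + Z * y
    ≡⟨ l₄ (X * δden) Z δnum y ⟩
      (X * δden + Z * 1) * y
    ≤⟨ *-monoˡ-≤ y (+-monoʳ-≤ (X * δden) (*-monoʳ-≤ Z 1≤δnum)) ⟩
      (X * δden + Z * δnum) * y ∎)
    where open ≤-Reasoning
  right : ℕ→ℚ (X * δden + Z * δnum) ≡ (P +ℚ δ) *ℚ ℕ→ℚ (Z * δden)
  right = begin
      ℕ→ℚ (X * δden + Z * δnum)
    ≡⟨ trans (ℕ→ℚ-+ (X * δden) (Z * δnum)) (cong₂ _+ℚ_ (ℕ→ℚ-* X δden) (ℕ→ℚ-* Z δnum)) ⟩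
      ℕ→ℚ X *ℚ ℕ→ℚ δden +ℚ ℕ→ℚ Z *ℚ ℕ→ℚ δnum
    ≡⟨ cong₂ (λ x d → x *ℚ ℕ→ℚ δden +ℚ ℕ→ℚ Z *ℚ d) (sym eP) (sym eδ) ⟩
      P *ℚ ℕ→ℚ Z *ℚ ℕ→ℚ δden +ℚ ℕ→ℚ Z *ℚ (δ *ℚ ℕ→ℚ δden)
    ≡⟨ l₅ P δ (ℕ→ℚ Z) (ℕ→ℚ δden) ⟩
      (P +ℚ δ) *ℚ (ℕ→ℚ Z *ℚ ℕ→ℚ δden)
    ≡⟨ cong ((P +ℚ δ) *ℚ_) (sym (ℕ→ℚ-* Z δden)) ⟩
      (P +ℚ δ) *ℚ ℕ→ℚ (Z * δden) ∎
    where
    open ≡-Reasoning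
    l₅ : ∀ P δ z d → P *ℚ z *ℚ d +ℚ z *ℚ (δ *ℚ d) ≡ (P +ℚ δ) *ℚ (z *ℚ d)
    l₅ = solve 4 (λ P δ z d → P :* z :* d :+ z :* (δ :* d) := (P :+ δ) :* (z :* d)) refl

-- From p ≥ n^(-d - 1/r) and n^(1/r) < y + 1. To avoid real roots, the r-th powers are compared and
-- the negation is refuted.
density-bound : ∀ num den n d r y → 1 ≤ r → den ^ r ≤ num ^ r * n ^ (d * r + 1) → n < suc y ^ r → den ≤ num * n ^ d * suc y
density-bound num den n d r y 1≤r le n< with den ≤? num * n ^ d * suc y
... | yes p = p
... | no ¬p = ⊥-elim (<⇒≱ (^-monoˡ-< r {{>-nonZero 1≤r}} (≰⇒> ¬p)) (begin
    den ^ r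
  ≤⟨ le ⟩
    num ^ r * n ^ (d * r + 1)
  ≡⟨ cong (num ^ r *_) (trans (^-distribˡ-+-* n (d * r) 1) (cong₂ _*_ (sym (^-*-assoc n d r)) (*-identityʳ n))) ⟩
    num ^ r * ((n ^ d) ^ r * n)
  ≤⟨ *-monoʳ-≤ (num ^ r) (*-monoʳ-≤ ((n ^ d) ^ r) (<⇒≤ n<)) ⟩
    num ^ r * ((n ^ d) ^ r * suc y ^ r)
  ≡⟨ sym (trans (*-^ (num * n ^ d) (suc y) r) (trans (cong (_* suc y ^ r) (*-^ num (n ^ d) r)) (*-assoc (num ^ r) _ _))) ⟩
    (num * n ^ d * suc y) ^ r ∎))
  where open ≤-Reasoning

m≤m^r : ∀ m r → 1 ≤ m → 1 ≤ r → m ≤ m ^ r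
m≤m^r m (suc r) 1≤m _ = m≤m*n m (m ^ r) {{m^n≢0 m r {{>-nonZero 1≤m}}}}

theorem1p7 : (k ℓ : ℕ) → 3 ≤ k → 2 ≤ ℓ → ℓ < k →
    (ε : ℚ) → 0ℚ <ℚ ε →
    Σ ℕ (λ m → 1 ≤ m × Σ ℕ (λ C → 1 ≤ C ×
    ((δ : ℚ) → 0ℚ <ℚ δ →
    Σ ℕ (λ n₀ → (n : ℕ) → n₀ ≤ n → (k ∸ ℓ) ∣ n →
    (H : KGraph n) → ε *ℚ ℕ→ℚ (n ^ k) ≤ℚ ℕ→ℚ (numEdges n k H) →
    (p : ℚ) → p ≤ℚ 1ℚ →
    0ℚ ≤ℚ p → 1ℚ ≤ℚ p ^ℚ m *ℚ ℕ→ℚ (n ^ ((k ∸ ℓ) * m + 1)) →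
    HamProbAtLeast k ℓ n H p (1ℚ - δ)))))
theorem1p7 k ℓ 3≤k 2≤ℓ ℓ<k ε 0<ε with fraction ε (ℚ.<⇒≤ 0<ε)
-- The first witness means η = 1 / r, in the form p^r n^(dr + 1) ≥ 1. E is the denominator of ε, and
-- ε ≥ 1 / E.
... | εnum , E , E≥1 , ε≡ = r , r≥1 , 1 , ≤-refl , bound
  where
  T = 2 * E * (k * k)
  r = 16 * T
  G = (2 * k * (16 * E)) ^ k
  d = k ∸ ℓ
  k≥1 : 1 ≤ k
  k≥1 = ≤-trans (s≤s z≤n) 3≤k
  r≥1 : 1 ≤ r
  r≥1 = *-mono-≤ {1} {16} (s≤s z≤n) (*-mono-≤ (*-mono-≤ {1} {2} (s≤s z≤n) E≥1) (*-mono-≤ k≥1 k≥1))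
  module Large (δ : ℚ) (0<δ : 0ℚ <ℚ δ) (δnum δden : ℕ) (δden≥1 : 1 ≤ δden) (δ≡ : δ *ℚ ℕ→ℚ δden ≡ ℕ→ℚ δnum) where
    Y : ℕ
    -- The summands provide for l ≥ 4, the constants in the spread, a failure probability 4r / y ≤ 1
    -- / δden ≤ δ, and n at least k and 2dT. From n ≥ Y^r it follows that y ≥ Y.
    Y = 4 + (4 * (G * r) + (4 * r * δden + (k + d * (2 * T))))
    module At (n : ℕ) (n₀≤n : Y ^ r ≤ n) (d∣n : d ∣ n) (H : KGraph n) (dense : ε *ℚ ℕ→ℚ (n ^ k) ≤ℚ ℕ→ℚ (numEdges n k H))
      (p : ℚ) (p≤1 : p ≤ℚ 1ℚ) (p-large : 1ℚ ≤ℚ p ^ℚ r *ℚ ℕ→ℚ (n ^ (d * r + 1)))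
      (num den : ℕ) (den≥1 : 1 ≤ den) (p≡ : p *ℚ ℕ→ℚ den ≡ ℕ→ℚ num)
      (y : ℕ) (y≤n : y ^ r ≤ n) (n<y : n < suc y ^ r) where
      Y≤y : Y ≤ y
      Y≤y = ≮⇒≥ (λ y<Y → <⇒≱ n<y (≤-trans (^-monoˡ-≤ r y<Y) n₀≤n))
      Y≤n : Y ≤ n
      Y≤n = ≤-trans Y≤y (≤-trans (m≤m^r y r (≤-trans (s≤s z≤n) Y≤y) r≥1) y≤n)
      4≤y : 4 ≤ y
      4≤y = ≤-trans (m≤m+n 4 _) Y≤y
      num≤den : num ≤ den
      num≤den = fraction-≤1 p num den p≡ p≤1
      den^r≤ : den ^ r ≤ num ^ r * n ^ (d * r + 1)
      den^r≤ = fraction-≥1 (p ^ℚ r) (num ^ r) (den ^ r) (n ^ (d * r + 1)) (fraction-^ p num den r p≡) p-large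
      num≥1 : 1 ≤ num
      num≥1 = n≢0⇒n>0 (λ num≡0 → <⇒≱ (m^n>0 den {{>-nonZero den≥1}} r)
        (≤-trans den^r≤ (≤-reflexive (cong (_* n ^ (d * r + 1)) (trans (cong (_^ r) num≡0) (0^r r r≥1))))))
        where
        0^r : ∀ r → 1 ≤ r → 0 ^ r ≡ 0
        0^r (suc r) _ = refl
      dense′ : n ^ k ≤ E * numEdges n k H
      dense′ = ≤-trans (m≤n*m (n ^ k) εnum {{>-nonZero (fraction-pos ε εnum E E≥1 ε≡ 0<ε)}}) (fraction-≤ ε εnum E (n ^ k) (numEdges n k H) E≥1 ε≡ dense)
      instance
        n≢0 : NonZero n
        n≢0 = >-nonZero (≤-trans (s≤s z≤n) Y≤n)
      open Finite n k ℓ E y num den H 2≤ℓ ℓ<k E≥1 d∣n using (b; module Main)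
      open Main dense′ 4≤y (≤-trans (≤-trans (m≤m+n (4 * (G * r)) _) (m≤n+m _ 4)) Y≤y) y≤n n<y num≤den num≥1
        (density-bound num den n d r y r≥1 den^r≤ n<y)
        (≤-trans (≤-trans (≤-trans (m≤m+n k _) (m≤n+m _ (4 * r * δden))) (≤-trans (m≤n+m _ (4 * (G * r))) (m≤n+m _ 4))) Y≤n)
        (≤-trans (≤-trans (≤-trans (m≤n+m (d * (2 * T)) k) (m≤n+m _ (4 * r * δden))) (≤-trans (m≤n+m _ (4 * (G * r))) (m≤n+m _ 4))) Y≤n)
        using (good; good-Hamiltonian; mostly-good; a; c)
      M = length (kSets n k)
      Hamiltonian-likely : HamProbAtLeast k ℓ n H p (1ℚ - δ)
      Hamiltonian-likely = good , (λ L _ → good-Hamiltonian L) , 1-δ≤ (sumℚ (map (λ L → if good L then weight n k p L else 0ℚ) (sublists (kSets n k)))) δ δnum δden (b ^ M) (𝔼 a c (λ W → indicator (good (select (kSets n k) W)))) y (4 * r)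
        (m^n>0 b {{>-nonZero (*-mono-≤ r≥1 den≥1)}} M) (≤-trans (s≤s z≤n) 4≤y) δden≥1 (fraction-pos δ δnum δden δden≥1 δ≡ 0<δ)
        (probability-𝔼 p (1ℚ - p) a b c (fraction-scale p num den r p≡) (fraction-scale (1ℚ - p) (den ∸ num) den r (fraction-complement p num den p≡ num≤den)) (kSets n k) good)
        δ≡ mostly-good
        (≤-trans (≤-trans (m≤m+n (4 * r * δden) _) (≤-trans (m≤n+m _ (4 * (G * r))) (m≤n+m _ 4))) Y≤y)
  bound : (δ : ℚ) → 0ℚ <ℚ δ → Σ ℕ (λ n₀ → (n : ℕ) → n₀ ≤ n → d ∣ n → (H : KGraph n) → ε *ℚ ℕ→ℚ (n ^ k) ≤ℚ ℕ→ℚ (numEdges n k H) →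
    (p : ℚ) → p ≤ℚ 1ℚ → 0ℚ ≤ℚ p → 1ℚ ≤ℚ p ^ℚ r *ℚ ℕ→ℚ (n ^ (d * r + 1)) → HamProbAtLeast k ℓ n H p (1ℚ - δ))
  bound δ 0<δ =
    let (δnum , δden , δden≥1 , δ≡) = fraction δ (ℚ.<⇒≤ 0<δ) in
    Large.Y δ 0<δ δnum δden δden≥1 δ≡ ^ r , λ n n₀≤n d∣n H dense p p≤1 0≤p p-large →
      let (num , den , den≥1 , p≡) = fraction p 0≤p
          (y , y≤n , n<y) = integer-root r n r≥1
      in Large.At.Hamiltonian-likely δ 0<δ δnum δden δden≥1 δ≡ n n₀≤n d∣n H dense p p≤1 p-large num den den≥1 p≡ y y≤n n<y
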